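{- Let $r\ge 1$ and $c$ be integers, and let $q,Z$ be indeterminates. For $n\ge 0$ put $$P_n(x)=p_n\big(q^{ -c}(1+(q-1)x);\,Zq^{ -r},\,1\mid q^r\big)\in\mathbb{Q}(q,Z)[x],$$ the shifted little $q$-Jacobi polynomials (base $q^r$, parameters $a=Zq^{ -r}$, $b=1$). Let $\mu_n=\varphi(x^n)$ be the $n$th moment of the sequence $(P_n(x))_{n\ge0}$, where $\varphi$ is the linear functional, normalized by $\varphi(1)=1$, with respect to which $(P_n(x))_{n\ge 0}$ is orthogonal. Then for all $n\ge 0$ $$\mu_n=(1-Z)\sum_{k\ge 0}\big([rk+c]_q\big)^n Z^k .$$ Moreover, if $c=1$, then for all $n\ge 1$ $$\mu_n=\frac{G_{r,n}(Z,q)}{(Zq^r;q^r)_n},$$ where $G_{r,n}(Z,q)=\sum_{\gamma\in G(r,n)}Z^{\mathrm{des}_G(\gamma)}q^{\mathrm{fmaj}(\gamma)}$ is the generating polynomial of the group $G(r,n)$ of $r$-coloured permutations.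
   Context: Notation: $[m]_q=\frac{1-q^m}{1-q}$ for $m\in\mathbb{Z}$, and $(a;q)_n=(1-a)(1-aq)\cdots(1-aq^{n-1})$. Little $q$-Jacobi polynomials (with base $q$): $$p_n(x;a,b\mid q)=\sum_{k=0}^{n}\frac{(q^{ -n};q)_k\,(abq^{n+1};q)_k}{(aq;q)_k\,(q;q)_k}(qx)^k .$$ In $p_n(x;a,b\mid q^r)$ every $q$ in this formula is replaced by $q^r$. Orthogonality: for a field $\mathbb{K}$ and a linear functional $\varphi:\mathbb{K}[x]\to\mathbb{K}$, a sequence $(P_n(x))_{n\ge0}$ in $\mathbb{K}[x]$ with $\deg P_n=n$ is orthogonal with respect to $\varphi$ if $\varphi(P_nP_{m})=K_n\delta_{n,m}$ with $K_n\ne0$ for all $n,m\ge 0$. The functional is uniquely determined by the sequence once $\varphi(1)$ is fixed; the normalization here is $\varphi(1)=1$. Here $\mathbb{K}=\mathbb{Q}(q,Z)$. The moments are rational functions in $q$ and $Z$, and the infinite sum over $k$ is understood as an expansion as a formal power series in $Z$ with coefficients in $\mathbb{Q}(q)$. Coloured permutations: for $r,n\ge1$, $G(r,n)=\{(c_1,\dots,c_n;\sigma): c_i\in\{0,\dots,r-1\},\ \sigma\in S_n\}$, and an element is written $\gamma=[\gamma(1),\dots,\gamma(n)]=[\sigma(1)^{c_1},\dots,\sigma(n)^{c_n}]$. The possible values are totally ordered, together with the symbol $0$, by $$n^{r-1}<\dots<n^1<\dots<1^{r-1}<\dots<1^1<0<1^0<\dots<n^0 .$$ Set $\gamma(0):=0$,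 $\mathrm{Des}_G(\gamma)=\{i\in\{0,\dots,n-1\}:\gamma(i)>\gamma(i+1)\}$, $\mathrm{des}_G(\gamma)=|\mathrm{Des}_G(\gamma)|$, $\mathrm{maj}(\gamma)=\sum_{i\in\mathrm{Des}_G(\gamma)}i$, $\mathrm{col}(\gamma)=\sum_{i=1}^n c_i$, and $\mathrm{fmaj}(\gamma)=r\cdot\mathrm{maj}(\gamma)+\mathrm{col}(\gamma)$. -}

module Defs where

open import Algebra.Bundles using (CommutativeRing; Semiring)
open import Algebra.Module.Bundles using (LeftModule)
import Algebra.Definitions.RawSemiring as RawSemiringDefs
import Algebra.Module.Construct.TensorUnit as TensorUnit
import Algebra.Module.Morphism.Structures as ModuleMorphisms
import Algebra.Properties.CommutativeSemigroup as CommutativeSemigroupProperties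
import Algebra.Properties.Monoid.Sum as MonoidSum
import Algebra.Properties.Ring as RingProperties
import Algebra.Solver.Ring.NaturalCoefficients.Default as SemiringSolver
open import Data.Fin.Base as Fin using (Fin; toℕ; inject₁)
import Data.Fin.Properties as Fin
open import Data.Integer.Base as ℤ using (ℤ; +_; -[1+_])
open import Data.List.Base as List using (List; []; _∷_)
open import Data.Nat.Base as ℕ using (ℕ; zero; suc; _∸_)
import Data.Nat.Properties as ℕ
open import Data.Product.Base using (Σ-syntax; _×_; _,_; proj₁; proj₂)
import Data.Rational.Base as ℚ
import Data.Rational.Properties as ℚ
open import Data.Vec.Base as Vec using (Vec; []; _∷_)
open import Data.Vec.Relation.Unary.AllPairs using (allPairs?)
open import Data.Vec.Relation.Unary.Unique.Propositional using (Unique)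
open import Level using (0ℓ)
open import Relation.Binary.Definitions using (Decidable)
import Relation.Binary.Reasoning.Setoid as SetoidReasoning
open import Relation.Binary.PropositionalEquality.Core as ≡ using (_≡_)
open import Relation.Nullary.Decidable.Core using (Dec; yes; no; map′; ¬?)
open import Relation.Nullary.Negation.Core using (¬_; contradiction)
import Relation.Unary as U

-- A field with decidable equality; the inverse is total with the convention 0⁻¹ = 0.
record Field : Set₁ where
  infix 9 _⁻¹
  infixl 7 _÷_
  infix 4 _≟_
  field
    commutativeRing : CommutativeRing 0ℓ 0ℓ
  open CommutativeRing commutativeRing public
  field
    _≟_       : Decidable _≈_
    1≉0       : ¬ (1# ≈ 0#)
    _⁻¹       : Carrier → Carrier
    ⁻¹-inverse : ∀ x → ¬ (x ≈ 0#) → x * x ⁻¹ ≈ 1#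
    ⁻¹-zero    : ∀ x → x ≈ 0# → x ⁻¹ ≈ 0#

  _÷_ : Carrier → Carrier → Carrier
  x ÷ y = x * y ⁻¹

  open RawSemiringDefs (Semiring.rawSemiring semiring) public using (_^_)

  infixr 8 _^ℤ_
  _^ℤ_ : Carrier → ℤ → Carrier
  x ^ℤ (+ n)    = x ^ n
  x ^ℤ -[1+ n ] = (x ^ suc n) ⁻¹

-- Coefficient lists, constant term first.
module Polynomials (R : CommutativeRing 0ℓ 0ℓ) where

  open CommutativeRing R

  Poly : Set
  Poly = List Carrier

  coeff : Poly → ℕ → Carrier
  coeff []      _       = 0#
  coeff (a ∷ f) zero    = a
  coeff (a ∷ f) (suc n) = coeff f n

  -- Equality ignores trailing zeros.
  infix 4 _≈ₚ_
  record _≈ₚ_ (f g : Poly) : Set where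
    constructor coeffwise
    field coeff-≈ : ∀ n → coeff f n ≈ coeff g n
  open _≈ₚ_ public

  infixl 6 _+ₚ_
  _+ₚ_ : Poly → Poly → Poly
  []      +ₚ g       = g
  (a ∷ f) +ₚ []      = a ∷ f
  (a ∷ f) +ₚ (b ∷ g) = a + b ∷ f +ₚ g

  infixr 7 _·ₚ_
  _·ₚ_ : Carrier → Poly → Poly
  a ·ₚ f = List.map (a *_) f

  -ₚ_ : Poly → Poly
  -ₚ f = List.map -_ f

  infixl 7 _*ₚ_
  _*ₚ_ : Poly → Poly → Poly
  []      *ₚ g = []
  (a ∷ f) *ₚ g = a ·ₚ g +ₚ (0# ∷ f *ₚ g)

  0ₚ 1ₚ X : Poly
  0ₚ = []
  1ₚ = 1# ∷ []
  X  = 0# ∷ 1# ∷ []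

  HasDegree : Poly → ℕ → Set
  HasDegree f n = ¬ (coeff f n ≈ 0#) × (∀ m → n ℕ.< m → coeff f m ≈ 0#)

  private
    open SetoidReasoning setoid
    open RingProperties ring using (-0#≈0#)
    module +C = CommutativeSemigroupProperties (CommutativeRing.+-commutativeSemigroup R)

  coeff-+ : ∀ f g n → coeff (f +ₚ g) n ≈ coeff f n + coeff g n
  coeff-+ []      g       n       = sym (+-identityˡ _)
  coeff-+ (a ∷ f) []      n       = sym (+-identityʳ _)
  coeff-+ (a ∷ f) (b ∷ g) zero    = refl
  coeff-+ (a ∷ f) (b ∷ g) (suc n) = coeff-+ f g n

  coeff-· : ∀ a f n → coeff (a ·ₚ f) n ≈ a * coeff f n
  coeff-· a []      n       = sym (zeroʳ a)
  coeff-· a (b ∷ f) zero    = refl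
  coeff-· a (b ∷ f) (suc n) = coeff-· a f n

  coeff-neg : ∀ f n → coeff (-ₚ f) n ≈ - coeff f n
  coeff-neg []      n       = sym -0#≈0#
  coeff-neg (b ∷ f) zero    = refl
  coeff-neg (b ∷ f) (suc n) = coeff-neg f n

  private
    ≈-refl : ∀ {f} → f ≈ₚ f
    ≈-refl = coeffwise λ _ → refl

    ≈-sym : ∀ {f g} → f ≈ₚ g → g ≈ₚ f
    ≈-sym (coeffwise p) = coeffwise λ n → sym (p n)

    ≈-trans : ∀ {f g h} → f ≈ₚ g → g ≈ₚ h → f ≈ₚ h
    ≈-trans (coeffwise p) (coeffwise q) = coeffwise λ n → trans (p n) (q n)

    ∷-cong : ∀ {a b f g} → a ≈ b → f ≈ₚ g → a ∷ f ≈ₚ b ∷ g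
    ∷-cong a≈b (coeffwise p) = coeffwise λ { zero → a≈b ; (suc n) → p n }

    0∷[] : 0# ∷ [] ≈ₚ []
    0∷[] = coeffwise λ { zero → refl ; (suc n) → refl }

    +-cong′ : ∀ {f f′ g g′} → f ≈ₚ f′ → g ≈ₚ g′ → f +ₚ g ≈ₚ f′ +ₚ g′
    +-cong′ {f} {f′} {g} {g′} (coeffwise p) (coeffwise q) = coeffwise λ n → begin
      coeff (f +ₚ g) n        ≈⟨ coeff-+ f g n ⟩
      coeff f n + coeff g n   ≈⟨ +-cong (p n) (q n) ⟩
      coeff f′ n + coeff g′ n ≈⟨ coeff-+ f′ g′ n ⟨
      coeff (f′ +ₚ g′) n      ∎

    +-assoc′ : ∀ f g h → (f +ₚ g) +ₚ h ≈ₚ f +ₚ (g +ₚ h)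
    +-assoc′ f g h = coeffwise λ n → begin
      coeff ((f +ₚ g) +ₚ h) n               ≈⟨ trans (coeff-+ (f +ₚ g) h n) (+-congʳ (coeff-+ f g n)) ⟩
      (coeff f n + coeff g n) + coeff h n   ≈⟨ +-assoc _ _ _ ⟩
      coeff f n + (coeff g n + coeff h n)   ≈⟨ trans (coeff-+ f (g +ₚ h) n) (+-congˡ (coeff-+ g h n)) ⟨
      coeff (f +ₚ (g +ₚ h)) n               ∎

    +-comm′ : ∀ f g → f +ₚ g ≈ₚ g +ₚ f
    +-comm′ f g = coeffwise λ n → begin
      coeff (f +ₚ g) n      ≈⟨ coeff-+ f g n ⟩
      coeff f n + coeff g n ≈⟨ +-comm _ _ ⟩
      coeff g n + coeff f n ≈⟨ coeff-+ g f n ⟨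
      coeff (g +ₚ f) n      ∎

    +-identityʳ′ : ∀ f → f +ₚ [] ≈ₚ f
    +-identityʳ′ []      = ≈-refl
    +-identityʳ′ (a ∷ f) = ≈-refl

    -‿cong′ : ∀ {f g} → f ≈ₚ g → -ₚ f ≈ₚ -ₚ g
    -‿cong′ {f} {g} (coeffwise p) = coeffwise λ n →
      trans (coeff-neg f n) (trans (-‿cong (p n)) (sym (coeff-neg g n)))

    -‿inverseʳ′ : ∀ f → f +ₚ (-ₚ f) ≈ₚ []
    -‿inverseʳ′ f = coeffwise λ n → begin
      coeff (f +ₚ (-ₚ f)) n      ≈⟨ coeff-+ f (-ₚ f) n ⟩
      coeff f n + coeff (-ₚ f) n ≈⟨ +-congˡ (coeff-neg f n) ⟩
      coeff f n + - coeff f n    ≈⟨ -‿inverseʳ _ ⟩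
      0#                         ∎

    ·-cong : ∀ {a b f g} → a ≈ b → f ≈ₚ g → a ·ₚ f ≈ₚ b ·ₚ g
    ·-cong {a} {b} {f} {g} a≈b (coeffwise p) = coeffwise λ n →
      trans (coeff-· a f n) (trans (*-cong a≈b (p n)) (sym (coeff-· b g n)))

    ·-zeroˡ : ∀ f → 0# ·ₚ f ≈ₚ []
    ·-zeroˡ f = coeffwise λ n → trans (coeff-· 0# f n) (zeroˡ _)

    ·-identityˡ : ∀ f → 1# ·ₚ f ≈ₚ f
    ·-identityˡ f = coeffwise λ n → trans (coeff-· 1# f n) (*-identityˡ _)

    ·-assoc : ∀ a b f → (a * b) ·ₚ f ≈ₚ a ·ₚ (b ·ₚ f)
    ·-assoc a b f = coeffwise λ n → begin
      coeff ((a * b) ·ₚ f) n ≈⟨ coeff-· (a * b) f n ⟩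
      a * b * coeff f n      ≈⟨ *-assoc _ _ _ ⟩
      a * (b * coeff f n)    ≈⟨ trans (coeff-· a (b ·ₚ f) n) (*-congˡ (coeff-· b f n)) ⟨
      coeff (a ·ₚ (b ·ₚ f)) n ∎

    ·-distribʳ : ∀ f a b → (a + b) ·ₚ f ≈ₚ a ·ₚ f +ₚ b ·ₚ f
    ·-distribʳ f a b = coeffwise λ n → begin
      coeff ((a + b) ·ₚ f) n                ≈⟨ coeff-· (a + b) f n ⟩
      (a + b) * coeff f n                   ≈⟨ distribʳ _ _ _ ⟩
      a * coeff f n + b * coeff f n         ≈⟨ +-cong (coeff-· a f n) (coeff-· b f n) ⟨
      coeff (a ·ₚ f) n + coeff (b ·ₚ f) n   ≈⟨ coeff-+ (a ·ₚ f) (b ·ₚ f) n ⟨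
      coeff (a ·ₚ f +ₚ b ·ₚ f) n            ∎

    ·-distribˡ : ∀ a f g → a ·ₚ (f +ₚ g) ≈ₚ a ·ₚ f +ₚ a ·ₚ g
    ·-distribˡ a f g = coeffwise λ n → begin
      coeff (a ·ₚ (f +ₚ g)) n               ≈⟨ trans (coeff-· a (f +ₚ g) n) (*-congˡ (coeff-+ f g n)) ⟩
      a * (coeff f n + coeff g n)           ≈⟨ distribˡ _ _ _ ⟩
      a * coeff f n + a * coeff g n         ≈⟨ +-cong (coeff-· a f n) (coeff-· a g n) ⟨
      coeff (a ·ₚ f) n + coeff (a ·ₚ g) n   ≈⟨ coeff-+ (a ·ₚ f) (a ·ₚ g) n ⟨
      coeff (a ·ₚ f +ₚ a ·ₚ g) n            ∎

    +-interchange : ∀ f g h k → (f +ₚ g) +ₚ (h +ₚ k) ≈ₚ (f +ₚ h) +ₚ (g +ₚ k)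
    +-interchange f g h k = coeffwise λ n → begin
      coeff ((f +ₚ g) +ₚ (h +ₚ k)) n                        ≈⟨ expand f g h k n ⟩
      (coeff f n + coeff g n) + (coeff h n + coeff k n)     ≈⟨ +C.interchange _ _ _ _ ⟩
      (coeff f n + coeff h n) + (coeff g n + coeff k n)     ≈⟨ expand f h g k n ⟨
      coeff ((f +ₚ h) +ₚ (g +ₚ k)) n                        ∎
      where
      expand : ∀ f g h k n → coeff ((f +ₚ g) +ₚ (h +ₚ k)) n
                             ≈ (coeff f n + coeff g n) + (coeff h n + coeff k n)
      expand f g h k n = trans (coeff-+ (f +ₚ g) (h +ₚ k) n) (+-cong (coeff-+ f g n) (coeff-+ h k n))

    0∷-+ : ∀ f g → 0# ∷ (f +ₚ g) ≈ₚ (0# ∷ f) +ₚ (0# ∷ g)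
    0∷-+ f g = ∷-cong (sym (+-identityˡ 0#)) ≈-refl

    *-congˡ′ : ∀ f {g h} → g ≈ₚ h → f *ₚ g ≈ₚ f *ₚ h
    *-congˡ′ []      p = ≈-refl
    *-congˡ′ (a ∷ f) p = +-cong′ (·-cong refl p) (∷-cong refl (*-congˡ′ f p))

    *-zeroʳ′ : ∀ f → f *ₚ [] ≈ₚ []
    *-zeroʳ′ []      = ≈-refl
    *-zeroʳ′ (a ∷ f) = ≈-trans (∷-cong refl (*-zeroʳ′ f)) 0∷[]

    *-∷ʳ : ∀ f b g → f *ₚ (b ∷ g) ≈ₚ b ·ₚ f +ₚ (0# ∷ f *ₚ g)
    *-∷ʳ []      b g = ≈-sym 0∷[]
    *-∷ʳ (a ∷ f) b g = ∷-cong (+-congʳ (*-comm a b))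
      (≈-trans (+-cong′ ≈-refl (*-∷ʳ f b g))
      (≈-trans (≈-sym (+-assoc′ (a ·ₚ g) (b ·ₚ f) (0# ∷ f *ₚ g)))
      (≈-trans (+-cong′ (+-comm′ (a ·ₚ g) (b ·ₚ f)) ≈-refl)
               (+-assoc′ (b ·ₚ f) (a ·ₚ g) (0# ∷ f *ₚ g)))))

    *-comm′ : ∀ f g → f *ₚ g ≈ₚ g *ₚ f
    *-comm′ []      g = ≈-sym (*-zeroʳ′ g)
    *-comm′ (a ∷ f) g =
      ≈-trans (+-cong′ ≈-refl (∷-cong refl (*-comm′ f g))) (≈-sym (*-∷ʳ g a f))

    *-cong′ : ∀ {f f′ g g′} → f ≈ₚ f′ → g ≈ₚ g′ → f *ₚ g ≈ₚ f′ *ₚ g′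
    *-cong′ {f} {f′} {g} {g′} p q =
      ≈-trans (*-congˡ′ f q) (≈-trans (*-comm′ f g′) (≈-trans (*-congˡ′ g′ p) (*-comm′ g′ f′)))

    *-distribˡ′ : ∀ f g h → f *ₚ (g +ₚ h) ≈ₚ f *ₚ g +ₚ f *ₚ h
    *-distribˡ′ []      g h = ≈-refl
    *-distribˡ′ (a ∷ f) g h =
      ≈-trans (+-cong′ (·-distribˡ a g h)
                       (≈-trans (∷-cong refl (*-distribˡ′ f g h)) (0∷-+ (f *ₚ g) (f *ₚ h))))
              (+-interchange (a ·ₚ g) (a ·ₚ h) (0# ∷ f *ₚ g) (0# ∷ f *ₚ h))

    *-distribʳ′ : ∀ f g h → (g +ₚ h) *ₚ f ≈ₚ g *ₚ f +ₚ h *ₚ f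
    *-distribʳ′ f g h = ≈-trans (*-comm′ (g +ₚ h) f)
      (≈-trans (*-distribˡ′ f g h) (+-cong′ (*-comm′ f g) (*-comm′ f h)))

    ·-*-assoc : ∀ a f g → (a ·ₚ f) *ₚ g ≈ₚ a ·ₚ (f *ₚ g)
    ·-*-assoc a []      g = ≈-refl
    ·-*-assoc a (b ∷ f) g =
      ≈-trans (+-cong′ (·-assoc a b g) (∷-cong (sym (zeroʳ a)) (·-*-assoc a f g)))
              (≈-sym (·-distribˡ a (b ·ₚ g) (0# ∷ f *ₚ g)))

    *-assoc′ : ∀ f g h → (f *ₚ g) *ₚ h ≈ₚ f *ₚ (g *ₚ h)
    *-assoc′ []      g h = ≈-refl
    *-assoc′ (a ∷ f) g h =
      ≈-trans (*-distribʳ′ h (a ·ₚ g) (0# ∷ f *ₚ g))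
              (+-cong′ (·-*-assoc a g h)
                       (+-cong′ (·-zeroˡ h) (∷-cong refl (*-assoc′ f g h))))

    *-identityˡ′ : ∀ f → 1ₚ *ₚ f ≈ₚ f
    *-identityˡ′ f = ≈-trans (+-cong′ (·-identityˡ f) 0∷[]) (+-identityʳ′ f)

  polyRing : CommutativeRing 0ℓ 0ℓ
  polyRing = record
    { Carrier = Poly
    ; _≈_ = _≈ₚ_
    ; _+_ = _+ₚ_
    ; _*_ = _*ₚ_
    ; -_  = -ₚ_
    ; 0#  = 0ₚ
    ; 1#  = 1ₚ
    ; isCommutativeRing = record
      { isRing = record
        { +-isAbelianGroup = record
          { isGroup = record
            { isMonoid = record
              { isSemigroup = record
                { isMagma = record
                  { isEquivalence = record { refl = ≈-refl ; sym = ≈-sym ; trans = ≈-trans }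
                  ; ∙-cong = +-cong′
                  }
                ; assoc = +-assoc′
                }
              ; identity = (λ _ → ≈-refl) , +-identityʳ′
              }
            ; inverse = (λ f → ≈-trans (+-comm′ (-ₚ f) f) (-‿inverseʳ′ f)) , -‿inverseʳ′
            ; ⁻¹-cong = -‿cong′
            }
          ; comm = +-comm′
          }
        ; *-cong = *-cong′
        ; *-assoc = *-assoc′
        ; *-identity = *-identityˡ′ , λ f → ≈-trans (*-comm′ f 1ₚ) (*-identityˡ′ f)
        ; distrib = *-distribˡ′ , *-distribʳ′
        }
      ; *-comm = *-comm′
      }
    }

  polyModule : LeftModule ring 0ℓ 0ℓ
  polyModule = record
    { Carrierᴹ = Poly
    ; _≈ᴹ_ = _≈ₚ_
    ; _+ᴹ_ = _+ₚ_
    ; _*ₗ_ = _·ₚ_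
    ; 0ᴹ = 0ₚ
    ; -ᴹ_ = -ₚ_
    ; isLeftModule = record
      { isLeftSemimodule = record
        { +ᴹ-isCommutativeMonoid = CommutativeRing.+-isCommutativeMonoid polyRing
        ; isPreleftSemimodule = record
          { *ₗ-cong = ·-cong
          ; *ₗ-zeroˡ = ·-zeroˡ
          ; *ₗ-distribʳ = ·-distribʳ
          ; *ₗ-identityˡ = ·-identityˡ
          ; *ₗ-assoc = ·-assoc
          ; *ₗ-zeroʳ = λ _ → ≈-refl
          ; *ₗ-distribˡ = ·-distribˡ
          }
        }
      ; -ᴹ‿cong = -‿cong′
      ; -ᴹ‿inverse = CommutativeRing.-‿inverse polyRing
      }
    }

  open RawSemiringDefs (Semiring.rawSemiring (CommutativeRing.semiring polyRing)) public
    using () renaming (_^_ to _^ₚ_)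

private
  module Identities (R : CommutativeRing 0ℓ 0ℓ) where
    open CommutativeRing R
    open SemiringSolver commutativeSemiring using (solve; _:=_; _:+_; _:*_)

    trans₁ : ∀ a d f → d * (a * f) ≈ a * d * f
    trans₁ = solve 3 (λ a d f →
      d :* (a :* f)
      := a :* d :* f) refl

    trans₂ : ∀ c b f → c * b * f ≈ c * f * b
    trans₂ = solve 3 (λ c b f →
      c :* b :* f
      := c :* f :* b) refl

    trans₃ : ∀ e d b → e * d * b ≈ d * (e * b)
    trans₃ = solve 3 (λ e d b →
      e :* d :* b
      := d :* (e :* b)) refl

    +-cong₁ : ∀ a b c d b′ d′ →
      (a * d + c * b) * (b′ * d′)
      ≈ a * b′ * (d * d′) + c * d′ * (b * b′)
    +-cong₁ = solve 6 (λ a b c d b′ d′ →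
      (a :* d :+ c :* b) :* (b′ :* d′)
      := a :* b′ :* (d :* d′) :+ c :* d′ :* (b :* b′)) refl

    +-cong₂ : ∀ a′ b′ c′ d′ b d →
      a′ * b * (d * d′) + c′ * d * (b * b′)
      ≈ (a′ * d′ + c′ * b′) * (b * d)
    +-cong₂ = solve 6 (λ a′ b′ c′ d′ b d →
      a′ :* b :* (d :* d′) :+ c′ :* d :* (b :* b′)
      := (a′ :* d′ :+ c′ :* b′) :* (b :* d)) refl

    interchange : ∀ x y z w → (x * y) * (z * w) ≈ (x * z) * (y * w)
    interchange = solve 4 (λ x y z w →
      (x :* y) :* (z :* w)
      := (x :* z) :* (y :* w)) refl

    -‿* : ∀ x y → - x * y ≈ - (x * y)
    -‿* x y = sym (RingProperties.-‿distribˡ-* ring x y)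

    assoc-+ : ∀ a b c d e f →
      ((a * d + c * b) * f + e * (b * d)) * (b * (d * f))
      ≈ (a * (d * f) + (c * f + e * d) * b) * ((b * d) * f)
    assoc-+ = solve 6 (λ a b c d e f →
      ((a :* d :+ c :* b) :* f :+ e :* (b :* d)) :* (b :* (d :* f))
      := (a :* (d :* f) :+ (c :* f :+ e :* d) :* b) :* ((b :* d) :* f)) refl

    comm-+ : ∀ a b c d → (a * d + c * b) * (d * b) ≈ (c * b + a * d) * (b * d)
    comm-+ = solve 4 (λ a b c d →
      (a :* d :+ c :* b) :* (d :* b)
      := (c :* b :+ a :* d) :* (b :* d)) refl

    identity-+ : ∀ a b → (0# * b + a * 1#) * b ≈ a * (1# * b)
    identity-+ a b = trans
      (*-congʳ (trans (+-cong (zeroˡ b) (*-identityʳ a)) (+-identityˡ a)))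
      (*-congˡ (sym (*-identityˡ b)))

    inverse-+ : ∀ a b → (- a * b + a * b) * 1# ≈ 0# * (b * b)
    inverse-+ a b = trans (*-identityʳ _) (trans (sym (distribʳ b (- a) a))
      (trans (*-congʳ (-‿inverseˡ a)) (trans (zeroˡ b) (sym (zeroˡ (b * b))))))

    assoc-* : ∀ a b c d e f → ((a * c) * e) * (b * (d * f)) ≈ (a * (c * e)) * ((b * d) * f)
    assoc-* = solve 6 (λ a b c d e f →
      ((a :* c) :* e) :* (b :* (d :* f))
      := (a :* (c :* e)) :* ((b :* d) :* f)) refl

    comm-* : ∀ a b c d → (a * c) * (d * b) ≈ (c * a) * (b * d)
    comm-* = solve 4 (λ a b c d →
      (a :* c) :* (d :* b)
      := (c :* a) :* (b :* d)) refl

    identity-* : ∀ a b → (1# * a) * b ≈ a * (1# * b)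
    identity-* a b = *-cong (*-identityˡ a) (sym (*-identityˡ b))

    distrib-* : ∀ a b c d e f →
      (a * (c * f + e * d)) * ((b * d) * (b * f))
      ≈ ((a * c) * (b * f) + (a * e) * (b * d)) * (b * (d * f))
    distrib-* = solve 6 (λ a b c d e f →
      (a :* (c :* f :+ e :* d)) :* ((b :* d) :* (b :* f))
      := ((a :* c) :* (b :* f) :+ (a :* e) :* (b :* d)) :* (b :* (d :* f))) refl

    inverse-* : ∀ a b → (a * b) * 1# ≈ 1# * (b * a)
    inverse-* a b = trans (*-identityʳ _) (trans (*-comm a b) (sym (*-identityˡ _)))

module Fractions
  (D : CommutativeRing 0ℓ 0ℓ)
  (_≟_ : Decidable (CommutativeRing._≈_ D))
  (1≉0 : ¬ (CommutativeRing._≈_ D (CommutativeRing.1# D) (CommutativeRing.0# D)))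
  (noZeroDivisors : ∀ x y → ¬ (CommutativeRing._≈_ D x (CommutativeRing.0# D)) →
                    CommutativeRing._≈_ D (CommutativeRing._*_ D x y) (CommutativeRing.0# D) →
                    CommutativeRing._≈_ D y (CommutativeRing.0# D))
  where

  open CommutativeRing D

  infix 5 _/_[_]
  record Fraction : Set where
    constructor _/_[_]
    field
      num   : Carrier
      den   : Carrier
      den≉0 : ¬ (den ≈ 0#)
  open Fraction public

  infix 4 _≈ᶠ_
  record _≈ᶠ_ (x y : Fraction) : Set where
    constructor cross
    field crossed : num x * den y ≈ num y * den x

  private
    open SetoidReasoning setoid

    module I = Identities D

    *-nonzero : ∀ {x y} → ¬ (x ≈ 0#) → ¬ (y ≈ 0#) → ¬ (x * y ≈ 0#)
    *-nonzero {x} {y} x≉0 y≉0 xy≈0 = y≉0 (noZeroDivisors x y x≉0 xy≈0)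

    cancelˡ : ∀ x {y z} → ¬ (x ≈ 0#) → x * y ≈ x * z → y ≈ z
    cancelˡ x {y} {z} x≉0 p = x-y≈0⇒x≈y y z
      (noZeroDivisors x (y - z) x≉0 (begin
        x * (y - z)     ≈⟨ x[y-z]≈xy-xz x y z ⟩
        x * y - x * z   ≈⟨ +-congʳ p ⟩
        x * z - x * z   ≈⟨ -‿inverseʳ _ ⟩
        0#              ∎))
      where open RingProperties ring using (x[y-z]≈xy-xz; x∙y⁻¹≈ε⇒x≈y)
            x-y≈0⇒x≈y = x∙y⁻¹≈ε⇒x≈y

    ≈ᶠ-trans : ∀ {x y z} → x ≈ᶠ y → y ≈ᶠ z → x ≈ᶠ z
    ≈ᶠ-trans {a / b [ _ ]} {c / d [ d≉0 ]} {e / f [ _ ]} (cross p) (cross q) =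
      cross (cancelˡ d d≉0 (begin
        d * (a * f)  ≈⟨ I.trans₁ a d f ⟩
        a * d * f    ≈⟨ *-congʳ p ⟩
        c * b * f    ≈⟨ I.trans₂ c b f ⟩
        c * f * b    ≈⟨ *-congʳ q ⟩
        e * d * b    ≈⟨ I.trans₃ e d b ⟩
        d * (e * b)  ∎))

  infixl 6 _+ᶠ_
  _+ᶠ_ : Fraction → Fraction → Fraction
  (a / b [ b≉0 ]) +ᶠ (c / d [ d≉0 ]) = (a * d + c * b) / (b * d) [ *-nonzero b≉0 d≉0 ]

  infixl 7 _*ᶠ_
  _*ᶠ_ : Fraction → Fraction → Fraction
  (a / b [ b≉0 ]) *ᶠ (c / d [ d≉0 ]) = (a * c) / (b * d) [ *-nonzero b≉0 d≉0 ]

  -ᶠ_ : Fraction → Fraction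
  -ᶠ (a / b [ b≉0 ]) = (- a) / b [ b≉0 ]

  ι : Carrier → Fraction
  ι a = a / 1# [ 1≉0 ]

  _⁻¹ᶠ : Fraction → Fraction
  (a / b [ _ ]) ⁻¹ᶠ with a ≟ 0#
  ... | yes _  = ι 0#
  ... | no a≉0 = b / a [ a≉0 ]

  private
    +ᶠ-cong : ∀ {x x′ y y′} → x ≈ᶠ x′ → y ≈ᶠ y′ → x +ᶠ y ≈ᶠ x′ +ᶠ y′
    +ᶠ-cong {a / b [ _ ]} {a′ / b′ [ _ ]} {c / d [ _ ]} {c′ / d′ [ _ ]} (cross p) (cross q) =
      cross (begin
        (a * d + c * b) * (b′ * d′)             ≈⟨ I.+-cong₁ a b c d b′ d′ ⟩
        a * b′ * (d * d′) + c * d′ * (b * b′)   ≈⟨ +-cong (*-congʳ p) (*-congʳ q) ⟩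
        a′ * b * (d * d′) + c′ * d * (b * b′)   ≈⟨ I.+-cong₂ a′ b′ c′ d′ b d ⟩
        (a′ * d′ + c′ * b′) * (b * d)           ∎)

    *ᶠ-cong : ∀ {x x′ y y′} → x ≈ᶠ x′ → y ≈ᶠ y′ → x *ᶠ y ≈ᶠ x′ *ᶠ y′
    *ᶠ-cong {a / b [ _ ]} {a′ / b′ [ _ ]} {c / d [ _ ]} {c′ / d′ [ _ ]} (cross p) (cross q) =
      cross (begin
        (a * c) * (b′ * d′)     ≈⟨ I.interchange a c b′ d′ ⟩
        (a * b′) * (c * d′)     ≈⟨ *-cong p q ⟩
        (a′ * b) * (c′ * d)     ≈⟨ I.interchange a′ b c′ d ⟩
        (a′ * c′) * (b * d)     ∎)

    -ᶠ-cong : ∀ {x y} → x ≈ᶠ y → -ᶠ x ≈ᶠ -ᶠ y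
    -ᶠ-cong {a / b [ _ ]} {c / d [ _ ]} (cross p) = cross (begin
      - a * d   ≈⟨ I.-‿* a d ⟩
      - (a * d) ≈⟨ -‿cong p ⟩
      - (c * b) ≈⟨ I.-‿* c b ⟨
      - c * b   ∎)

    +ᶠ-assoc : ∀ x y z → (x +ᶠ y) +ᶠ z ≈ᶠ x +ᶠ (y +ᶠ z)
    +ᶠ-assoc (a / b [ _ ]) (c / d [ _ ]) (e / f [ _ ]) = cross (I.assoc-+ a b c d e f)

    +ᶠ-comm : ∀ x y → x +ᶠ y ≈ᶠ y +ᶠ x
    +ᶠ-comm (a / b [ _ ]) (c / d [ _ ]) = cross (I.comm-+ a b c d)

    +ᶠ-identityˡ : ∀ x → ι 0# +ᶠ x ≈ᶠ x
    +ᶠ-identityˡ (a / b [ _ ]) = cross (I.identity-+ a b)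

    +ᶠ-inverseˡ : ∀ x → (-ᶠ x) +ᶠ x ≈ᶠ ι 0#
    +ᶠ-inverseˡ (a / b [ _ ]) = cross (I.inverse-+ a b)

    *ᶠ-assoc : ∀ x y z → (x *ᶠ y) *ᶠ z ≈ᶠ x *ᶠ (y *ᶠ z)
    *ᶠ-assoc (a / b [ _ ]) (c / d [ _ ]) (e / f [ _ ]) = cross (I.assoc-* a b c d e f)

    *ᶠ-comm : ∀ x y → x *ᶠ y ≈ᶠ y *ᶠ x
    *ᶠ-comm (a / b [ _ ]) (c / d [ _ ]) = cross (I.comm-* a b c d)

    *ᶠ-identityˡ : ∀ x → ι 1# *ᶠ x ≈ᶠ x
    *ᶠ-identityˡ (a / b [ _ ]) = cross (I.identity-* a b)

    *ᶠ-distribˡ : ∀ x y z → x *ᶠ (y +ᶠ z) ≈ᶠ x *ᶠ y +ᶠ x *ᶠ z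
    *ᶠ-distribˡ (a / b [ _ ]) (c / d [ _ ]) (e / f [ _ ]) = cross (I.distrib-* a b c d e f)

    _≟ᶠ_ : Decidable _≈ᶠ_
    x ≟ᶠ y = map′ cross _≈ᶠ_.crossed ((num x * den y) ≟ (num y * den x))

    ≈ᶠ0⇒num≈0 : ∀ x → x ≈ᶠ ι 0# → num x ≈ 0#
    ≈ᶠ0⇒num≈0 x (cross p) = trans (sym (*-identityʳ _)) (trans p (zeroˡ _))

    num≈0⇒≈ᶠ0 : ∀ x → num x ≈ 0# → x ≈ᶠ ι 0#
    num≈0⇒≈ᶠ0 x p = cross (trans (*-congʳ p) (trans (zeroˡ _) (sym (zeroˡ _))))

    ⁻¹ᶠ-inverse : ∀ x → ¬ (x ≈ᶠ ι 0#) → x *ᶠ x ⁻¹ᶠ ≈ᶠ ι 1#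
    ⁻¹ᶠ-inverse x@(a / b [ _ ]) x≉0 with a ≟ 0#
    ... | yes a≈0 = contradiction (num≈0⇒≈ᶠ0 x a≈0) x≉0
    ... | no _    = cross (I.inverse-* a b)

    ⁻¹ᶠ-zero : ∀ x → x ≈ᶠ ι 0# → x ⁻¹ᶠ ≈ᶠ ι 0#
    ⁻¹ᶠ-zero x@(a / b [ _ ]) x≈0 with a ≟ 0#
    ... | yes _  = cross refl
    ... | no a≉0 = contradiction (≈ᶠ0⇒num≈0 x x≈0) a≉0

  fractionField : Field
  fractionField = record
    { commutativeRing = record
      { Carrier = Fraction
      ; _≈_ = _≈ᶠ_
      ; _+_ = _+ᶠ_
      ; _*_ = _*ᶠ_
      ; -_  = -ᶠ_
      ; 0#  = ι 0#
      ; 1#  = ι 1#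
      ; isCommutativeRing = record
        { isRing = record
          { +-isAbelianGroup = record
            { isGroup = record
              { isMonoid = record
                { isSemigroup = record
                  { isMagma = record
                    { isEquivalence = record
                      { refl  = cross refl
                      ; sym   = λ { (cross p) → cross (sym p) }
                      ; trans = ≈ᶠ-trans
                      }
                    ; ∙-cong = +ᶠ-cong
                    }
                  ; assoc = +ᶠ-assoc
                  }
                ; identity = +ᶠ-identityˡ , λ x → ≈ᶠ-trans (+ᶠ-comm x (ι 0#)) (+ᶠ-identityˡ x)
                }
              ; inverse = +ᶠ-inverseˡ , λ x → ≈ᶠ-trans (+ᶠ-comm x (-ᶠ x)) (+ᶠ-inverseˡ x)
              ; ⁻¹-cong = -ᶠ-cong
              }
            ; comm = +ᶠ-comm
            }
          ; *-cong = *ᶠ-cong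
          ; *-assoc = *ᶠ-assoc
          ; *-identity = *ᶠ-identityˡ , λ x → ≈ᶠ-trans (*ᶠ-comm x (ι 1#)) (*ᶠ-identityˡ x)
          ; distrib = *ᶠ-distribˡ , λ x y z →
              ≈ᶠ-trans (*ᶠ-comm (y +ᶠ z) x)
                (≈ᶠ-trans (*ᶠ-distribˡ x y z) (+ᶠ-cong (*ᶠ-comm x y) (*ᶠ-comm x z)))
          }
        ; *-comm = *ᶠ-comm
        }
      }
    ; _≟_ = _≟ᶠ_
    ; 1≉0 = λ p → 1≉0 (≈ᶠ0⇒num≈0 (ι 1#) p)
    ; _⁻¹ = _⁻¹ᶠ
    ; ⁻¹-inverse = ⁻¹ᶠ-inverse
    ; ⁻¹-zero = ⁻¹ᶠ-zero
    }

module RationalFunctions (F : Field) where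

  open Field F
  open Polynomials commutativeRing public
  private
    module P = CommutativeRing polyRing

    x*y≈0⇒x≈0 : ∀ x y → ¬ (y ≈ 0#) → x * y ≈ 0# → x ≈ 0#
    x*y≈0⇒x≈0 x y y≉0 p = begin
      x                ≈⟨ *-identityʳ x ⟨
      x * 1#           ≈⟨ *-congˡ (⁻¹-inverse y y≉0) ⟨
      x * (y * y ⁻¹)   ≈⟨ *-assoc _ _ _ ⟨
      x * y * y ⁻¹     ≈⟨ *-congʳ p ⟩
      0# * y ⁻¹        ≈⟨ zeroˡ _ ⟩
      0#               ∎
      where open SetoidReasoning setoid

    head≈0 : ∀ {a f} → a ∷ f ≈ₚ [] → a ≈ 0#
    head≈0 (coeffwise p) = p 0

    tail≈0 : ∀ {a f} → a ∷ f ≈ₚ [] → f ≈ₚ []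
    tail≈0 (coeffwise p) = coeffwise λ n → p (suc n)

    ∷≈0 : ∀ {a f} → a ≈ 0# → f ≈ₚ [] → a ∷ f ≈ₚ []
    ∷≈0 p (coeffwise q) = coeffwise λ { zero → p ; (suc n) → q n }

    drop-zero : ∀ a f g → a ≈ 0# → a ·ₚ f +ₚ (0# ∷ g) ≈ₚ [] → g ≈ₚ []
    drop-zero a f g a≈0 (coeffwise p) = coeffwise λ n → begin
      coeff g n                                  ≈⟨ +-identityˡ _ ⟨
      0# + coeff g n                             ≈⟨ +-congʳ (zeroˡ _) ⟨
      0# * coeff f (suc n) + coeff g n           ≈⟨ +-congʳ (*-congʳ a≈0) ⟨
      a * coeff f (suc n) + coeff g n            ≈⟨ +-congʳ (coeff-· a f (suc n)) ⟨
      coeff (a ·ₚ f) (suc n) + coeff g n         ≈⟨ coeff-+ (a ·ₚ f) (0# ∷ g) (suc n) ⟨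
      coeff (a ·ₚ f +ₚ (0# ∷ g)) (suc n)         ≈⟨ p (suc n) ⟩
      0#                                         ∎
      where open SetoidReasoning setoid

    noZeroDivisors-∷ : ∀ g a f → ¬ (a ≈ 0#) → g *ₚ (a ∷ f) ≈ₚ [] → g ≈ₚ []
    noZeroDivisors-∷ []      a f a≉0 p = P.refl
    noZeroDivisors-∷ (b ∷ g) a f a≉0 p =
      ∷≈0 b≈0 (noZeroDivisors-∷ g a f a≉0 (drop-zero b (a ∷ f) (g *ₚ (a ∷ f)) b≈0 p))
      where
      b≈0 : b ≈ 0#
      b≈0 = x*y≈0⇒x≈0 b a a≉0 (trans (sym (+-identityʳ _)) (head≈0 p))

    noZeroDivisors : ∀ f g → ¬ (f ≈ₚ []) → f *ₚ g ≈ₚ [] → g ≈ₚ []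
    noZeroDivisors []      g f≉0 p = contradiction P.refl f≉0
    noZeroDivisors (a ∷ f) g f≉0 p with a ≟ 0#
    ... | yes a≈0 = noZeroDivisors f g (λ f≈0 → f≉0 (∷≈0 a≈0 f≈0)) (drop-zero a g (f *ₚ g) a≈0 p)
    ... | no a≉0  = noZeroDivisors-∷ g a f a≉0 (P.trans (P.*-comm g (a ∷ f)) p)

    _≟0 : ∀ f → Dec (f ≈ₚ [])
    [] ≟0 = yes P.refl
    (a ∷ f) ≟0 with a ≟ 0# | f ≟0
    ... | yes p | yes q = yes (∷≈0 p q)
    ... | no ¬p | _     = no λ r → ¬p (head≈0 r)
    ... | _     | no ¬q = no λ r → ¬q (tail≈0 r)

    _≟ₚ_ : Decidable _≈ₚ_
    f ≟ₚ g = map′ (x∙y⁻¹≈ε⇒x≈y f g) x≈y⇒x∙y⁻¹≈ε ((f P.- g) ≟0)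
      where open RingProperties P.ring using (x∙y⁻¹≈ε⇒x≈y; x≈y⇒x∙y⁻¹≈ε)

    1ₚ≉0ₚ : ¬ (1ₚ ≈ₚ 0ₚ)
    1ₚ≉0ₚ p = 1≉0 (head≈0 p)

  open Fractions polyRing _≟ₚ_ 1ₚ≉0ₚ noZeroDivisors public

  PowerSeries : Set
  PowerSeries = ℕ → Carrier

  infix 4 _≋_
  _≋_ : PowerSeries → PowerSeries → Set
  s ≋ t = ∀ n → s n ≈ t n

  infixl 7 _⊛_
  _⊛_ : PowerSeries → PowerSeries → PowerSeries
  (s ⊛ t) n = ∑[ i ≤ n ] (s (toℕ i) * t (n ∸ toℕ i))
    where open MonoidSum +-monoid

  -- f = s in the field of formal Laurent series. As den f ≉ 0 and power
  -- series form an integral domain, s is the only expansion f can have.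
  infix 4 _ExpandsTo_
  _ExpandsTo_ : Fraction → PowerSeries → Set
  f ExpandsTo s = coeff (num f) ≋ coeff (den f) ⊛ s

module QAnalogues (F : Field) where

  open Field F
  open Polynomials commutativeRing

  [_]⟨_⟩ : ℤ → Carrier → Carrier
  [ m ]⟨ q ⟩ = (1# - q ^ℤ m) ÷ (1# - q)

  qPochhammer : Carrier → Carrier → ℕ → Carrier
  qPochhammer a q zero    = 1#
  qPochhammer a q (suc n) = qPochhammer a q n * (1# - a * q ^ n)

  -- pₙ(y; a, b | q), where the argument y is itself a polynomial.
  littleqJacobi : ℕ → Poly → Carrier → Carrier → Carrier → Poly
  littleqJacobi n y a b q = ∑[ k ≤ n ] (coefficient (toℕ k) ·ₚ (q ·ₚ y) ^ₚ toℕ k)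
    where
    open MonoidSum (CommutativeRing.+-monoid polyRing)
    coefficient : ℕ → Carrier
    coefficient k = (qPochhammer ((q ^ n) ⁻¹) q k * qPochhammer (a * b * q ^ suc n) q k)
                    ÷ (qPochhammer (a * q) q k * qPochhammer q q k)

module Orthogonality (F : Field) where

  open Field F
  open Polynomials commutativeRing

  IsLinearFunctional : (Poly → Carrier) → Set
  IsLinearFunctional = ModuleMorphisms.LeftModuleMorphisms.IsLeftModuleHomomorphism
    (LeftModule.rawLeftModule polyModule)
    (LeftModule.rawLeftModule (TensorUnit.leftModule {R = ring}))

  record IsOrthogonal (φ : Poly → Carrier) (P : ℕ → Poly) : Set where
    field
      degree       : ∀ n → HasDegree (P n) n
      diagonal     : ∀ n → ¬ (φ (P n *ₚ P n) ≈ 0#)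
      off-diagonal : ∀ n m → ¬ (n ≡ m) → φ (P n *ₚ P m) ≈ 0#

-- i ^^ c stands for iᶜ, 𝟎 for the symbol 0.
infix 9 _^^_
data Letter : Set where
  𝟎    : Letter
  _^^_ : ℕ → ℕ → Letter

-- n^{r-1} ≺ … ≺ n¹ ≺ … ≺ 1^{r-1} ≺ … ≺ 1¹ ≺ 0 ≺ 1⁰ ≺ … ≺ n⁰
infix 4 _≺_
data _≺_ : Letter → Letter → Set where
  coloured-base   : ∀ {i j c d} → j ℕ.< i → i ^^ suc c ≺ j ^^ suc d
  coloured-colour : ∀ {i c d} → d ℕ.< c → i ^^ suc c ≺ i ^^ suc d
  coloured-𝟎      : ∀ {i c} → i ^^ suc c ≺ 𝟎
  coloured-plain  : ∀ {i j c} → i ^^ suc c ≺ j ^^ 0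
  𝟎-plain         : ∀ {j} → 𝟎 ≺ j ^^ 0
  plain-plain     : ∀ {i j} → i ℕ.< j → i ^^ 0 ≺ j ^^ 0

infix 4 _≺?_
_≺?_ : Decidable _≺_
𝟎          ≺? 𝟎          = no λ ()
𝟎          ≺? j ^^ zero  = yes 𝟎-plain
𝟎          ≺? j ^^ suc d = no λ ()
i ^^ zero  ≺? 𝟎          = no λ ()
i ^^ zero  ≺? j ^^ zero  = map′ plain-plain (λ { (plain-plain p) → p }) (i ℕ.<? j)
i ^^ zero  ≺? j ^^ suc d = no λ ()
i ^^ suc c ≺? 𝟎          = yes coloured-𝟎
i ^^ suc c ≺? j ^^ zero  = yes coloured-plain
i ^^ suc c ≺? j ^^ suc d with j ℕ.<? i
... | yes j<i = yes (coloured-base j<i)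
... | no j≮i with i ℕ.≟ j
...   | no i≢j = no λ { (coloured-base j<i) → j≮i j<i ; (coloured-colour _) → i≢j ≡.refl }
...   | yes ≡.refl = map′ coloured-colour
          (λ { (coloured-base j<i) → contradiction j<i j≮i ; (coloured-colour p) → p })
          (d ℕ.<? c)

-- Colours (c₁, …, cₙ) and a word σ(1) … σ(n), both with values counted
-- from 0; it is a coloured permutation when the word has no repetition.
ColouredWord : ℕ → ℕ → Set
ColouredWord r n = Vec (Fin r) n × Vec (Fin n) n

words : ∀ {A : Set} → List A → ∀ n → List (Vec A n)
words xs zero    = [] ∷ []
words xs (suc n) = List.cartesianProductWith _∷_ xs (words xs n)

unique? : ∀ {n} → U.Decidable (Unique {A = Fin n} {n})
unique? = allPairs? λ i j → ¬? (i Fin.≟ j)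

G : ∀ r n → List (ColouredWord r n)
G r n = List.cartesianProduct (words (List.allFin r) n)
                              (List.filter unique? (words (List.allFin n) n))

module _ {r n : ℕ} where

  -- γ(0), γ(1), …, γ(n), with values counted from 1 as usual
  letters : ColouredWord r n → Vec Letter (suc n)
  letters (c , σ) = 𝟎 ∷ Vec.zipWith (λ i k → suc (toℕ i) ^^ toℕ k) σ c

  Des : ColouredWord r n → List (Fin n)
  Des γ = List.filter (λ i → Vec.lookup (letters γ) (Fin.suc i) ≺? Vec.lookup (letters γ) (inject₁ i))
                      (List.allFin n)

  des maj col fmaj : ColouredWord r n → ℕ
  des γ       = List.length (Des γ)
  maj γ       = List.sum (List.map toℕ (Des γ))
  col (c , _) = Vec.sum (Vec.map toℕ c)
  fmaj γ      = r ℕ.* maj γ ℕ.+ col γ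

ℚ-field : Field
ℚ-field = record
  { commutativeRing = ℚ.+-*-commutativeRing
  ; _≟_ = ℚ._≟_
  ; 1≉0 = λ ()
  ; _⁻¹ = inverse
  ; ⁻¹-inverse = inverseʳ
  ; ⁻¹-zero = inverse-zero
  }
  where
  inverse : ℚ.ℚ → ℚ.ℚ
  inverse x with x ℚ.≟ ℚ.0ℚ
  ... | yes _  = ℚ.0ℚ
  ... | no x≢0 = ℚ.1/_ x {{ℚ.≢-nonZero x≢0}}

  inverseʳ : ∀ x → ¬ (x ≡ ℚ.0ℚ) → x ℚ.* inverse x ≡ ℚ.1ℚ
  inverseʳ x x≢0 with x ℚ.≟ ℚ.0ℚ
  ... | yes x≡0 = contradiction x≡0 x≢0
  ... | no x≢0′ = ℚ.*-inverseʳ x {{ℚ.≢-nonZero x≢0′}}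

  inverse-zero : ∀ x → x ≡ ℚ.0ℚ → inverse x ≡ ℚ.0ℚ
  inverse-zero x x≡0 with x ℚ.≟ ℚ.0ℚ
  ... | yes _  = ≡.refl
  ... | no x≢0 = contradiction x≡0 x≢0

module ℚ⟨q⟩ = RationalFunctions ℚ-field

ℚ⟨q⟩-field : Field
ℚ⟨q⟩-field = ℚ⟨q⟩.fractionField

-- ℚ(q, Z) is realised as ℚ(q)(Z), so expansions in Z have coefficients in ℚ(q).
module ℚ⟨q,Z⟩ = RationalFunctions ℚ⟨q⟩-field

𝕂-field : Field
𝕂-field = ℚ⟨q,Z⟩.fractionField

module 𝕂 = Field 𝕂-field
module 𝕂[x] = Polynomials 𝕂.commutativeRing

q₀ : ℚ⟨q⟩.Fraction
q₀ = ℚ⟨q⟩.ι ℚ⟨q⟩.X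

q Z : 𝕂.Carrier
q = ℚ⟨q,Z⟩.ι (q₀ ∷ [])
Z = ℚ⟨q,Z⟩.ι ℚ⟨q,Z⟩.X

open QAnalogues 𝕂-field public using (qPochhammer; littleqJacobi)
open QAnalogues ℚ⟨q⟩-field public using ([_]⟨_⟩)
open Orthogonality 𝕂-field public

shiftedJacobi : ℕ → ℤ → ℕ → 𝕂[x].Poly
shiftedJacobi r c n = littleqJacobi n ((q ^ℤ (ℤ.- c)) ·ₚ (1ₚ +ₚ (q - 1#) ·ₚ X))
                                    (Z * q ^ℤ (ℤ.- (+ r))) 1# (q ^ r)
  where open 𝕂
        open 𝕂[x]

momentSeries : ℕ → ℤ → ℕ → ℚ⟨q,Z⟩.PowerSeries
momentSeries r c n = coeff (1ₚ +ₚ (-ₚ X)) ⊛ λ k → [ + (r ℕ.* k) ℤ.+ c ]⟨ q₀ ⟩ ^ n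
  where open ℚ⟨q,Z⟩
        open Field ℚ⟨q⟩-field using (_^_)

generatingPolynomial : ℕ → ℕ → 𝕂.Carrier
generatingPolynomial r n = List.foldr _+_ 0# (List.map (λ γ → Z ^ des γ * q ^ fmaj γ) (G r n))
  where open 𝕂

{-# OPTIONS --safe #-}
module Submission where

-- Orthogonality to P₀ = 1 gives φ(Pₙ) = 0 for n ≥ 1; with φ(1) = 1 this determines φ.
-- Put Q = qʳ and y = q⁻ᶜ(1 + (q-1)x).  A summable ₂φ₁ identity shows that the
-- solution is φ(yᵐ) = (1-Z)/(1-ZQᵐ) = (1-Z) ∑ₖ QᵏᵐZᵏ: φ is evaluation at the points
-- y = Qᵏ, that is x = [rk+c], with weights (1-Z)Zᵏ.
--
-- For c = 1, [rk+1]ⁿ is the sum of q^(f(1)+⋯+f(n)) over f : {1,…,n} → {0,…,rk}.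
-- Write f(i) = r g + d with d < r and order the letters iᵈ by decreasing g and, for
-- equal g, increasingly: this turns f into a coloured permutation γ together with a
-- chain k ≥ g₁ ≥ … ≥ gₙ ≥ 0 that is strict at the descents of γ (the first step
-- being that from 0 to γ(1)).  For fixed γ these chains have the generating function
-- Z^des(γ) q^fmaj(γ) / (Z; Q)ₙ₊₁ in Z.

open import Defs using (Field; module Polynomials; module RationalFunctions; module QAnalogues; module Orthogonality;
  Letter; 𝟎; _^^_; _≺_; _≺?_; coloured-base; coloured-colour; coloured-𝟎; coloured-plain; 𝟎-plain; plain-plain;
  words; unique?; G; ColouredWord; des; fmaj)
open import Algebra.Bundles using (CommutativeRing; RawRing)
open import Algebra.Module.Bundles using (LeftModule)
import Algebra.Module.Morphism.Structures as ModuleMorphisms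
import Algebra.Properties.CommutativeSemigroup as CommutativeSemigroupProperties
import Algebra.Properties.CommutativeSemiring.Exp as CommutativeExp
import Algebra.Properties.Monoid.Sum as MonoidSum
import Algebra.Properties.Ring as RingProperties
import Algebra.Properties.Semiring.Exp as Exp
import Algebra.Properties.Semiring.Mult.TCOptimised as Multiples
import Algebra.Solver.Ring as RingSolver
open import Algebra.Solver.Ring.AlmostCommutativeRing using (fromCommutativeRing; _-Raw-AlmostCommutative⟶_; Induced-equivalence)
open import Data.Bool.Base using (Bool; true; false; if_then_else_)
open import Data.Fin.Base as Fin using (Fin; zero; suc; toℕ; fromℕ; inject₁)
import Data.Fin.Properties as Fin
open import Data.Integer.Base as ℤ using (ℤ; +_; -[1+_])
import Data.Integer.Properties as ℤ
open import Data.List.Base as List using (List; []; _∷_; _++_; allFin)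
import Data.List.Properties as List
open import Data.List.Relation.Binary.Permutation.Propositional as ↭ using (_↭_; ↭-sym)
import Data.List.Relation.Binary.Permutation.Setoid.Properties as Permutation
open import Data.List.Relation.Unary.All as All using (All; []; _∷_)
open import Data.List.Relation.Unary.AllPairs as AllPairs using (AllPairs; []; _∷_)
import Data.List.Relation.Unary.Sorted.TotalOrder.Properties as Sorted
import Data.List.Relation.Unary.Unique.Propositional as ListUnique
import Data.List.Relation.Unary.Unique.Propositional.Properties as ListUniqueProperties
import Data.List.Sort as Sort
open import Data.Maybe.Base as Maybe using ()
open import Data.Nat.Base as ℕ using (ℕ; zero; suc; _∸_; _≤_)
import Data.Nat.Induction as ℕ
import Data.Nat.ListAction as ListAction
import Data.Nat.Properties as ℕ
open import Data.Product.Base using (_×_; _,_; proj₁; proj₂)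
open import Data.Sum.Base using (_⊎_; inj₁; inj₂)
open import Data.Vec.Base as Vec using (Vec; []; _∷_; lookup)
import Data.Vec.Properties as Vec
import Data.Vec.Relation.Unary.All as VecAll
open import Data.Vec.Relation.Unary.AllPairs using ([]; _∷_)
open import Data.Vec.Relation.Unary.Unique.Propositional using (Unique)
open import Function.Base using (_∘_)
open import Level using (0ℓ)
open import Relation.Binary.Bundles using (Setoid; StrictTotalOrder; DecTotalOrder)
import Relation.Binary.Construct.On as On
open import Relation.Binary.Definitions using (Transitive; Trichotomous; WeaklyDecidable; tri<; tri≈; tri>)
import Relation.Binary.Properties.StrictTotalOrder as StrictTotalOrderProperties
open import Relation.Binary.PropositionalEquality.Core as ≡ using (_≡_; _≢_)
import Relation.Binary.PropositionalEquality.Properties as ≡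
import Relation.Binary.Reasoning.Setoid as SetoidReasoning
open import Relation.Binary.Structures using (IsStrictTotalOrder)
open import Relation.Binary.Structures.Biased using (isStrictTotalOrderᶜ)
open import Relation.Nullary.Decidable using (Dec; does; yes; no; dec⇒maybe; dec-true; dec-false)
open import Relation.Nullary.Negation.Core using (¬_; contradiction)
open import Relation.Unary using (Pred; Decidable)

-- The bijection between maps f and pairs (γ, chain) is not constructed. Instead, both total weights
-- are shown to satisfy one recursion: the sum over words is split by the first letter, the product
-- over i by the first pair (g, letter) in the order "g decreasing, then letter increasing". For the
-- induction this is stated for any preceding letter ℓ, any level k and any set S of values still to
-- be used. The choice c = 1 reflects the place of 𝟎 in the order: at the top level g = k only the
-- letters i⁰ may follow 𝟎, so exactly the exponent rk is added to the exponents 0, ..., rk-1 of the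
-- lower levels.
--
-- From φ(yᵐ) to φ(xⁿ) the proof goes through the mixed moments φ(yᵐxⁿ), since x is affine in y;
-- this replaces a binomial expansion. Series are never divided: a fraction and its expansion are
-- compared after multiplication by polynomials in Z, which can be cancelled because series have no
-- torsion over F[Z].
--
-- All of this is done over an arbitrary field F with an element q₀ that is neither 0 nor a root of
-- unity; F = ℚ(q) enters only at the end.

-- Ring solver with integer coefficients, finite sums, division in a field

module IntegerSolver (R : CommutativeRing 0ℓ 0ℓ) where

  open CommutativeRing R
  private
    open Multiples semiring renaming (_×_ to _⋆_)
    open RingProperties ring
    open CommutativeSemigroupProperties +-commutativeSemigroup using (interchange)
    open SetoidReasoning setoid

    -- Integers serve as the coefficients of the solver: their equality is decided by evaluation
    -- whatever R is, and they allow subtraction and numerals.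
    ⟦_⟧ : ℤ → Carrier
    ⟦ + n ⟧      = n ⋆ 1#
    ⟦ -[1+ n ] ⟧ = - (suc n ⋆ 1#)

    ⊖-homo : ∀ m n → ⟦ m ℤ.⊖ n ⟧ ≈ m ⋆ 1# - n ⋆ 1#
    ⊖-homo m zero = sym (trans (+-congˡ -0#≈0#) (+-identityʳ _))
    ⊖-homo zero (suc n) = sym (+-identityˡ _)
    ⊖-homo (suc m) (suc n) = begin
      ⟦ suc m ℤ.⊖ suc n ⟧                   ≡⟨ ≡.cong ⟦_⟧ (ℤ.[1+m]⊖[1+n]≡m⊖n m n) ⟩
      ⟦ m ℤ.⊖ n ⟧                           ≈⟨ ⊖-homo m n ⟩
      m ⋆ 1# - n ⋆ 1#                       ≈⟨ +-identityˡ _ ⟨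
      0# + (m ⋆ 1# - n ⋆ 1#)                ≈⟨ +-congʳ (-‿inverseʳ 1#) ⟨
      (1# - 1#) + (m ⋆ 1# - n ⋆ 1#)         ≈⟨ interchange _ _ _ _ ⟩
      (1# + m ⋆ 1#) + (- 1# - n ⋆ 1#)       ≈⟨ +-cong (1+× m 1#) (trans (-‿cong (1+× n 1#)) (sym (-‿+-comm _ _))) ⟨
      suc m ⋆ 1# - suc n ⋆ 1#               ∎

    -‿homo : ∀ i → ⟦ ℤ.- i ⟧ ≈ - ⟦ i ⟧
    -‿homo (+ zero)   = sym -0#≈0#
    -‿homo (+ suc n)  = refl
    -‿homo (-[1+ n ]) = sym (-‿involutive _)

    +-homo : ∀ i j → ⟦ i ℤ.+ j ⟧ ≈ ⟦ i ⟧ + ⟦ j ⟧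
    +-homo (+ m)      (+ n)      = ×-homo-+ 1# m n
    +-homo (+ m)      (-[1+ n ]) = ⊖-homo m (suc n)
    +-homo (-[1+ m ]) (+ n)      = trans (⊖-homo n (suc m)) (+-comm _ _)
    +-homo (-[1+ m ]) (-[1+ n ]) = begin
      - (suc (suc (m ℕ.+ n)) ⋆ 1#)      ≡⟨ ≡.cong (λ k → - (suc k ⋆ 1#)) (≡.sym (ℕ.+-suc m n)) ⟩
      - ((suc m ℕ.+ suc n) ⋆ 1#)        ≈⟨ -‿cong (×-homo-+ 1# (suc m) (suc n)) ⟩
      - (suc m ⋆ 1# + suc n ⋆ 1#)       ≈⟨ -‿+-comm _ _ ⟨
      - (suc m ⋆ 1#) - suc n ⋆ 1#       ∎

    *-homo-pos : ∀ m n → ⟦ + m ℤ.* + n ⟧ ≈ ⟦ + m ⟧ * ⟦ + n ⟧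
    *-homo-pos m n = begin
      ⟦ + m ℤ.* + n ⟧       ≡⟨ ≡.cong ⟦_⟧ (≡.sym (ℤ.pos-* m n)) ⟩
      (m ℕ.* n) ⋆ 1#        ≈⟨ ×1-homo-* m n ⟩
      m ⋆ 1# * (n ⋆ 1#)     ∎

    *-homo-posˡ : ∀ m j → ⟦ + m ℤ.* j ⟧ ≈ ⟦ + m ⟧ * ⟦ j ⟧
    *-homo-posˡ m (+ n)      = *-homo-pos m n
    *-homo-posˡ m (-[1+ n ]) = begin
      ⟦ + m ℤ.* -[1+ n ] ⟧              ≡⟨ ≡.cong ⟦_⟧ (≡.sym (ℤ.neg-distribʳ-* (+ m) (+ suc n))) ⟩
      ⟦ ℤ.- (+ m ℤ.* + suc n) ⟧         ≈⟨ -‿homo (+ m ℤ.* + suc n) ⟩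
      - ⟦ + m ℤ.* + suc n ⟧             ≈⟨ -‿cong (*-homo-pos m (suc n)) ⟩
      - (⟦ + m ⟧ * ⟦ + suc n ⟧)         ≈⟨ -‿distribʳ-* _ _ ⟩
      ⟦ + m ⟧ * - ⟦ + suc n ⟧           ∎

    *-homo : ∀ i j → ⟦ i ℤ.* j ⟧ ≈ ⟦ i ⟧ * ⟦ j ⟧
    *-homo (+ m)      j = *-homo-posˡ m j
    *-homo (-[1+ m ]) j = begin
      ⟦ -[1+ m ] ℤ.* j ⟧                ≡⟨ ≡.cong ⟦_⟧ (≡.sym (ℤ.neg-distribˡ-* (+ suc m) j)) ⟩
      ⟦ ℤ.- (+ suc m ℤ.* j) ⟧           ≈⟨ -‿homo (+ suc m ℤ.* j) ⟩
      - ⟦ + suc m ℤ.* j ⟧               ≈⟨ -‿cong (*-homo-posˡ (suc m) j) ⟩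
      - (⟦ + suc m ⟧ * ⟦ j ⟧)           ≈⟨ -‿distribˡ-* _ _ ⟩
      - ⟦ + suc m ⟧ * ⟦ j ⟧             ∎

    ℤ-rawRing : RawRing 0ℓ 0ℓ
    ℤ-rawRing = record { Carrier = ℤ ; _≈_ = _≡_ ; _+_ = ℤ._+_ ; _*_ = ℤ._*_ ; -_ = ℤ.-_ ; 0# = ℤ.0ℤ ; 1# = ℤ.1ℤ }

    homomorphism : ℤ-rawRing -Raw-AlmostCommutative⟶ fromCommutativeRing R
    homomorphism = record
      { ⟦_⟧    = ⟦_⟧
      ; +-homo = +-homo
      ; *-homo = *-homo
      ; -‿homo = -‿homo
      ; 0-homo = refl
      ; 1-homo = refl
      }

    _coeff≟_ : WeaklyDecidable (Induced-equivalence homomorphism)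
    i coeff≟ j = Maybe.map (λ i≡j → reflexive (≡.cong ⟦_⟧ i≡j)) (dec⇒maybe (i ℤ.≟ j))

  open RingSolver ℤ-rawRing (fromCommutativeRing R) homomorphism _coeff≟_ public
    using (solve; _:=_; _:+_; _:*_; _:-_; :-_; con; Polynomial)

  :1 : ∀ {n} → Polynomial n
  :1 = con (+ 1)

module RangeSums (R : CommutativeRing 0ℓ 0ℓ) where

  open CommutativeRing R

  sumTo : ℕ → (ℕ → Carrier) → Carrier
  sumTo zero    f = 0#
  sumTo (suc n) f = sumTo n f + f n

  sumTo-cong : ∀ n {f g : ℕ → Carrier} → (∀ k → k ℕ.< n → f k ≈ g k) → sumTo n f ≈ sumTo n g
  sumTo-cong zero    p = refl
  sumTo-cong (suc n) p = +-cong (sumTo-cong n (λ k k<n → p k (ℕ.m<n⇒m<1+n k<n))) (p n (ℕ.n<1+n n))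

module FieldProperties (F : Field) where

  open Field F
  open RingProperties ring using (x∙y⁻¹≈ε⇒x≈y)
  open SetoidReasoning setoid

  *-cancelʳ : ∀ {x y} z → ¬ (z ≈ 0#) → x * z ≈ y * z → x ≈ y
  *-cancelʳ {x} {y} z z≉0 p = begin
    x               ≈⟨ divide x ⟨
    x * z * z ⁻¹    ≈⟨ *-congʳ p ⟩
    y * z * z ⁻¹    ≈⟨ divide y ⟩
    y               ∎
    where
    divide : ∀ w → w * z * z ⁻¹ ≈ w
    divide w = trans (*-assoc _ _ _) (trans (*-congˡ (⁻¹-inverse z z≉0)) (*-identityʳ w))

  *-nonzero : ∀ {x y} → ¬ (x ≈ 0#) → ¬ (y ≈ 0#) → ¬ (x * y ≈ 0#)
  *-nonzero {x} {y} x≉0 y≉0 p = x≉0 (*-cancelʳ y y≉0 (trans p (sym (zeroˡ y))))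

  ÷-*-cancel : ∀ x {y} → ¬ (y ≈ 0#) → (x ÷ y) * y ≈ x
  ÷-*-cancel x {y} y≉0 = trans (*-assoc _ _ _) (trans (*-congˡ (trans (*-comm _ _) (⁻¹-inverse y y≉0))) (*-identityʳ x))

  *-÷-cancel : ∀ x {y} → ¬ (y ≈ 0#) → y * (x ÷ y) ≈ x
  *-÷-cancel x y≉0 = trans (*-comm _ _) (÷-*-cancel x y≉0)

  ÷-unique : ∀ {x y z} → ¬ (z ≈ 0#) → y * z ≈ x → y ≈ x ÷ z
  ÷-unique {x} {y} {z} z≉0 p = *-cancelʳ z z≉0 (trans p (sym (÷-*-cancel x z≉0)))

  ⁻¹-nonzero : ∀ {x} → ¬ (x ≈ 0#) → ¬ (x ⁻¹ ≈ 0#)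
  ⁻¹-nonzero {x} x≉0 p = 1≉0 (trans (sym (⁻¹-inverse x x≉0)) (trans (*-congˡ p) (zeroʳ x)))

  ÷-nonzero : ∀ {x y} → ¬ (x ≈ 0#) → ¬ (y ≈ 0#) → ¬ (x ÷ y ≈ 0#)
  ÷-nonzero x≉0 y≉0 = *-nonzero x≉0 (⁻¹-nonzero y≉0)

  ^-nonzero : ∀ {x} n → ¬ (x ≈ 0#) → ¬ (x ^ n ≈ 0#)
  ^-nonzero zero    x≉0 = 1≉0
  ^-nonzero (suc n) x≉0 = *-nonzero x≉0 (^-nonzero n x≉0)

  1-x-nonzero : ∀ {x} → ¬ (x ≈ 1#) → ¬ (1# - x ≈ 0#)
  1-x-nonzero {x} x≉1 p = x≉1 (sym (x∙y⁻¹≈ε⇒x≈y 1# x p))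

  ⁻¹-cong : ∀ {x y} → x ≈ y → x ⁻¹ ≈ y ⁻¹
  ⁻¹-cong {x} {y} x≈y with x ≟ 0#
  ... | yes x≈0 = trans (⁻¹-zero x x≈0) (sym (⁻¹-zero y (trans (sym x≈y) x≈0)))
  ... | no x≉0  = *-cancelʳ x x≉0 (begin
    x ⁻¹ * x    ≈⟨ trans (*-comm _ _) (⁻¹-inverse x x≉0) ⟩
    1#          ≈⟨ ⁻¹-inverse y (λ y≈0 → x≉0 (trans x≈y y≈0)) ⟨
    y * y ⁻¹    ≈⟨ trans (*-comm _ _) (*-congˡ (sym x≈y)) ⟩
    y ⁻¹ * x    ∎)

  ÷-cong : ∀ {x x′ y y′} → x ≈ x′ → y ≈ y′ → x ÷ y ≈ x′ ÷ y′
  ÷-cong p q = *-cong p (⁻¹-cong q)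

-- q-Pochhammer symbols and a summable ₂φ₁

module QPochhammerProperties (F : Field) where

  open Field F
  open FieldProperties F
  open QAnalogues F using () renaming (qPochhammer to poch)
  open IntegerSolver commutativeRing
  open SetoidReasoning setoid

  poch-cong : ∀ {a b} q n → a ≈ b → poch a q n ≈ poch b q n
  poch-cong q zero    p = refl
  poch-cong q (suc n) p = *-cong (poch-cong q n p) (+-congˡ (-‿cong (*-congʳ p)))

  -- The definition splits off the last factor; by induction the first one can be split off instead,
  -- which shifts the parameter from a to aq.
  poch-suc : ∀ a q n → poch a q (suc n) ≈ (1# - a) * poch (a * q) q n
  poch-suc a q zero = trans (*-identityˡ _) (trans (+-congˡ (-‿cong (*-identityʳ a))) (sym (*-identityʳ _)))
  poch-suc a q (suc n) = begin
    poch a q (suc n) * (1# - a * (q * q ^ n))              ≈⟨ *-congʳ (poch-suc a q n) ⟩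
    (1# - a) * poch (a * q) q n * (1# - a * (q * q ^ n))   ≈⟨ solve 4 (λ a q p x →
      (:1 :- a) :* p :* (:1 :- a :* (q :* x)) := (:1 :- a) :* (p :* (:1 :- a :* q :* x))) refl a q _ _ ⟩
    (1# - a) * (poch (a * q) q n * (1# - a * q * q ^ n))   ∎

  poch-nonzero : ∀ a q n → (∀ j → j ℕ.< n → ¬ (a * q ^ j ≈ 1#)) → ¬ (poch a q n ≈ 0#)
  poch-nonzero a q zero    p = 1≉0
  poch-nonzero a q (suc n) p =
    *-nonzero (poch-nonzero a q n (λ j j<n → p j (ℕ.m<n⇒m<1+n j<n))) (1-x-nonzero (p n (ℕ.n<1+n n)))

  poch-vanishes : ∀ a q n → a * q ^ n ≈ 1# → poch a q (suc n) ≈ 0#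
  poch-vanishes a q n p = trans (*-congˡ (trans (+-congˡ (-‿cong p)) (-‿inverseʳ 1#))) (zeroʳ _)

-- The terms of the sum are those of ₂φ₁(q⁻ⁿ, zqⁿ; zq; q, q).  When the lower
-- parameter is ABq such a sum is indefinitely summable: the partial sums are
-- (Aq)ₘ(Bq)ₘ / ((ABq)ₘ(q)ₘ), which for A = q⁻ⁿ vanishes at m = n.
module Vandermonde (F : Field) where

  open Field F

  module Sum (q z : Carrier)
    (q≉0 : ¬ (q ≈ 0#))
    (qʲ≉1 : ∀ j → ¬ (q ^ suc j ≈ 1#))
    (zqʲ≉1 : ∀ j → ¬ (z * q ^ j ≈ 1#))
    where

    open FieldProperties F
    open QPochhammerProperties F
    open RangeSums commutativeRing
    open QAnalogues F using () renaming (qPochhammer to poch)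
    open IntegerSolver commutativeRing
    open SetoidReasoning setoid

    -- The value that φ(yᵏ) will turn out to have; z stands for aq.
    moment : ℕ → Carrier
    moment k = (1# - z) ÷ (1# - z * q ^ k)

    -- The coefficient of (qy)ᵏ in pₙ(y; a, 1 | q) when aq = z.
    coefficient : ℕ → ℕ → Carrier
    coefficient n k = (poch ((q ^ n) ⁻¹) q k * poch (z * q ^ n) q k) ÷ (poch z q k * poch q q k)

    z[q]-nonzero : ∀ k → ¬ (poch z q k ≈ 0#)
    z[q]-nonzero k = poch-nonzero z q k (λ j _ → zqʲ≉1 j)

    q[q]-nonzero : ∀ k → ¬ (poch q q k ≈ 0#)
    q[q]-nonzero k = poch-nonzero q q k (λ j _ → qʲ≉1 j)

    zq[q]-nonzero : ∀ k → ¬ (poch (z * q) q k ≈ 0#)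
    zq[q]-nonzero k = poch-nonzero (z * q) q k (λ j _ p → zqʲ≉1 (suc j) (trans (sym (*-assoc _ _ _)) p))

    module _ (n : ℕ) where

      A B : Carrier
      A = (q ^ n) ⁻¹
      B = z * q ^ n

      qⁿ≉0 : ¬ (q ^ n ≈ 0#)
      qⁿ≉0 = ^-nonzero n q≉0

      A-inverse : A * q ^ n ≈ 1#
      A-inverse = trans (*-comm _ _) (⁻¹-inverse _ qⁿ≉0)

      AB≈z : A * B ≈ z
      AB≈z = begin
        A * (z * q ^ n)   ≈⟨ solve 3 (λ a z x → a :* (z :* x) := z :* (a :* x)) refl A z _ ⟩
        z * (A * q ^ n)   ≈⟨ *-congˡ A-inverse ⟩
        z * 1#            ≈⟨ *-identityʳ z ⟩
        z                 ∎

      term : ℕ → Carrier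
      term k = coefficient n k * (q ^ k * moment k)

      -- The factor `moment k` moves the lower parameter from z to zq, because (z;q)ₖ(1-zqᵏ) =
      -- (1-z)(zq;q)ₖ. Since AB = z, the new parameter is ABq, the summable case.
      term-cleared : ∀ k → term k * (poch (z * q) q k * poch q q k) ≈ poch A q k * poch B q k * q ^ k
      term-cleared k = *-cancelʳ (1# - z) (1-x-nonzero (λ z≈1 → zqʲ≉1 0 (trans (*-identityʳ z) z≈1))) (begin
        coefficient n k * (q ^ k * moment k) * (poch (z * q) q k * poch q q k) * (1# - z)
          ≈⟨ solve 6 (λ c x m p r y → c :* (x :* m) :* (p :* r) :* y := c :* x :* m :* r :* (y :* p)) refl
               (coefficient n k) (q ^ k) (moment k) (poch (z * q) q k) (poch q q k) (1# - z) ⟩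
        coefficient n k * q ^ k * moment k * poch q q k * ((1# - z) * poch (z * q) q k)
          ≈⟨ *-congˡ (poch-suc z q k) ⟨
        coefficient n k * q ^ k * moment k * poch q q k * (poch z q k * (1# - z * q ^ k))
          ≈⟨ solve 6 (λ c x m p r y → c :* x :* m :* r :* (p :* y) := (c :* (p :* r)) :* x :* (m :* y)) refl
               (coefficient n k) (q ^ k) (moment k) (poch z q k) (poch q q k) (1# - z * q ^ k) ⟩
        coefficient n k * (poch z q k * poch q q k) * q ^ k * (moment k * (1# - z * q ^ k))
          ≈⟨ *-cong (*-congʳ (÷-*-cancel _ (*-nonzero (z[q]-nonzero k) (q[q]-nonzero k))))
                    (÷-*-cancel _ (1-x-nonzero (zqʲ≉1 k))) ⟩
        poch A q k * poch B q k * q ^ k * (1# - z) ∎)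

      partial-sum : ∀ m → sumTo (suc m) term * (poch (z * q) q m * poch q q m)
                          ≈ poch (A * q) q m * poch (B * q) q m
      partial-sum zero = begin
        (0# + term 0) * (1# * 1#)   ≈⟨ *-congʳ (+-identityˡ _) ⟩
        term 0 * (1# * 1#)          ≈⟨ term-cleared 0 ⟩
        1# * 1# * 1#                ≈⟨ *-identityʳ _ ⟩
        1# * 1#                     ∎
      partial-sum (suc m) = begin
        (s + t) * (p * (1# - z * q * q ^ m) * (r * (1# - q * q ^ m)))
          ≈⟨ solve 7 (λ s t p y r x w → (s :+ t) :* (p :* y :* (r :* x)) :=
               s :* (p :* r) :* (y :* x) :+ t :* (p :* y :* (r :* x))) refl s t p _ r _ 0# ⟩
        s * (p * r) * ((1# - z * q * q ^ m) * (1# - q * q ^ m)) + t * (p * (1# - z * q * q ^ m) * (r * (1# - q * q ^ m)))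
          ≈⟨ +-cong (*-congʳ (partial-sum m)) (term-cleared (suc m)) ⟩
        a * b * ((1# - z * q * q ^ m) * (1# - q * q ^ m)) + poch A q (suc m) * poch B q (suc m) * (q * q ^ m)
          -- With z written as AB, what remains is a polynomial identity in A, B, a, b, q and qᵐ:
          -- (1-ABt)(1-t) + (1-A)(1-B)t = (1-At)(1-Bt) for t = q·qᵐ, times ab.
          ≈⟨ +-cong (*-congˡ (*-congʳ (+-congˡ (-‿cong (trans (*-assoc _ _ _) (*-congʳ (sym AB≈z)))))))
                    (*-congʳ (*-cong (poch-suc A q m) (poch-suc B q m))) ⟩
        a * b * ((1# - A * B * (q * q ^ m)) * (1# - q * q ^ m)) + (1# - A) * a * ((1# - B) * b) * (q * q ^ m)
          ≈⟨ solve 6 (λ A B a b q x →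
               a :* b :* ((:1 :- A :* B :* (q :* x)) :* (:1 :- q :* x)) :+ (:1 :- A) :* a :* ((:1 :- B) :* b) :* (q :* x)
               := a :* (:1 :- A :* q :* x) :* (b :* (:1 :- B :* q :* x))) refl A B a b q (q ^ m) ⟩
        a * (1# - A * q * q ^ m) * (b * (1# - B * q * q ^ m)) ∎
        where
        s = sumTo (suc m) term
        t = term (suc m)
        p = poch (z * q) q m
        r = poch q q m
        a = poch (A * q) q m
        b = poch (B * q) q m

    sum-vanishes : ∀ n → sumTo (suc (suc n)) (λ k → coefficient (suc n) k * (q ^ k * moment k)) ≈ 0#
    sum-vanishes n = *-cancelʳ (poch (z * q) q (suc n) * poch q q (suc n))
      (*-nonzero (zq[q]-nonzero (suc n)) (q[q]-nonzero (suc n)))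
      (begin
        sumTo (suc (suc n)) (term (suc n)) * (poch (z * q) q (suc n) * poch q q (suc n))
          ≈⟨ partial-sum (suc n) (suc n) ⟩
        poch (A (suc n) * q) q (suc n) * poch (B (suc n) * q) q (suc n)
          ≈⟨ *-congʳ (poch-vanishes _ q n (trans (*-assoc _ _ _) (A-inverse (suc n)))) ⟩
        0# * poch (B (suc n) * q) q (suc n)
          ≈⟨ zeroˡ _ ⟩
        0# ≈⟨ zeroˡ _ ⟨
        0# * (poch (z * q) q (suc n) * poch q q (suc n)) ∎)

    -- This makes the relation φ(Pₙ) = 0 solvable for φ(yⁿ). The numerator has factors 1 - qʲ⁻ⁿ with
    -- j < n and 1 - zqⁿ⁺ʲ, none of which vanishes.
    leading-nonzero : ∀ n → ¬ (coefficient n n * q ^ n ≈ 0#)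
    leading-nonzero n = *-nonzero
      (÷-nonzero
        (*-nonzero (poch-nonzero _ q n A-factors) (poch-nonzero _ q n B-factors))
        (*-nonzero (z[q]-nonzero n) (q[q]-nonzero n)))
      (^-nonzero n q≉0)
      where
      open Exp semiring using (^-homo-*)

      A-factors : ∀ j → j ℕ.< n → ¬ ((q ^ n) ⁻¹ * q ^ j ≈ 1#)
      A-factors j j<n p with ℕ.m≤n⇒∃[o]m+o≡n j<n
      ... | o , ≡.refl = qʲ≉1 o (*-cancelʳ (q ^ j) (^-nonzero j q≉0) (begin
        q ^ suc o * q ^ j             ≈⟨ *-comm _ _ ⟩
        q ^ j * q ^ suc o             ≈⟨ ^-homo-* q j (suc o) ⟨
        q ^ (j ℕ.+ suc o)             ≡⟨ ≡.cong (q ^_) (ℕ.+-suc j o) ⟩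
        q ^ n                         ≈⟨ *-identityʳ _ ⟨
        q ^ n * 1#                    ≈⟨ *-congˡ p ⟨
        q ^ n * ((q ^ n) ⁻¹ * q ^ j)  ≈⟨ *-assoc _ _ _ ⟨
        q ^ n * (q ^ n) ⁻¹ * q ^ j    ≈⟨ *-congʳ (⁻¹-inverse _ (^-nonzero n q≉0)) ⟩
        1# * q ^ j                    ∎))

      B-factors : ∀ j → j ℕ.< n → ¬ (z * q ^ n * q ^ j ≈ 1#)
      B-factors j _ p = zqʲ≉1 (n ℕ.+ j) (trans (*-congˡ (^-homo-* q n j)) (trans (sym (*-assoc _ _ _)) p))

-- Power series as a module over polynomials, and expansions of fractions

-- Power series over F as a torsion-free module over F[Z], with action _▷_.
module SeriesModule (F : Field) where

  open Field F
  open RationalFunctions F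
    using (PowerSeries; _≋_; _⊛_; Poly; coeff; _≈ₚ_; coeffwise; coeff-≈; _+ₚ_; _·ₚ_; _*ₚ_; 0ₚ; 1ₚ; polyRing)
  open FieldProperties F
  private
    module P = CommutativeRing polyRing
  open CommutativeSemigroupProperties +-commutativeSemigroup using (interchange)
  open CommutativeSemigroupProperties *-commutativeSemigroup using () renaming (x∙yz≈y∙xz to x*yz≈y*xz)
  open RingProperties ring using (x∙y⁻¹≈ε⇒x≈y; -1*x≈-x)
  open MonoidSum +-monoid using (sum-cong-≋; sum-replicate-zero)

  seriesSetoid : Setoid 0ℓ 0ℓ
  seriesSetoid = record
    { Carrier = PowerSeries ; _≈_ = _≋_
    ; isEquivalence = record { refl = λ _ → refl ; sym = λ p n → sym (p n) ; trans = λ p q n → trans (p n) (q n) } }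

  open Setoid seriesSetoid public using () renaming (refl to ≋-refl; sym to ≋-sym; trans to ≋-trans)

  infixl 6 _⊕_
  infixr 7 _⊙_ _▷_

  𝟘 𝟙 : PowerSeries
  𝟘 _ = 0#
  𝟙 zero    = 1#
  𝟙 (suc n) = 0#

  _⊕_ : PowerSeries → PowerSeries → PowerSeries
  (s ⊕ t) n = s n + t n

  _⊙_ : Carrier → PowerSeries → PowerSeries
  (a ⊙ s) n = a * s n

  shift : PowerSeries → PowerSeries
  shift s zero    = 0#
  shift s (suc n) = s n

  -- The Cauchy product `coeff f ⊛ s` in Horner form; with recursion on the coefficient list the
  -- module laws follow by induction on f.
  _▷_ : Poly → PowerSeries → PowerSeries
  []      ▷ s = 𝟘
  (a ∷ f) ▷ s = a ⊙ s ⊕ shift (f ▷ s)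

  ⊕-cong : ∀ {s s′ t t′} → s ≋ s′ → t ≋ t′ → s ⊕ t ≋ s′ ⊕ t′
  ⊕-cong p q n = +-cong (p n) (q n)

  ⊙-congˡ : ∀ a {s t} → s ≋ t → a ⊙ s ≋ a ⊙ t
  ⊙-congˡ a p n = *-congˡ (p n)

  shift-cong : ∀ {s t} → s ≋ t → shift s ≋ shift t
  shift-cong p zero    = refl
  shift-cong p (suc n) = p n

  shift-⊕ : ∀ s t → shift (s ⊕ t) ≋ shift s ⊕ shift t
  shift-⊕ s t zero    = sym (+-identityˡ 0#)
  shift-⊕ s t (suc n) = refl

  shift-⊙ : ∀ a s → shift (a ⊙ s) ≋ a ⊙ shift s
  shift-⊙ a s zero    = sym (zeroʳ a)
  shift-⊙ a s (suc n) = refl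

  ⊛≋▷ : ∀ f s → coeff f ⊛ s ≋ f ▷ s
  ⊛≋▷ []      s n = trans (sum-cong-≋ {suc n} (λ i → zeroˡ (s (n ∸ toℕ i)))) (sum-replicate-zero (suc n))
  ⊛≋▷ (a ∷ f) s zero    = refl
  ⊛≋▷ (a ∷ f) s (suc n) = +-congˡ (⊛≋▷ f s n)

  -- Equal polynomials may be lists of different lengths, so the proof goes through `⊛`, which sees
  -- only coefficients.
  ▷-congʳ : ∀ f g s → f ≈ₚ g → f ▷ s ≋ g ▷ s
  ▷-congʳ f g s p n = trans (sym (⊛≋▷ f s n))
    (trans (sum-cong-≋ {suc n} (λ i → *-congʳ {s (n ∸ toℕ i)} (coeff-≈ p (toℕ i)))) (⊛≋▷ g s n))

  ▷-congˡ : ∀ f {s t} → s ≋ t → f ▷ s ≋ f ▷ t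
  ▷-congˡ []      p = ≋-refl
  ▷-congˡ (a ∷ f) p = ⊕-cong (⊙-congˡ a p) (shift-cong (▷-congˡ f p))

  +-▷ : ∀ f g s → (f +ₚ g) ▷ s ≋ f ▷ s ⊕ g ▷ s
  +-▷ []      g       s n = sym (+-identityˡ _)
  +-▷ (a ∷ f) []      s n = sym (+-identityʳ _)
  +-▷ (a ∷ f) (b ∷ g) s n = trans
    (+-cong (distribʳ _ _ _) (≋-trans (shift-cong (+-▷ f g s)) (shift-⊕ (f ▷ s) (g ▷ s)) n))
    (interchange _ _ _ _)

  ·-▷ : ∀ a f s → (a ·ₚ f) ▷ s ≋ a ⊙ (f ▷ s)
  ·-▷ a []      s n = sym (zeroʳ a)
  ·-▷ a (b ∷ f) s n = trans
    (+-cong (*-assoc _ _ _) (≋-trans (shift-cong (·-▷ a f s)) (shift-⊙ a (f ▷ s)) n))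
    (sym (distribˡ _ _ _))

  0∷-▷ : ∀ f s → (0# ∷ f) ▷ s ≋ shift (f ▷ s)
  0∷-▷ f s n = trans (+-congʳ (zeroˡ _)) (+-identityˡ _)

  *-▷ : ∀ f g s → (f *ₚ g) ▷ s ≋ f ▷ g ▷ s
  *-▷ []      g s = ≋-refl
  *-▷ (a ∷ f) g s = ≋-trans (+-▷ (a ·ₚ g) (0# ∷ f *ₚ g) s)
    (⊕-cong (·-▷ a g s) (≋-trans (0∷-▷ (f *ₚ g) s) (shift-cong (*-▷ f g s))))

  1-▷ : ∀ s → 1ₚ ▷ s ≋ s
  1-▷ s zero    = trans (+-identityʳ _) (*-identityˡ _)
  1-▷ s (suc n) = trans (+-identityʳ _) (*-identityˡ _)

  ▷-comm : ∀ f g s → f ▷ g ▷ s ≋ g ▷ f ▷ s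
  ▷-comm f g s = ≋-trans (≋-sym (*-▷ f g s)) (≋-trans (▷-congʳ (f *ₚ g) (g *ₚ f) s (P.*-comm f g)) (*-▷ g f s))

  ▷-⊕ : ∀ f s t → f ▷ (s ⊕ t) ≋ f ▷ s ⊕ f ▷ t
  ▷-⊕ []      s t n = sym (+-identityˡ 0#)
  ▷-⊕ (a ∷ f) s t n = trans
    (+-cong (distribˡ _ _ _) (≋-trans (shift-cong (▷-⊕ f s t)) (shift-⊕ (f ▷ s) (f ▷ t)) n))
    (interchange _ _ _ _)

  ▷-⊙ : ∀ f a s → f ▷ (a ⊙ s) ≋ a ⊙ (f ▷ s)
  ▷-⊙ []      a s n = sym (zeroʳ a)
  ▷-⊙ (b ∷ f) a s n = trans
    (+-cong (x*yz≈y*xz b a (s n)) (≋-trans (shift-cong (▷-⊙ f a s)) (shift-⊙ a (f ▷ s)) n))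
    (sym (distribˡ _ _ _))

  ▷-𝟙 : ∀ f → f ▷ 𝟙 ≋ coeff f
  ▷-𝟙 []      n       = refl
  ▷-𝟙 (a ∷ f) zero    = trans (+-identityʳ _) (*-identityʳ a)
  ▷-𝟙 (a ∷ f) (suc n) = trans (+-congʳ (zeroʳ a)) (trans (+-identityˡ _) (▷-𝟙 f n))

  ▷-vanishes : ∀ f s n → (∀ m → m ℕ.≤ n → s m ≈ 0#) → (f ▷ s) n ≈ 0#
  ▷-vanishes []      s n       p = refl
  ▷-vanishes (a ∷ f) s zero    p = trans (+-identityʳ _) (trans (*-congˡ (p 0 ℕ.≤-refl)) (zeroʳ a))
  ▷-vanishes (a ∷ f) s (suc n) p = trans
    (+-cong (trans (*-congˡ (p (suc n) ℕ.≤-refl)) (zeroʳ a)) (▷-vanishes f s n (λ m m≤n → p m (ℕ.m≤n⇒m≤1+n m≤n))))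
    (+-identityˡ 0#)

  -- A vanishing constant term of f is stripped off by shifting the relation one degree. If the
  -- constant term a is nonzero, the coefficient of Zⁿ in the product is a·s(n) plus terms in s(m)
  -- with m < n, so strong induction on n applies.
  ▷-torsion-free : ∀ f s → ¬ (f ≈ₚ 0ₚ) → f ▷ s ≋ 𝟘 → s ≋ 𝟘
  ▷-torsion-free []      s f≉0 p = contradiction P.refl f≉0
  ▷-torsion-free (a ∷ f) s f≉0 p with a ≟ 0#
  ... | yes a≈0 = ▷-torsion-free f s
    (λ f≈0 → f≉0 (coeffwise λ { zero → a≈0 ; (suc n) → coeff-≈ f≈0 n }))
    (λ n → trans (sym (+-identityˡ _)) (trans (+-congʳ (sym (trans (*-congʳ a≈0) (zeroˡ _)))) (p (suc n))))
  ... | no a≉0 = ℕ.<-rec _ step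
    where
    lower : ∀ n → (∀ {m} → m ℕ.< n → s m ≈ 0#) → shift (f ▷ s) n ≈ 0#
    lower zero    h = refl
    lower (suc n) h = ▷-vanishes f s n (λ m m≤n → h (ℕ.s≤s m≤n))

    step : ∀ n → (∀ {m} → m ℕ.< n → s m ≈ 0#) → s n ≈ 0#
    step n h = *-cancelʳ a a≉0 (begin
      s n * a                     ≈⟨ *-comm _ _ ⟩
      a * s n                     ≈⟨ +-identityʳ _ ⟨
      a * s n + 0#                ≈⟨ +-congˡ (lower n h) ⟨
      a * s n + shift (f ▷ s) n   ≈⟨ p n ⟩
      0#                          ≈⟨ zeroˡ a ⟨
      0# * a                      ∎)
      where open SetoidReasoning setoid

  ▷-cancel : ∀ f {s t} → ¬ (f ≈ₚ 0ₚ) → f ▷ s ≋ f ▷ t → s ≋ t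
  ▷-cancel f {s} {t} f≉0 p n = x∙y⁻¹≈ε⇒x≈y _ _ (trans (+-congˡ (sym (-1*x≈-x _)))
    (▷-torsion-free f (s ⊕ ((- 1#) ⊙ t)) f≉0 difference n))
    where
    difference : f ▷ (s ⊕ ((- 1#) ⊙ t)) ≋ 𝟘
    difference n = trans (▷-⊕ f s _ n) (trans (+-cong (p n) (trans (▷-⊙ f _ t n) (-1*x≈-x _))) (-‿inverseʳ _))

module Expansions (F : Field) where

  open RationalFunctions F
  open SeriesModule F
  private
    module F = Field F
    module P = CommutativeRing polyRing
    module K = Field fractionField
    open SetoidReasoning seriesSetoid

  -- Writing the numerator as `num f ▷ 𝟙` turns statements about expansions into identities of the
  -- module, where denominators commute and cancel.
  ExpandsTo⇒▷ : ∀ {f s} → f ExpandsTo s → num f ▷ 𝟙 ≋ den f ▷ s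
  ExpandsTo⇒▷ {f} {s} p = ≋-trans (▷-𝟙 (num f)) (≋-trans p (⊛≋▷ (den f) s))

  ▷⇒ExpandsTo : ∀ f s → num f ▷ 𝟙 ≋ den f ▷ s → f ExpandsTo s
  ▷⇒ExpandsTo f s p = ≋-trans (≋-sym (▷-𝟙 (num f))) (≋-trans p (≋-sym (⊛≋▷ (den f) s)))

  -- Gives the expansion of g/d without inverting the series d: the claim is multiplied by `d` and
  -- `den g`, both of which are cancelled afterwards.
  quotient-ExpandsTo : ∀ {f g d s t} → ¬ (d ≈ₚ 0ₚ) → ι d K.* f K.≈ g → g ExpandsTo t → t ≋ d ▷ s → f ExpandsTo s
  quotient-ExpandsTo {f} {g} {d} {s} {t} d≉0 (cross p) q t≋ds = ▷⇒ExpandsTo f s (▷-cancel d d≉0 (▷-cancel (den g) (den≉0 g) (begin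
    den g ▷ d ▷ num f ▷ 𝟙         ≈⟨ ▷-congˡ (den g) (*-▷ d (num f) 𝟙) ⟨
    den g ▷ (d *ₚ num f) ▷ 𝟙      ≈⟨ *-▷ (den g) (d *ₚ num f) 𝟙 ⟨
    (den g *ₚ (d *ₚ num f)) ▷ 𝟙   ≈⟨ ▷-congʳ (den g *ₚ (d *ₚ num f)) (den f *ₚ num g) 𝟙
                                       (P.trans (P.*-comm (den g) (d *ₚ num f)) (P.trans p (P.trans (P.*-congˡ {num g} (P.*-identityˡ (den f))) (P.*-comm (num g) (den f))))) ⟩
    (den f *ₚ num g) ▷ 𝟙          ≈⟨ *-▷ (den f) (num g) 𝟙 ⟩
    den f ▷ num g ▷ 𝟙             ≈⟨ ▷-congˡ (den f) (≋-trans (ExpandsTo⇒▷ {g} q) (▷-congˡ (den g) t≋ds)) ⟩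
    den f ▷ den g ▷ d ▷ s         ≈⟨ ▷-comm (den f) (den g) (d ▷ s) ⟩
    den g ▷ den f ▷ d ▷ s         ≈⟨ ▷-congˡ (den g) (▷-comm (den f) d s) ⟩
    den g ▷ d ▷ den f ▷ s         ∎)))

  ι-ExpandsTo : ∀ p → ι p ExpandsTo (p ▷ 𝟙)
  ι-ExpandsTo p = ▷⇒ExpandsTo (ι p) (p ▷ 𝟙) (≋-sym (1-▷ (p ▷ 𝟙)))

  ExpandsTo-cong : ∀ {f g s t} → f K.≈ g → s ≋ t → f ExpandsTo s → g ExpandsTo t
  ExpandsTo-cong {f} {g} {s} {t} (cross p) s≋t q = ▷⇒ExpandsTo g t (▷-cancel (den f) (den≉0 f) (begin
    den f ▷ num g ▷ 𝟙     ≈⟨ ▷-comm (den f) (num g) 𝟙 ⟩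
    num g ▷ den f ▷ 𝟙     ≈⟨ *-▷ (num g) (den f) 𝟙 ⟨
    (num g *ₚ den f) ▷ 𝟙  ≈⟨ ▷-congʳ (num f *ₚ den g) (num g *ₚ den f) 𝟙 p ⟨
    (num f *ₚ den g) ▷ 𝟙  ≈⟨ *-▷ (num f) (den g) 𝟙 ⟩
    num f ▷ den g ▷ 𝟙     ≈⟨ ▷-comm (num f) (den g) 𝟙 ⟩
    den g ▷ num f ▷ 𝟙     ≈⟨ ▷-congˡ (den g) (ExpandsTo⇒▷ {f} q) ⟩
    den g ▷ den f ▷ s     ≈⟨ ▷-comm (den g) (den f) s ⟩
    den f ▷ den g ▷ s     ≈⟨ ▷-congˡ (den f) (▷-congˡ (den g) s≋t) ⟩
    den f ▷ den g ▷ t     ∎))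

  ExpandsTo-+ : ∀ {f g s t} → f ExpandsTo s → g ExpandsTo t → (f K.+ g) ExpandsTo (s ⊕ t)
  ExpandsTo-+ {f} {g} {s} {t} p q = ▷⇒ExpandsTo (f K.+ g) (s ⊕ t) (begin
    (num f *ₚ den g +ₚ num g *ₚ den f) ▷ 𝟙         ≈⟨ +-▷ (num f *ₚ den g) _ 𝟙 ⟩
    (num f *ₚ den g) ▷ 𝟙 ⊕ (num g *ₚ den f) ▷ 𝟙    ≈⟨ ⊕-cong (summand f g p) (summand g f q) ⟩
    den g ▷ den f ▷ s ⊕ den f ▷ den g ▷ t          ≈⟨ ⊕-cong (▷-comm (den g) (den f) s) ≋-refl ⟩
    den f ▷ den g ▷ s ⊕ den f ▷ den g ▷ t          ≈⟨ ▷-⊕ (den f) _ _ ⟨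
    den f ▷ (den g ▷ s ⊕ den g ▷ t)                ≈⟨ ▷-congˡ (den f) (▷-⊕ (den g) s t) ⟨
    den f ▷ den g ▷ (s ⊕ t)                        ≈⟨ *-▷ (den f) (den g) _ ⟨
    (den f *ₚ den g) ▷ (s ⊕ t)                     ∎)
    where
    summand : ∀ f g {s} → f ExpandsTo s → (num f *ₚ den g) ▷ 𝟙 ≋ den g ▷ den f ▷ s
    summand f g {s} p = begin
      (num f *ₚ den g) ▷ 𝟙  ≈⟨ *-▷ (num f) (den g) 𝟙 ⟩
      num f ▷ den g ▷ 𝟙     ≈⟨ ▷-comm (num f) (den g) 𝟙 ⟩
      den g ▷ num f ▷ 𝟙     ≈⟨ ▷-congˡ (den g) (ExpandsTo⇒▷ {f} p) ⟩
      den g ▷ den f ▷ s     ∎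

  ExpandsTo-ι* : ∀ p {f s} → f ExpandsTo s → (ι p K.* f) ExpandsTo (p ▷ s)
  ExpandsTo-ι* p {f} {s} q = ▷⇒ExpandsTo (ι p K.* f) (p ▷ s) (begin
    (p *ₚ num f) ▷ 𝟙      ≈⟨ *-▷ p (num f) 𝟙 ⟩
    p ▷ num f ▷ 𝟙         ≈⟨ ▷-congˡ p (ExpandsTo⇒▷ {f} q) ⟩
    p ▷ den f ▷ s         ≈⟨ ▷-comm p (den f) s ⟩
    den f ▷ p ▷ s         ≈⟨ ▷-congʳ (1ₚ *ₚ den f) (den f) (p ▷ s) (P.*-identityˡ (den f)) ⟨
    (1ₚ *ₚ den f) ▷ p ▷ s ∎)

  -- Lifts an identity of power series back to rational functions: applying `den g` to one expansion
  -- and `den f` to the other yields the same series, so the cross products agree coefficientwise.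
  ExpandsTo-injective : ∀ {f g s} → f ExpandsTo s → g ExpandsTo s → f K.≈ g
  ExpandsTo-injective {f} {g} {s} p q = cross (coeffwise (≋-trans (≋-sym (▷-𝟙 (num f *ₚ den g))) (≋-trans equal (▷-𝟙 (num g *ₚ den f)))))
    where
    equal : (num f *ₚ den g) ▷ 𝟙 ≋ (num g *ₚ den f) ▷ 𝟙
    equal = begin
      (num f *ₚ den g) ▷ 𝟙  ≈⟨ ≋-trans (▷-congʳ (num f *ₚ den g) (den g *ₚ num f) 𝟙 (P.*-comm (num f) (den g))) (*-▷ (den g) (num f) 𝟙) ⟩
      den g ▷ num f ▷ 𝟙     ≈⟨ ▷-congˡ (den g) (ExpandsTo⇒▷ {f} p) ⟩
      den g ▷ den f ▷ s     ≈⟨ ▷-comm (den g) (den f) s ⟩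
      den f ▷ den g ▷ s     ≈⟨ ▷-congˡ (den f) (ExpandsTo⇒▷ {g} q) ⟨
      den f ▷ num g ▷ 𝟙     ≈⟨ ≋-trans (▷-congʳ (num g *ₚ den f) (den f *ₚ num g) 𝟙 (P.*-comm (num g) (den f))) (*-▷ (den f) (num g) 𝟙) ⟨
      (num g *ₚ den f) ▷ 𝟙  ∎

  constant-▷ : ∀ a s → (a ∷ []) ▷ s ≋ a ⊙ s
  constant-▷ a s zero    = F.+-identityʳ _
  constant-▷ a s (suc n) = F.+-identityʳ _

  ι-+ : ∀ f g → ι (f +ₚ g) K.≈ ι f K.+ ι g
  ι-+ f g = cross (P.*-cong (P.sym (P.+-cong (P.*-identityʳ f) (P.*-identityʳ g))) (P.*-identityˡ 1ₚ))

  ι-* : ∀ f g → ι (f *ₚ g) K.≈ ι f K.* ι g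
  ι-* f g = cross (P.*-congˡ {f *ₚ g} (P.*-identityˡ 1ₚ))

  ι-cong : ∀ {f g} → f ≈ₚ g → ι f K.≈ ι g
  ι-cong p = cross (P.*-congʳ p)

  ι-injective : ∀ {f g} → ι f K.≈ ι g → f ≈ₚ g
  ι-injective (cross p) = P.trans (P.sym (P.*-identityʳ _)) (P.trans p (P.*-identityʳ _))

-- Scalars and powers of polynomials, linear functionals

module PolynomialProperties (R : CommutativeRing 0ℓ 0ℓ) where

  open CommutativeRing R
  open Polynomials R
  private
    module P = CommutativeRing polyRing

  constant-* : ∀ a f → (a ∷ []) *ₚ f ≈ₚ a ·ₚ f
  constant-* a f = P.trans (P.+-congˡ {a ·ₚ f} (coeffwise λ { zero → refl ; (suc n) → refl })) (P.+-identityʳ _)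

  ·-*ʳ : ∀ a f g → f *ₚ (a ·ₚ g) ≈ₚ a ·ₚ (f *ₚ g)
  ·-*ʳ a f g = begin
    f *ₚ (a ·ₚ g)             ≈⟨ P.*-congˡ {f} (constant-* a g) ⟨
    f *ₚ ((a ∷ []) *ₚ g)      ≈⟨ x∙yz≈y∙xz f (a ∷ []) g ⟩
    (a ∷ []) *ₚ (f *ₚ g)      ≈⟨ constant-* a (f *ₚ g) ⟩
    a ·ₚ (f *ₚ g)             ∎
    where open SetoidReasoning P.setoid
          open import Algebra.Properties.CommutativeSemigroup P.*-commutativeSemigroup using (x∙yz≈y∙xz)

  ·-^ : ∀ a f k → (a ·ₚ f) ^ₚ k ≈ₚ (Exp._^_ semiring a k) ·ₚ (f ^ₚ k)
  ·-^ a f zero = coeffwise λ { zero → sym (*-identityʳ 1#) ; (suc n) → refl }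
  ·-^ a f (suc k) = begin
    (a ·ₚ f) *ₚ (a ·ₚ f) ^ₚ k       ≈⟨ P.*-congˡ {a ·ₚ f} (·-^ a f k) ⟩
    (a ·ₚ f) *ₚ (aᵏ ·ₚ f ^ₚ k)      ≈⟨ ·-*ʳ aᵏ (a ·ₚ f) (f ^ₚ k) ⟩
    aᵏ ·ₚ ((a ·ₚ f) *ₚ f ^ₚ k)      ≈⟨ *ₗ-cong refl (P.trans (P.*-comm (a ·ₚ f) (f ^ₚ k)) (P.trans (·-*ʳ a (f ^ₚ k) f) (*ₗ-cong refl (P.*-comm (f ^ₚ k) f)))) ⟩
    aᵏ ·ₚ (a ·ₚ (f *ₚ f ^ₚ k))      ≈⟨ *ₗ-assoc aᵏ a (f *ₚ f ^ₚ k) ⟨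
    (aᵏ * a) ·ₚ (f *ₚ f ^ₚ k)       ≈⟨ *ₗ-cong (*-comm aᵏ a) P.refl ⟩
    (a * aᵏ) ·ₚ (f *ₚ f ^ₚ k)       ∎
    where
    open SetoidReasoning P.setoid
    open LeftModule polyModule using (*ₗ-cong; *ₗ-assoc)
    aᵏ = Exp._^_ semiring a k

module Functionals (F : Field) where

  open Field F
  open Polynomials commutativeRing

  module Linear (φ : Poly → Carrier) (linear : Orthogonality.IsLinearFunctional F φ) where

    open RangeSums commutativeRing
    private
      module P = CommutativeRing polyRing
    open MonoidSum P.+-monoid using (sum; sum-init-last; sum-cong-≗)

    open ModuleMorphisms.LeftModuleMorphisms.IsLeftModuleHomomorphism linear public
      using () renaming (⟦⟧-cong to φ-cong; +ᴹ-homo to φ-+; *ₗ-homo to φ-·; 0ᴹ-homo to φ-0)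

    -- `sum` recurses at the first index and `sumTo` at the last; hence the detour through `inject₁`
    -- and `fromℕ`.
    φ-sum : ∀ (g : ℕ → Poly) n → φ (sum {n} (g ∘ toℕ)) ≈ sumTo n (φ ∘ g)
    φ-sum g zero    = φ-0
    φ-sum g (suc n) = begin
      φ (sum {suc n} (g ∘ toℕ))                                   ≈⟨ φ-cong (sum-init-last (g ∘ toℕ)) ⟩
      φ (sum {n} (g ∘ toℕ ∘ inject₁) +ₚ g (toℕ (fromℕ n)))        ≈⟨ φ-+ _ _ ⟩
      φ (sum {n} (g ∘ toℕ ∘ inject₁)) + φ (g (toℕ (fromℕ n)))     ≡⟨ ≡.cong₂ (λ s k → φ s + φ (g k))
                                                                       (sum-cong-≗ {n} (≡.cong g ∘ Fin.toℕ-inject₁)) (Fin.toℕ-fromℕ n) ⟩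
      φ (sum {n} (g ∘ toℕ)) + φ (g n)                             ≈⟨ +-congʳ (φ-sum g n) ⟩
      sumTo n (φ ∘ g) + φ (g n)                                   ∎
      where open SetoidReasoning setoid

-- The values φ(yⁿ) forced by orthogonality

module Jacobi (F : Field) where

  open Field F
  open Polynomials commutativeRing
  open QAnalogues F using () renaming (littleqJacobi to jacobi; qPochhammer to poch)

  module Moments (q z a : Carrier)
    (q≉0 : ¬ (q ≈ 0#))
    (qʲ≉1 : ∀ j → ¬ (q ^ suc j ≈ 1#))
    (zqʲ≉1 : ∀ j → ¬ (z * q ^ j ≈ 1#))
    (aq≈z : a * q ≈ z)
    (y : Poly) (φ : Poly → Carrier)
    (linear : Orthogonality.IsLinearFunctional F φ) (φ1≈1 : φ 1ₚ ≈ 1#)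
    (orthogonal : Orthogonality.IsOrthogonal F φ (λ n → jacobi n y a 1# q))
    where

    open Vandermonde.Sum F q z q≉0 qʲ≉1 zqʲ≉1 public using (moment)
    open Vandermonde.Sum F q z q≉0 qʲ≉1 zqʲ≉1 using (coefficient; sum-vanishes; leading-nonzero)
    open FieldProperties F
    open QPochhammerProperties F
    open RangeSums commutativeRing
    open PolynomialProperties commutativeRing
    open Functionals.Linear F φ linear
    open RingProperties ring using (+-cancelˡ)
    open SetoidReasoning setoid
    private
      module P = CommutativeRing polyRing

      jacobiCoefficient : ℕ → ℕ → Carrier
      jacobiCoefficient n k = (poch ((q ^ n) ⁻¹) q k * poch (a * 1# * q ^ suc n) q k)
                              ÷ (poch (a * q) q k * poch q q k)

      jacobiCoefficient≈ : ∀ n k → jacobiCoefficient n k ≈ coefficient n k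
      jacobiCoefficient≈ n k = ÷-cong
        (*-congˡ (poch-cong q k (trans (*-congʳ (*-identityʳ a)) (trans (sym (*-assoc a q (q ^ n))) (*-congʳ aq≈z)))))
        (*-congʳ (poch-cong q k aq≈z))

      φ-jacobi : ∀ n → φ (jacobi n y a 1# q) ≈ sumTo (suc n) (λ k → coefficient n k * (q ^ k * φ (y ^ₚ k)))
      φ-jacobi n = trans (φ-sum (λ k → jacobiCoefficient n k ·ₚ (q ·ₚ y) ^ₚ k) (suc n))
        (sumTo-cong (suc n) λ k _ → begin
          φ (jacobiCoefficient n k ·ₚ (q ·ₚ y) ^ₚ k)          ≈⟨ φ-· _ _ ⟩
          jacobiCoefficient n k * φ ((q ·ₚ y) ^ₚ k)           ≈⟨ *-cong (jacobiCoefficient≈ n k) (trans (φ-cong (·-^ q y k)) (φ-· _ _)) ⟩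
          coefficient n k * (q ^ k * φ (y ^ₚ k))              ∎)

      jacobi-zero : jacobi 0 y a 1# q ≈ₚ 1ₚ
      jacobi-zero = coeffwise λ
        { zero    → trans (*-identityʳ _) (⁻¹-inverse (1# * 1#) (λ p → 1≉0 (trans (sym (*-identityʳ 1#)) p)))
        ; (suc n) → refl }

      φ-jacobi-vanishes : ∀ n → φ (jacobi (suc n) y a 1# q) ≈ 0#
      φ-jacobi-vanishes n = begin
        φ Pₙ                                ≈⟨ φ-cong (P.*-identityʳ Pₙ) ⟨
        φ (Pₙ *ₚ 1ₚ)                        ≈⟨ φ-cong (P.*-congˡ {Pₙ} jacobi-zero) ⟨
        φ (Pₙ *ₚ jacobi 0 y a 1# q)  ≈⟨ Orthogonality.IsOrthogonal.off-diagonal orthogonal (suc n) 0 (λ ()) ⟩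
        0#                                  ∎
        where Pₙ = jacobi (suc n) y a 1# q

      -- The sequences φ(yᵏ) and `moment k` satisfy the same triangular system: the sums of c(k)qᵏ
      -- times either of them over k ≤ n vanish for n ≥ 1. The lower terms agree by induction and
      -- cancel; the leading coefficient is invertible.
      step : ∀ n → (∀ {k} → k ℕ.< n → φ (y ^ₚ k) ≈ moment k) → φ (y ^ₚ n) ≈ moment n
      step zero    h = trans φ1≈1 (sym (trans (*-congˡ (⁻¹-cong (+-congˡ (-‿cong (*-identityʳ z)))))
        (⁻¹-inverse _ (1-x-nonzero (λ z≈1 → zqʲ≉1 0 (trans (*-identityʳ z) z≈1))))))
      step (suc n) h = *-cancelʳ _ (leading-nonzero (suc n)) (begin
        φ (y ^ₚ suc n) * (c (suc n) * q ^ suc n)      ≈⟨ rearrange _ _ _ ⟩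
        c (suc n) * (q ^ suc n * φ (y ^ₚ suc n))      ≈⟨ +-cancelˡ (sumTo (suc n) (λ k → c k * (q ^ k * moment k))) _ _ (begin
            sumTo (suc n) (λ k → c k * (q ^ k * moment k)) + c (suc n) * (q ^ suc n * φ (y ^ₚ suc n))
              ≈⟨ +-congʳ (sumTo-cong (suc n) (λ k k<n → *-congˡ (*-congˡ (h k<n)))) ⟨
            sumTo (suc (suc n)) (λ k → c k * (q ^ k * φ (y ^ₚ k)))
              ≈⟨ φ-jacobi (suc n) ⟨
            φ (jacobi (suc n) y a 1# q)
              ≈⟨ φ-jacobi-vanishes n ⟩
            0#
              ≈⟨ sum-vanishes n ⟨
            sumTo (suc (suc n)) (λ k → c k * (q ^ k * moment k)) ∎) ⟩
        c (suc n) * (q ^ suc n * moment (suc n))      ≈⟨ rearrange _ _ _ ⟨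
        moment (suc n) * (c (suc n) * q ^ suc n)      ∎)
        where
        c : ℕ → Carrier
        c = coefficient (suc n)
        rearrange : ∀ u v w → u * (v * w) ≈ v * (w * u)
        rearrange u v w = trans (*-comm u _) (*-assoc v w u)

    φ-power : ∀ n → φ (y ^ₚ n) ≈ moment n
    φ-power = ℕ.<-rec _ step

module IntegerPowers (F : Field) (q : Field.Carrier F) (q≉0 : ¬ (Field._≈_ F q (Field.0# F))) where

  open Field F
  open FieldProperties F
  open Exp semiring using (^-homo-*)
  open SetoidReasoning setoid

  ^ℤ-⊖ : ∀ m n → q ^ℤ (m ℤ.⊖ n) * q ^ n ≈ q ^ m
  ^ℤ-⊖ m       zero    = *-identityʳ _
  ^ℤ-⊖ zero    (suc n) = trans (*-comm _ _) (⁻¹-inverse _ (^-nonzero (suc n) q≉0))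
  ^ℤ-⊖ (suc m) (suc n) = begin
    q ^ℤ (suc m ℤ.⊖ suc n) * (q * q ^ n)  ≡⟨ ≡.cong (λ i → q ^ℤ i * (q * q ^ n)) (ℤ.[1+m]⊖[1+n]≡m⊖n m n) ⟩
    q ^ℤ (m ℤ.⊖ n) * (q * q ^ n)          ≈⟨ trans (sym (*-assoc _ _ _)) (trans (*-congʳ (*-comm _ q)) (*-assoc _ _ _)) ⟩
    q * (q ^ℤ (m ℤ.⊖ n) * q ^ n)          ≈⟨ *-congˡ (^ℤ-⊖ m n) ⟩
    q * q ^ m                             ∎

  ^ℤ-+ : ∀ m i → q ^ℤ (+ m ℤ.+ i) ≈ q ^ m * q ^ℤ i
  ^ℤ-+ m (+ n)      = ^-homo-* q m n
  ^ℤ-+ m (-[1+ n ]) = *-cancelʳ (q ^ suc n) (^-nonzero (suc n) q≉0) (begin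
    q ^ℤ (m ℤ.⊖ suc n) * q ^ suc n            ≈⟨ ^ℤ-⊖ m (suc n) ⟩
    q ^ m                                     ≈⟨ *-identityʳ _ ⟨
    q ^ m * 1#                                ≈⟨ *-congˡ (^ℤ-⊖ 0 (suc n)) ⟨
    q ^ m * (q ^ℤ -[1+ n ] * q ^ suc n)       ≈⟨ *-assoc _ _ _ ⟨
    q ^ m * q ^ℤ -[1+ n ] * q ^ suc n         ∎)

  -- Applied with n = r: the parameter a = zq⁻ʳ times the base qʳ is z, which is the lower parameter
  -- of the polynomials.
  *-^ℤ-cancel : ∀ x n → x * q ^ℤ (ℤ.- (+ n)) * q ^ n ≈ x
  *-^ℤ-cancel x n = begin
    x * q ^ℤ (ℤ.- (+ n)) * q ^ n      ≈⟨ *-assoc _ _ _ ⟩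
    x * (q ^ℤ (ℤ.- (+ n)) * q ^ n)    ≡⟨ ≡.cong (λ i → x * (q ^ℤ i * q ^ n)) (≡.sym (ℤ.⊖-swap 0 n)) ⟩
    x * (q ^ℤ (0 ℤ.⊖ n) * q ^ n)      ≈⟨ *-congˡ (^ℤ-⊖ 0 n) ⟩
    x * 1#                            ≈⟨ *-identityʳ x ⟩
    x                                 ∎

module ShiftedJacobi (F : Field) (q z : Field.Carrier F) where

  open Field F
  open Polynomials commutativeRing
  open QAnalogues F using () renaming (littleqJacobi to jacobi)

  argument : ℤ → Poly
  argument c = (q ^ℤ (ℤ.- c)) ·ₚ (1ₚ +ₚ (q - 1#) ·ₚ X)

  -- Opaque because comparing two unfolded instances over ℚ(q, Z) is infeasible.
  opaque
    shifted : ℕ → ℤ → ℕ → Poly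
    shifted r c n = jacobi n ((q ^ℤ (ℤ.- c)) ·ₚ (1ₚ +ₚ (q - 1#) ·ₚ X)) (z * q ^ℤ (ℤ.- (+ r))) 1# (q ^ r)

module ShiftedJacobiFunctional (F : Field) where

  open Field F
  open Polynomials commutativeRing
  open QAnalogues F using () renaming (littleqJacobi to jacobi)

  module Moments (q z : Carrier) (q≉0 : ¬ (q ≈ 0#)) (r : ℕ)
    (qʳʲ≉1 : ∀ j → ¬ ((q ^ r) ^ suc j ≈ 1#))
    (zqʳʲ≉1 : ∀ j → ¬ (z * (q ^ r) ^ j ≈ 1#))
    (c : ℤ) (φ : Poly → Carrier)
    (linear : Orthogonality.IsLinearFunctional F φ) (φ1≈1 : φ 1ₚ ≈ 1#)
    (orthogonal : Orthogonality.IsOrthogonal F φ (ShiftedJacobi.shifted F q z r c))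
    where

    open ShiftedJacobi F q z

    opaque
      unfolding shifted

      orthogonal′ : Orthogonality.IsOrthogonal F φ (λ n → jacobi n (argument c) (z * q ^ℤ (ℤ.- (+ r))) 1# (q ^ r))
      orthogonal′ = orthogonal

    open Jacobi.Moments F (q ^ r) z (z * q ^ℤ (ℤ.- (+ r))) (FieldProperties.^-nonzero F r q≉0) qʳʲ≉1 zqʳʲ≉1
      (IntegerPowers.*-^ℤ-cancel F q q≉0 z r) (argument c) φ linear φ1≈1 orthogonal′ public using (moment; φ-power)

-- From φ(yᵐ) to the expansion of φ(xⁿ) in Z

module Constants (F : Field) where

  open RationalFunctions F
  open Expansions F
  open SeriesModule F using (_▷_; 𝟙)
  private
    module F = Field F
    module FS = IntegerSolver F.commutativeRing
    module K = Field fractionField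

  κ : F.Carrier → Fraction
  κ a = ι (a ∷ [])

  ∷[]-cong : ∀ {a b} → a F.≈ b → a ∷ [] ≈ₚ b ∷ []
  ∷[]-cong p = coeffwise λ { zero → p ; (suc n) → F.refl }

  κ-cong : ∀ {a b} → a F.≈ b → κ a K.≈ κ b
  κ-cong p = ι-cong (∷[]-cong p)

  κ-injective : ∀ {a b} → κ a K.≈ κ b → a F.≈ b
  κ-injective p = coeff-≈ (ι-injective p) 0

  κ-* : ∀ a b → κ (a F.* b) K.≈ κ a K.* κ b
  κ-* a b = K.trans (ι-cong (∷[]-cong (F.sym (F.+-identityʳ _)))) (ι-* (a ∷ []) (b ∷ []))

  κ-+ : ∀ a b → κ (a F.+ b) K.≈ κ a K.+ κ b
  κ-+ a b = ι-+ (a ∷ []) (b ∷ [])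

  κ-^ : ∀ a n → κ (a F.^ n) K.≈ κ a K.^ n
  κ-^ a zero    = K.refl
  κ-^ a (suc n) = K.trans (κ-* a (a F.^ n)) (K.*-congˡ {κ a} (κ-^ a n))

  κ-nonzero : ∀ {a} → ¬ (a F.≈ F.0#) → ¬ (κ a K.≈ K.0#)
  κ-nonzero a≉0 p = a≉0 (coeff-≈ (ι-injective p) 0)

  κ-inverse : ∀ {a b} → a F.* b F.≈ F.1# → κ a K.* κ b K.≈ K.1#
  κ-inverse {a} {b} p = K.trans (K.sym (κ-* a b)) (κ-cong p)

  linearFactor : F.Carrier → Poly
  linearFactor w = F.1# ∷ F.- w ∷ []

  linearFactor≉0 : ∀ w → ¬ (linearFactor w ≈ₚ 0ₚ)
  linearFactor≉0 w p = F.1≉0 (coeff-≈ p 0)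

  ι-linearFactor : ∀ w → ι (linearFactor w) K.≈ K.1# K.- ι X K.* κ w
  ι-linearFactor w = begin
    ι (linearFactor w)
      ≈⟨ ι-cong (coeffwise λ { zero → FS.solve 1 (λ w → FS.:1 FS.:= FS.:1 FS.:+ (FS.:- (FS.con (+ 0) FS.:* w FS.:+ FS.con (+ 0)))) F.refl w
                             ; (suc zero) → F.-‿cong (F.sym (F.trans (F.+-identityʳ _) (F.*-identityˡ _)))
                             ; (suc (suc n)) → F.refl }) ⟩
    ι (1ₚ +ₚ (-ₚ (X *ₚ (w ∷ []))))
      ≈⟨ ι-+ 1ₚ (-ₚ (X *ₚ (w ∷ []))) ⟩
    K.1# K.- ι (X *ₚ (w ∷ []))
      ≈⟨ K.+-congˡ {K.1#} (K.-‿cong {ι (X *ₚ (w ∷ []))} {ι X K.* κ w} (ι-* X (w ∷ []))) ⟩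
    K.1# K.- ι X K.* κ w ∎
    where open SetoidReasoning K.setoid

  linearFactor-▷ : ∀ w s k → (linearFactor w ▷ s) (suc k) F.≈ s (suc k) F.- w F.* s k
  linearFactor-▷ w s k = F.+-cong (F.*-identityˡ _) (F.trans (constant-▷ (F.- w) s k) (F.sym (RingProperties.-‿distribˡ-* F.ring w (s k))))

  geometric : ∀ w → linearFactor w ▷ (w F.^_) ≋ 𝟙
  geometric w zero    = F.trans (F.+-identityʳ _) (F.*-identityˡ _)
  geometric w (suc k) = F.trans (linearFactor-▷ w (w F.^_) k) (F.-‿inverseʳ _)

module BracketSeries (F : Field) where

  private
    module F = Field F
    module RF = RationalFunctions F

  -- The shape of momentSeries over a general field, so that its instance at ℚ(q) is
  -- recognised as momentSeries by unfolding alone.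
  bracketSeries : F.Carrier → ℕ → ℤ → ℕ → RF.PowerSeries
  bracketSeries q₀ r c n = RF.coeff (RF.1ₚ RF.+ₚ (RF.-ₚ RF.X)) RF.⊛ λ k → QAnalogues.[_]⟨_⟩ F (+ (r ℕ.* k) ℤ.+ c) q₀ F.^ n

module ShiftedMoments (F : Field) (q₀ : Field.Carrier F)
  (q₀≉0 : ¬ (Field._≈_ F q₀ (Field.0# F)))
  (q₀ʲ≉1 : ∀ j → ¬ (Field._≈_ F (Field._^_ F q₀ (suc j)) (Field.1# F)))
  (r′ : ℕ) (c : ℤ)
  where

  open RationalFunctions F
    using (PowerSeries; _≋_; _ExpandsTo_; ι; fractionField)
  open Constants F
  open Expansions F
  open SeriesModule F
  module K = Field fractionField
  private
    module F = Field F
    module S = RationalFunctions F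
    module P = Polynomials K.commutativeRing
    module PR = CommutativeRing P.polyRing
    module KF = FieldProperties fractionField
    module FF = FieldProperties F
    module FS = IntegerSolver F.commutativeRing
    module KS = IntegerSolver K.commutativeRing

  r : ℕ
  r = suc r′

  q Z Q : K.Carrier
  q = κ q₀
  Z = ι S.X
  Q = q K.^ r

  Q₀ : F.Carrier
  Q₀ = q₀ F.^ r

  κQ₀^ : ∀ j → κ (Q₀ F.^ j) K.≈ Q K.^ j
  κQ₀^ j = K.trans (κ-^ Q₀ j) (Exp.^-congˡ K.semiring j (κ-^ q₀ r))

  q≉0 : ¬ (q K.≈ K.0#)
  q≉0 = κ-nonzero q₀≉0

  Qʲ≉1 : ∀ j → ¬ (Q K.^ suc j K.≈ K.1#)
  -- The exponent r(j+1) computes to `suc (j ℕ.+ r′ ℕ.* suc j)`; it is positive because r =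
  -- `suc r′`.
  Qʲ≉1 j p = q₀ʲ≉1 (j ℕ.+ r′ ℕ.* suc j)
    (F.trans (F.sym (Exp.^-assocʳ F.semiring q₀ r (suc j))) (κ-injective (K.trans (κQ₀^ (suc j)) p)))

  ι-linearFactor^ : ∀ j → ι (linearFactor (Q₀ F.^ j)) K.≈ K.1# K.- Z K.* Q K.^ j
  ι-linearFactor^ j = K.trans (ι-linearFactor (Q₀ F.^ j)) (K.+-congˡ {K.1#} (K.-‿cong {Z K.* κ (Q₀ F.^ j)} (K.*-congˡ {Z} (κQ₀^ j))))

  -- 1 - QʲZ is a polynomial in Z with constant term 1, hence not zero.
  ZQʲ≉1 : ∀ j → ¬ (Z K.* Q K.^ j K.≈ K.1#)
  ZQʲ≉1 j p = linearFactor≉0 (Q₀ F.^ j) (ι-injective (K.trans (ι-linearFactor^ j)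
    (K.trans (K.+-congˡ {K.1#} (K.-‿cong {Z K.* Q K.^ j} p)) (K.-‿inverseʳ K.1#))))

  open ShiftedJacobi fractionField q Z using (shifted)

  u : K.Carrier
  u = q K.^ℤ (ℤ.- c)

  y : P.Poly
  y = ShiftedJacobi.argument fractionField q Z c

  1-q₀≉0 : ¬ (F.1# F.- q₀ F.≈ F.0#)
  1-q₀≉0 = FF.1-x-nonzero (λ p → q₀ʲ≉1 0 (F.trans (F.*-identityʳ q₀) p))

  -- x = α + β y
  α₀ β₀ : F.Carrier
  α₀ = (F.1# F.- q₀) F.⁻¹
  β₀ = F.- (q₀ F.^ℤ c F.* α₀)

  -- Of the two powers, the one with negative exponent is defined by an inverse: this is formed in
  -- F(Z) if c > 0 and in F if c < 0, so the two signs need separate arguments.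
  κq₀ᶜ-inverse : ∀ c → κ (q₀ F.^ℤ c) K.* q K.^ℤ (ℤ.- c) K.≈ K.1#
  κq₀ᶜ-inverse (+ zero)   = K.*-identityˡ K.1#
  κq₀ᶜ-inverse (+ suc n)  = K.trans (K.*-congʳ {(q K.^ suc n) K.⁻¹} (κ-^ q₀ (suc n)))
    (K.⁻¹-inverse (q K.^ suc n) (KF.^-nonzero (suc n) q≉0))
  κq₀ᶜ-inverse (-[1+ n ]) = K.trans (K.*-congˡ {κ ((q₀ F.^ suc n) F.⁻¹)} (K.sym (κ-^ q₀ (suc n))))
    (κ-inverse (F.trans (F.*-comm _ _) (F.⁻¹-inverse _ (FF.^-nonzero (suc n) q₀≉0))))

  -- Solving y = q⁻ᶜ(1 + (q-1)x) gives x = (1 - qᶜy)/(1-q). In both nontrivial coefficients the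
  -- check reduces to βq⁻ᶜ = -α.
  X-affine : P.X P.≈ₚ κ α₀ P.·ₚ P.1ₚ P.+ₚ κ β₀ P.·ₚ y
  X-affine = P.coeffwise λ
    { zero → K.sym (begin
        α K.* K.1# K.+ β K.* (u K.* (K.1# K.+ (q K.- K.1#) K.* K.0#))
          ≈⟨ KS.solve 4 (λ α β u q → α KS.:* KS.:1 KS.:+ β KS.:* (u KS.:* (KS.:1 KS.:+ (q KS.:- KS.:1) KS.:* KS.con (+ 0)))
               KS.:= α KS.:+ β KS.:* u) K.refl α β u q ⟩
        α K.+ β K.* u        ≈⟨ K.+-congˡ {α} βu ⟩
        α K.- α              ≈⟨ K.-‿inverseʳ α ⟩
        K.0#                 ∎)
    ; (suc zero) → K.sym (begin
        β K.* (u K.* ((q K.- K.1#) K.* K.1#))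
          ≈⟨ KS.solve 3 (λ β u q → β KS.:* (u KS.:* ((q KS.:- KS.:1) KS.:* KS.:1)) KS.:= β KS.:* u KS.:* (q KS.:- KS.:1)) K.refl β u q ⟩
        β K.* u K.* (q K.- K.1#)      ≈⟨ K.*-congʳ {q K.- K.1#} βu ⟩
        (K.- α) K.* (q K.- K.1#)
          ≈⟨ KS.solve 2 (λ α q → (KS.:- α) KS.:* (q KS.:- KS.:1) KS.:= (KS.:1 KS.:- q) KS.:* α) K.refl α q ⟩
        (K.1# K.- q) K.* α            ≈⟨ K.*-congʳ {α} (κ-+ F.1# (F.- q₀)) ⟨
        κ (F.1# F.- q₀) K.* α         ≈⟨ κ-inverse (F.⁻¹-inverse _ 1-q₀≉0) ⟩
        K.1# ∎)
    ; (suc (suc n)) → K.refl }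
    where
    open SetoidReasoning K.setoid
    α = κ α₀
    β = κ β₀
    βu : β K.* u K.≈ K.- α
    βu = begin
      (K.- κ (q₀ F.^ℤ c F.* α₀)) K.* u
        ≈⟨ K.*-congʳ {u} (K.-‿cong {κ (q₀ F.^ℤ c F.* α₀)} (κ-* (q₀ F.^ℤ c) α₀)) ⟩
      (K.- (κ (q₀ F.^ℤ c) K.* α)) K.* u
        ≈⟨ KS.solve 3 (λ w α u → (KS.:- (w KS.:* α)) KS.:* u KS.:= KS.:- (w KS.:* u KS.:* α)) K.refl (κ (q₀ F.^ℤ c)) α u ⟩
      K.- (κ (q₀ F.^ℤ c) K.* u K.* α)
        ≈⟨ K.-‿cong {κ (q₀ F.^ℤ c) K.* u K.* α} (K.trans (K.*-congʳ {α} (κq₀ᶜ-inverse c)) (K.*-identityˡ α)) ⟩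
      K.- α ∎

  -- (α + β Qᵏ)ⁿ = [rk+c]ⁿ, weighted by Qᵏᵐ to account for yᵐ.
  weightedPowers : ℕ → ℕ → PowerSeries
  weightedPowers m n k = (Q₀ F.^ m) F.^ k F.* (α₀ F.+ β₀ F.* Q₀ F.^ k) F.^ n

  1-Z : S.Poly
  1-Z = S.1ₚ S.+ₚ (S.-ₚ S.X)

  ι-1-Z : ι 1-Z K.≈ K.1# K.- Z
  ι-1-Z = ι-+ S.1ₚ (S.-ₚ S.X)

  bracket : ∀ k → α₀ F.+ β₀ F.* Q₀ F.^ k F.≈ (F.1# F.- q₀ F.^ℤ (+ (r ℕ.* k) ℤ.+ c)) F.÷ (F.1# F.- q₀)
  bracket k = begin
    α₀ F.+ F.- (q₀ F.^ℤ c F.* α₀) F.* Q₀ F.^ k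
      ≈⟨ FS.solve 3 (λ α w x → α FS.:+ (FS.:- (w FS.:* α)) FS.:* x FS.:= (FS.:1 FS.:- x FS.:* w) FS.:* α) F.refl α₀ (q₀ F.^ℤ c) (Q₀ F.^ k) ⟩
    (F.1# F.- Q₀ F.^ k F.* q₀ F.^ℤ c) F.* α₀
      ≈⟨ F.*-congʳ (F.+-congˡ (F.-‿cong (F.trans (F.*-congʳ (Exp.^-assocʳ F.semiring q₀ r k))
           (F.sym (IntegerPowers.^ℤ-+ F q₀ q₀≉0 (r ℕ.* k) c))))) ⟩
    (F.1# F.- q₀ F.^ℤ (+ (r ℕ.* k) ℤ.+ c)) F.* α₀ ∎
    where open SetoidReasoning F.setoid

  bracketPowers : ℕ → PowerSeries
  bracketPowers n k = QAnalogues.[_]⟨_⟩ F (+ (r ℕ.* k) ℤ.+ c) q₀ F.^ n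

  module _ (φ : P.Poly → K.Carrier)
    (linear : Orthogonality.IsLinearFunctional fractionField φ) (φ1≈1 : φ P.1ₚ K.≈ K.1#)
    (orthogonal : Orthogonality.IsOrthogonal fractionField φ (shifted r c))
    where

    open ShiftedJacobiFunctional.Moments fractionField q Z q≉0 r Qʲ≉1 ZQʲ≉1 c φ linear φ1≈1 orthogonal using (moment; φ-power)
    open Functionals.Linear fractionField φ linear
    open PolynomialProperties K.commutativeRing

    moment-expansion : ∀ m → moment m ExpandsTo (1-Z ▷ weightedPowers m 0)
    moment-expansion m = quotient-ExpandsTo {moment m} {ι 1-Z} (linearFactor≉0 (Q₀ F.^ m))
      (K.trans (K.*-congʳ {moment m} (ι-linearFactor^ m))
        (K.trans (KF.*-÷-cancel (K.1# K.- Z) (KF.1-x-nonzero (ZQʲ≉1 m))) (K.sym ι-1-Z)))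
      (ι-ExpandsTo 1-Z)
      (begin
        1-Z ▷ 𝟙                                                       ≈⟨ ▷-congˡ 1-Z (geometric (Q₀ F.^ m)) ⟨
        1-Z ▷ linearFactor (Q₀ F.^ m) ▷ (λ k → (Q₀ F.^ m) F.^ k)      ≈⟨ ▷-comm 1-Z (linearFactor (Q₀ F.^ m)) _ ⟩
        linearFactor (Q₀ F.^ m) ▷ 1-Z ▷ (λ k → (Q₀ F.^ m) F.^ k)      ≈⟨ ▷-congˡ (linearFactor (Q₀ F.^ m)) (▷-congˡ 1-Z (λ k → F.sym (F.*-identityʳ _))) ⟩
        linearFactor (Q₀ F.^ m) ▷ 1-Z ▷ weightedPowers m 0            ∎)
      where open SetoidReasoning seriesSetoid

    φ-X : ∀ f → φ (f P.*ₚ P.X) K.≈ κ α₀ K.* φ f K.+ κ β₀ K.* φ (y P.*ₚ f)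
    φ-X f = begin
      φ (f P.*ₚ P.X)
        ≈⟨ φ-cong (PR.*-congˡ {f} X-affine) ⟩
      φ (f P.*ₚ (κ α₀ P.·ₚ P.1ₚ P.+ₚ κ β₀ P.·ₚ y))
        ≈⟨ φ-cong (PR.distribˡ f (κ α₀ P.·ₚ P.1ₚ) (κ β₀ P.·ₚ y)) ⟩
      φ (f P.*ₚ (κ α₀ P.·ₚ P.1ₚ) P.+ₚ f P.*ₚ (κ β₀ P.·ₚ y))
        ≈⟨ φ-+ (f P.*ₚ (κ α₀ P.·ₚ P.1ₚ)) (f P.*ₚ (κ β₀ P.·ₚ y)) ⟩
      φ (f P.*ₚ (κ α₀ P.·ₚ P.1ₚ)) K.+ φ (f P.*ₚ (κ β₀ P.·ₚ y))
        ≈⟨ K.+-cong (scalar (κ α₀) P.1ₚ f (PR.*-identityʳ f)) (scalar (κ β₀) y (y P.*ₚ f) (PR.*-comm f y)) ⟩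
      κ α₀ K.* φ f K.+ κ β₀ K.* φ (y P.*ₚ f) ∎
      where
      open SetoidReasoning K.setoid
      scalar : ∀ b g h → f P.*ₚ g P.≈ₚ h → φ (f P.*ₚ (b P.·ₚ g)) K.≈ b K.* φ h
      scalar b g h p = K.trans (φ-cong (·-*ʳ b f g)) (K.trans (φ-· b (f P.*ₚ g)) (K.*-congˡ {b} (φ-cong p)))

    -- Induction on n for all m at once: substituting x = α + βy for one factor x leaves φ(yᵐxⁿ) and
    -- φ(yᵐ⁺¹xⁿ), so the exponent of y has to vary.
    weighted-moments : ∀ n m → φ (y P.^ₚ m P.*ₚ P.X P.^ₚ n) ExpandsTo (1-Z ▷ weightedPowers m n)
    weighted-moments zero m = ExpandsTo-cong {moment m}
      (K.trans (K.sym (φ-power m)) (φ-cong (PR.sym (PR.*-identityʳ (y P.^ₚ m))))) ≋-refl (moment-expansion m)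
    weighted-moments (suc n) m = ExpandsTo-cong
      {κ α₀ K.* φ f K.+ κ β₀ K.* φ (y P.^ₚ suc m P.*ₚ P.X P.^ₚ n)} {φ (y P.^ₚ m P.*ₚ P.X P.^ₚ suc n)}
      (K.sym (K.trans (φ-cong (PR.trans (PR.*-congˡ {y P.^ₚ m} (PR.*-comm P.X (P.X P.^ₚ n))) (PR.sym (PR.*-assoc (y P.^ₚ m) (P.X P.^ₚ n) P.X))))
        (K.trans (φ-X f) (K.+-congˡ {κ α₀ K.* φ f} (K.*-congˡ {κ β₀} (φ-cong (PR.sym (PR.*-assoc y (y P.^ₚ m) (P.X P.^ₚ n)))))))))
      series
      (ExpandsTo-+ {κ α₀ K.* φ f} {κ β₀ K.* φ (y P.^ₚ suc m P.*ₚ P.X P.^ₚ n)}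
        (ExpandsTo-ι* (α₀ ∷ []) {φ f} (weighted-moments n m))
        (ExpandsTo-ι* (β₀ ∷ []) {φ (y P.^ₚ suc m P.*ₚ P.X P.^ₚ n)} (weighted-moments n (suc m))))
      where
      f : P.Poly
      f = y P.^ₚ m P.*ₚ P.X P.^ₚ n

      series : (α₀ ∷ []) ▷ 1-Z ▷ weightedPowers m n ⊕ (β₀ ∷ []) ▷ 1-Z ▷ weightedPowers (suc m) n
               ≋ 1-Z ▷ weightedPowers m (suc n)
      series = begin
        (α₀ ∷ []) ▷ 1-Z ▷ weightedPowers m n ⊕ (β₀ ∷ []) ▷ 1-Z ▷ weightedPowers (suc m) n
          ≈⟨ ⊕-cong (constant-▷ α₀ (1-Z ▷ weightedPowers m n)) (constant-▷ β₀ (1-Z ▷ weightedPowers (suc m) n)) ⟩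
        α₀ ⊙ (1-Z ▷ weightedPowers m n) ⊕ β₀ ⊙ (1-Z ▷ weightedPowers (suc m) n)
          ≈⟨ ⊕-cong (▷-⊙ 1-Z α₀ (weightedPowers m n)) (▷-⊙ 1-Z β₀ (weightedPowers (suc m) n)) ⟨
        1-Z ▷ (α₀ ⊙ weightedPowers m n) ⊕ 1-Z ▷ (β₀ ⊙ weightedPowers (suc m) n)
          ≈⟨ ▷-⊕ 1-Z (α₀ ⊙ weightedPowers m n) (β₀ ⊙ weightedPowers (suc m) n) ⟨
        1-Z ▷ (α₀ ⊙ weightedPowers m n ⊕ β₀ ⊙ weightedPowers (suc m) n)
          -- (Qᵐ⁺¹)ᵏ = Qᵏ(Qᵐ)ᵏ, and the extra Qᵏ turns the two summands into one more factor α +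
          -- βQᵏ.
          ≈⟨ ▷-congˡ 1-Z (λ k → F.trans
               (F.+-congˡ (F.*-congˡ (F.*-congʳ (CommutativeExp.^-distrib-* F.commutativeSemiring Q₀ (Q₀ F.^ m) k))))
               (FS.solve 5 (λ α β x e w → α FS.:* (w FS.:* e) FS.:+ β FS.:* (x FS.:* w FS.:* e) FS.:= w FS.:* ((α FS.:+ β FS.:* x) FS.:* e)) F.refl
                 α₀ β₀ (Q₀ F.^ k) ((α₀ F.+ β₀ F.* Q₀ F.^ k) F.^ n) ((Q₀ F.^ m) F.^ k))) ⟩
        1-Z ▷ weightedPowers m (suc n) ∎
        where open SetoidReasoning seriesSetoid

    moments : ∀ n → φ (P.X P.^ₚ n) ExpandsTo (1-Z ▷ bracketPowers n)
    moments n = ExpandsTo-cong {φ (P.1ₚ P.*ₚ P.X P.^ₚ n)} (φ-cong (PR.*-identityˡ (P.X P.^ₚ n)))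
      (▷-congˡ 1-Z (λ k → F.trans (F.*-congʳ (1^ k)) (F.trans (F.*-identityˡ _) (Exp.^-congˡ F.semiring n (bracket k)))))
      (weighted-moments n 0)
      where
      1^ : ∀ k → F.1# F.^ k F.≈ F.1#
      1^ zero    = F.refl
      1^ (suc k) = F.trans (F.*-identityˡ _) (1^ k)

    moments-⊛ : ∀ n → φ (P.X P.^ₚ n) ExpandsTo BracketSeries.bracketSeries F q₀ r c n
    moments-⊛ n = ExpandsTo-cong {φ (P.X P.^ₚ n)} K.refl (≋-sym (⊛≋▷ 1-Z (bracketPowers n))) (moments n)

-- The total order on letters and the increasing list of coloured letters

≺-trans : Transitive _≺_
≺-trans (coloured-base p)   (coloured-base q)   = coloured-base (ℕ.<-trans q p)
≺-trans (coloured-base p)   (coloured-colour q) = coloured-base p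
≺-trans (coloured-base p)   coloured-𝟎          = coloured-𝟎
≺-trans (coloured-base p)   coloured-plain      = coloured-plain
≺-trans (coloured-colour p) (coloured-base q)   = coloured-base q
≺-trans (coloured-colour p) (coloured-colour q) = coloured-colour (ℕ.<-trans q p)
≺-trans (coloured-colour p) coloured-𝟎          = coloured-𝟎
≺-trans (coloured-colour p) coloured-plain      = coloured-plain
≺-trans coloured-𝟎          𝟎-plain             = coloured-plain
≺-trans coloured-plain      (plain-plain q)     = coloured-plain
≺-trans 𝟎-plain             (plain-plain q)     = 𝟎-plain
≺-trans (plain-plain p)     (plain-plain q)     = plain-plain (ℕ.<-trans p q)

≺-compare : Trichotomous _≡_ _≺_
≺-compare 𝟎            𝟎            = tri≈ (λ ()) ≡.refl (λ ())
≺-compare 𝟎            (j ^^ zero)  = tri< 𝟎-plain (λ ()) (λ ())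
≺-compare 𝟎            (j ^^ suc d) = tri> (λ ()) (λ ()) coloured-𝟎
≺-compare (i ^^ zero)  𝟎            = tri> (λ ()) (λ ()) 𝟎-plain
≺-compare (i ^^ zero)  (j ^^ zero)  with ℕ.<-cmp i j
... | tri< p ¬q ¬r     = tri< (plain-plain p) (λ { ≡.refl → ¬q ≡.refl }) (λ { (plain-plain r) → ¬r r })
... | tri≈ ¬p ≡.refl ¬r = tri≈ (λ { (plain-plain p) → ¬p p }) ≡.refl (λ { (plain-plain r) → ¬r r })
... | tri> ¬p ¬q r     = tri> (λ { (plain-plain p) → ¬p p }) (λ { ≡.refl → ¬q ≡.refl }) (plain-plain r)
≺-compare (i ^^ zero)  (j ^^ suc d) = tri> (λ ()) (λ ()) coloured-plain
≺-compare (i ^^ suc c) 𝟎            = tri< coloured-𝟎 (λ ()) (λ ())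
≺-compare (i ^^ suc c) (j ^^ zero)  = tri< coloured-plain (λ ()) (λ ())
≺-compare (i ^^ suc c) (j ^^ suc d) with ℕ.<-cmp i j
... | tri< p ¬q ¬r = tri> (λ { (coloured-base r) → ¬r r ; (coloured-colour _) → ¬q ≡.refl }) (λ { ≡.refl → ¬q ≡.refl }) (coloured-base p)
... | tri> ¬p ¬q r = tri< (coloured-base r) (λ { ≡.refl → ¬q ≡.refl }) (λ { (coloured-base p) → ¬p p ; (coloured-colour _) → ¬q ≡.refl })
... | tri≈ ¬p ≡.refl ¬r with ℕ.<-cmp c d
...   | tri< p ¬q′ ¬r′ = tri> (λ { (coloured-base r) → ¬r r ; (coloured-colour r) → ¬r′ r }) (λ { ≡.refl → ¬q′ ≡.refl }) (coloured-colour p)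
...   | tri> ¬p′ ¬q′ r = tri< (coloured-colour r) (λ { ≡.refl → ¬q′ ≡.refl }) (λ { (coloured-base p) → ¬p p ; (coloured-colour p) → ¬p′ p })
...   | tri≈ ¬p′ ≡.refl ¬r′ = tri≈ (λ { (coloured-base p) → ¬p p ; (coloured-colour p) → ¬p′ p }) ≡.refl
                                  (λ { (coloured-base r) → ¬r r ; (coloured-colour r) → ¬r′ r })

letterOrder : StrictTotalOrder 0ℓ 0ℓ 0ℓ
letterOrder = record
  { Carrier = Letter ; _≈_ = _≡_ ; _<_ = _≺_
  ; isStrictTotalOrder = isStrictTotalOrderᶜ (record { isEquivalence = ≡.isEquivalence ; trans = ≺-trans ; compare = ≺-compare }) }

open IsStrictTotalOrder (StrictTotalOrder.isStrictTotalOrder letterOrder) public using () renaming (irrefl to ≺-irrefl; asym to ≺-asym)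

module ColouredLetters (n r : ℕ) where

  Element : Set
  Element = Fin n × Fin r

  letter : Element → Letter
  letter (i , c) = suc (toℕ i) ^^ toℕ c

  infix 4 _⊏_
  _⊏_ : Element → Element → Set
  u ⊏ v = letter u ≺ letter v

  letter-injective : ∀ {u v} → letter u ≡ letter v → u ≡ v
  letter-injective {i , c} {j , d} p = ≡.cong₂ _,_ (Fin.toℕ-injective (base p)) (Fin.toℕ-injective (colour p))
    where
    base : ∀ {a b x y} → suc a ^^ x ≡ suc b ^^ y → a ≡ b
    base ≡.refl = ≡.refl
    colour : ∀ {a b x y} → suc a ^^ x ≡ suc b ^^ y → x ≡ y
    colour ≡.refl = ≡.refl

  elements : List Element
  elements = List.cartesianProduct (allFin n) (allFin r)

  private
    order : DecTotalOrder 0ℓ 0ℓ 0ℓ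
    order = StrictTotalOrderProperties.decTotalOrder (On.strictTotalOrder letterOrder letter)

    module S = Sort order

  increasing : List Element
  increasing = S.sort elements

  increasing-↭ : increasing ↭ elements
  increasing-↭ = S.sort-↭ elements

  -- Sorting yields only the weak order. It is strict because `elements` has no repetition, which a
  -- permutation preserves, and `letter` is injective.
  increasing-⊏ : AllPairs _⊏_ increasing
  increasing-⊏ = AllPairs.zipWith strict (Sorted.Sorted⇒AllPairs (DecTotalOrder.totalOrder order) (S.sort-↗ elements) , distinct)
    where
    distinct : ListUnique.Unique increasing
    distinct = Permutation.Unique-resp-↭ (≡.setoid Element) (↭.↭⇒↭ₛ (↭-sym increasing-↭))
      (ListUniqueProperties.cartesianProduct⁺ (ListUniqueProperties.allFin⁺ n) (ListUniqueProperties.allFin⁺ r))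
    strict : ∀ {u v} → DecTotalOrder._≤_ order u v × u ≢ v → u ⊏ v
    strict (inj₁ u⊏v , _)   = u⊏v
    strict (inj₂ eq  , u≢v) = contradiction (letter-injective eq) u≢v

-- Sums over lists, subsets and products over subsets

module ListSums (R : CommutativeRing 0ℓ 0ℓ) where

  open CommutativeRing R hiding (zero)
  open RangeSums R
  open CommutativeSemigroupProperties +-commutativeSemigroup using (interchange; x∙yz≈y∙xz)
  open SetoidReasoning setoid

  private variable
    A B C : Set

  ⟨_⟩ : Bool → Carrier
  ⟨ b ⟩ = if b then 1# else 0#

  -- The same fold as in `generatingPolynomial`, so that the two agree by unfolding.
  ∑ : List A → (A → Carrier) → Carrier
  ∑ xs f = List.foldr _+_ 0# (List.map f xs)

  ∑-cong-All : ∀ {xs : List A} {f g} → All (λ x → f x ≈ g x) xs → ∑ xs f ≈ ∑ xs g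
  ∑-cong-All []       = refl
  ∑-cong-All (p ∷ ps) = +-cong p (∑-cong-All ps)

  ∑-cong : ∀ (xs : List A) {f g} → (∀ x → f x ≈ g x) → ∑ xs f ≈ ∑ xs g
  ∑-cong xs p = ∑-cong-All (All.universal p xs)

  ∑-zero : ∀ (xs : List A) → ∑ xs (λ _ → 0#) ≈ 0#
  ∑-zero []       = refl
  ∑-zero (x ∷ xs) = trans (+-identityˡ _) (∑-zero xs)

  ∑-+ : ∀ (xs : List A) f g → ∑ xs (λ x → f x + g x) ≈ ∑ xs f + ∑ xs g
  ∑-+ []       f g = sym (+-identityˡ 0#)
  ∑-+ (x ∷ xs) f g = trans (+-congˡ (∑-+ xs f g)) (interchange _ _ _ _)

  ∑-*ˡ : ∀ (xs : List A) a f → ∑ xs (λ x → a * f x) ≈ a * ∑ xs f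
  ∑-*ˡ []       a f = sym (zeroʳ a)
  ∑-*ˡ (x ∷ xs) a f = trans (+-congˡ (∑-*ˡ xs a f)) (sym (distribˡ _ _ _))

  ∑-swap : ∀ (xs : List A) (ys : List B) (f : A → B → Carrier) → ∑ xs (λ x → ∑ ys (f x)) ≈ ∑ ys (λ y → ∑ xs (λ x → f x y))
  ∑-swap []       ys f = sym (∑-zero ys)
  ∑-swap (x ∷ xs) ys f = trans (+-congˡ (∑-swap xs ys f)) (sym (∑-+ ys _ _))

  ∑-++ : ∀ (xs ys : List A) f → ∑ (xs ++ ys) f ≈ ∑ xs f + ∑ ys f
  ∑-++ []       ys f = sym (+-identityˡ _)
  ∑-++ (x ∷ xs) ys f = trans (+-congˡ (∑-++ xs ys f)) (sym (+-assoc _ _ _))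

  ∑-map : ∀ (xs : List A) (g : A → B) f → ∑ (List.map g xs) f ≈ ∑ xs (f ∘ g)
  ∑-map []       g f = refl
  ∑-map (x ∷ xs) g f = +-congˡ (∑-map xs g f)

  ∑-cartesianProductWith : ∀ (g : A → B → C) xs ys f →
    ∑ (List.cartesianProductWith g xs ys) f ≈ ∑ xs (λ x → ∑ ys (λ y → f (g x y)))
  ∑-cartesianProductWith g []       ys f = refl
  ∑-cartesianProductWith g (x ∷ xs) ys f = trans (∑-++ (List.map (g x) ys) _ f)
    (+-cong (∑-map ys (g x) f) (∑-cartesianProductWith g xs ys f))

  ∑-filter : ∀ {P : Pred A 0ℓ} (P? : Decidable P) xs f →
    ∑ (List.filter P? xs) f ≈ ∑ xs (λ x → ⟨ does (P? x) ⟩ * f x)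
  ∑-filter P? []       f = refl
  ∑-filter P? (x ∷ xs) f with does (P? x)
  ... | true  = +-cong (sym (*-identityˡ _)) (∑-filter P? xs f)
  ... | false = trans (∑-filter P? xs f) (sym (trans (+-congʳ (zeroˡ _)) (+-identityˡ _)))

  ∑-↭ : ∀ {xs ys : List A} f → xs ↭ ys → ∑ xs f ≈ ∑ ys f
  ∑-↭ f ↭.refl         = refl
  ∑-↭ f (↭.prep x p)   = +-congˡ (∑-↭ f p)
  ∑-↭ f (↭.swap x y p) = trans (+-congˡ (+-congˡ (∑-↭ f p))) (x∙yz≈y∙xz _ _ _)
  ∑-↭ f (↭.trans p q)  = trans (∑-↭ f p) (∑-↭ f q)

  ∑-allFin-suc : ∀ n (f : Fin (suc n) → Carrier) → ∑ (allFin (suc n)) f ≈ f zero + ∑ (allFin n) (f ∘ suc)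
  ∑-allFin-suc n f = +-congˡ (trans
    (reflexive (≡.cong (λ xs → ∑ xs f) (≡.sym (List.map-tabulate {n = n} (λ i → i) suc)))) (∑-map (allFin n) suc f))

  ∑-select : ∀ n (i : Fin n) (f : Fin n → Carrier) → ∑ (allFin n) (λ j → ⟨ does (j Fin.≟ i) ⟩ * f j) ≈ f i
  ∑-select (suc n) zero f = begin
    ∑ (allFin (suc n)) (λ j → ⟨ does (j Fin.≟ zero) ⟩ * f j)      ≈⟨ ∑-allFin-suc n (λ j → ⟨ does (j Fin.≟ zero) ⟩ * f j) ⟩
    1# * f zero + ∑ (allFin n) (λ j → 0# * f (suc j))             ≈⟨ +-cong (*-identityˡ _) (trans (∑-cong (allFin n) (λ j → zeroˡ _)) (∑-zero (allFin n))) ⟩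
    f zero + 0#                                                   ≈⟨ +-identityʳ _ ⟩
    f zero                                                        ∎
  ∑-select (suc n) (suc i) f = begin
    ∑ (allFin (suc n)) (λ j → ⟨ does (j Fin.≟ suc i) ⟩ * f j)                 ≈⟨ ∑-allFin-suc n (λ j → ⟨ does (j Fin.≟ suc i) ⟩ * f j) ⟩
    0# * f zero + ∑ (allFin n) (λ j → ⟨ does (j Fin.≟ i) ⟩ * f (suc j))       ≈⟨ +-cong (zeroˡ _) (∑-select n i (f ∘ suc)) ⟩
    0# + f (suc i)                                                            ≈⟨ +-identityˡ _ ⟩
    f (suc i)                                                                 ∎

  ∑-words-suc : ∀ (xs : List A) m f → ∑ (words xs (suc m)) f ≈ ∑ xs (λ x → ∑ (words xs m) (λ w → f (x ∷ w)))
  ∑-words-suc xs m f = ∑-cartesianProductWith _∷_ xs (words xs m) f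

  sumTo-*ˡ : ∀ n a f → sumTo n (λ k → a * f k) ≈ a * sumTo n f
  sumTo-*ˡ zero    a f = sym (zeroʳ a)
  sumTo-*ˡ (suc n) a f = trans (+-congʳ (sumTo-*ˡ n a f)) (sym (distribˡ _ _ _))

  sumTo-∑ : ∀ n (xs : List A) (f : A → ℕ → Carrier) → sumTo n (λ k → ∑ xs (λ x → f x k)) ≈ ∑ xs (λ x → sumTo n (f x))
  sumTo-∑ zero    xs f = sym (∑-zero xs)
  sumTo-∑ (suc n) xs f = trans (+-congʳ (sumTo-∑ n xs f)) (sym (∑-+ xs _ _))

module Subsets where

  -- A subset is its characteristic vector; below, S consists of the values that the rest of σ may
  -- still take.
  remove : ∀ {n} → Vec Bool n → Fin n → Vec Bool n
  remove S i = S Vec.[ i ]≔ false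

  count : ∀ {n} → Vec Bool n → ℕ
  count []          = 0
  count (true ∷ S)  = suc (count S)
  count (false ∷ S) = count S

  count-remove : ∀ {n} (S : Vec Bool n) i → lookup S i ≡ true → count S ≡ suc (count (remove S i))
  count-remove (true ∷ S)  zero    p = ≡.refl
  count-remove (true ∷ S)  (suc i) p = ≡.cong suc (count-remove S i p)
  count-remove (false ∷ S) (suc i) p = count-remove S i p

  count-full : ∀ n → count (Vec.replicate n true) ≡ n
  count-full zero    = ≡.refl
  count-full (suc n) = ≡.cong suc (count-full n)

open Subsets

module SubsetProducts (R : CommutativeRing 0ℓ 0ℓ) where

  open CommutativeRing R hiding (zero)
  open ListSums R using (⟨_⟩)
  open IntegerSolver R
  open Exp semiring using (_^_)
  open SetoidReasoning setoid

  ⟨⟩-true : ∀ {P : Set} (d : Dec P) → P → ⟨ does d ⟩ ≈ 1#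
  ⟨⟩-true d p = reflexive (≡.cong ⟨_⟩ (dec-true d p))

  ⟨⟩-false : ∀ {P : Set} (d : Dec P) → ¬ P → ⟨ does d ⟩ ≈ 0#
  ⟨⟩-false d ¬p = reflexive (≡.cong ⟨_⟩ (dec-false d ¬p))

  ⟨⟩-*-cong : ∀ b {x y} → (b ≡ true → x ≈ y) → ⟨ b ⟩ * x ≈ ⟨ b ⟩ * y
  ⟨⟩-*-cong true  p = *-congˡ (p ≡.refl)
  ⟨⟩-*-cong false p = trans (zeroˡ _) (sym (zeroˡ _))

  ∏ : ∀ {n} → Vec Bool n → (Fin n → Carrier) → Carrier
  ∏ []          f = 1#
  ∏ (true ∷ S)  f = f zero * ∏ S (f ∘ suc)
  ∏ (false ∷ S) f = ∏ S (f ∘ suc)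

  ∏-cong : ∀ {n} (S : Vec Bool n) {f g : Fin n → Carrier} → (∀ i → f i ≈ g i) → ∏ S f ≈ ∏ S g
  ∏-cong []          p = refl
  ∏-cong (true ∷ S)  p = *-cong (p zero) (∏-cong S (p ∘ suc))
  ∏-cong (false ∷ S) p = ∏-cong S (p ∘ suc)

  ∏-empty : ∀ {n} (S : Vec Bool n) f → count S ≡ 0 → ∏ S f ≈ 1#
  ∏-empty []          f p = refl
  ∏-empty (false ∷ S) f p = ∏-empty S (f ∘ suc) p

  ∏-zero : ∀ {n} (S : Vec Bool n) {m} → count S ≡ suc m → ∏ S (λ _ → 0#) ≈ 0#
  ∏-zero (true ∷ S)  p = zeroˡ _
  ∏-zero (false ∷ S) p = ∏-zero S p

  ∏-full : ∀ n x → ∏ (Vec.replicate n true) (λ _ → x) ≈ x ^ n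
  ∏-full zero    x = refl
  ∏-full (suc n) x = *-congˡ (∏-full n x)

  -- The product is affine in its factor at b: adding w there adds w times the product over the
  -- other elements, provided that b ∈ S.
  ∏-update : ∀ {n} (S : Vec Bool n) b f w →
    ∏ S (λ i → f i + ⟨ does (b Fin.≟ i) ⟩ * w) ≈ ∏ S f + ⟨ lookup S b ⟩ * (w * ∏ (remove S b) f)
  ∏-update (s ∷ S) zero f w = begin
    ∏ (s ∷ S) (λ i → f i + ⟨ does (zero Fin.≟ i) ⟩ * w)                       ≈⟨ head s ⟩
    ∏ (s ∷ S) f + ⟨ s ⟩ * (w * ∏ S (f ∘ suc))                                 ∎
    where
    tail : ∏ S (λ i → f (suc i) + 0# * w) ≈ ∏ S (f ∘ suc)
    tail = ∏-cong S (λ i → trans (+-congˡ (zeroˡ w)) (+-identityʳ _))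
    head : ∀ s → ∏ (s ∷ S) (λ i → f i + ⟨ does (zero Fin.≟ i) ⟩ * w) ≈ ∏ (s ∷ S) f + ⟨ s ⟩ * (w * ∏ S (f ∘ suc))
    head true  = trans (*-congˡ tail) (solve 3 (λ a w p → (a :+ :1 :* w) :* p := a :* p :+ :1 :* (w :* p)) refl (f zero) w _)
    head false = trans tail (sym (trans (+-congˡ (zeroˡ _)) (+-identityʳ _)))
  ∏-update (true ∷ S)  (suc b) f w = begin
    (f zero + 0# * w) * ∏ S (λ i → f (suc i) + ⟨ does (b Fin.≟ i) ⟩ * w)      ≈⟨ *-cong (trans (+-congˡ (zeroˡ w)) (+-identityʳ _)) (∏-update S b (f ∘ suc) w) ⟩
    f zero * (∏ S (f ∘ suc) + ⟨ lookup S b ⟩ * (w * ∏ (remove S b) (f ∘ suc)))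
      ≈⟨ solve 5 (λ a p x w y → a :* (p :+ x :* (w :* y)) := a :* p :+ x :* (w :* (a :* y))) refl (f zero) _ ⟨ lookup S b ⟩ w _ ⟩
    f zero * ∏ S (f ∘ suc) + ⟨ lookup S b ⟩ * (w * (f zero * ∏ (remove S b) (f ∘ suc))) ∎
  ∏-update (false ∷ S) (suc b) f w = ∏-update S b (f ∘ suc) w

-- Chains along words, and their total weight as a product

module Chains (R : CommutativeRing 0ℓ 0ℓ) (q Q : CommutativeRing.Carrier R) where

  open CommutativeRing R hiding (zero)
  open RangeSums R
  open ListSums R
  open Exp semiring using (_^_)

  colour : Letter → ℕ
  colour 𝟎        = 0
  colour (_ ^^ c) = c

  below : Bool → (ℕ → Carrier) → ℕ → Carrier
  below strict h k = sumTo k h + (if strict then 0# else h k)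

  -- For a word x₁ … xₘ preceded by ℓ, the sum of ∏ qᶜᵒˡ⁽ˣʲ⁾ Q^gⱼ over the chains
  -- k ≥ g₁ ≥ … ≥ gₘ ≥ 0 that are strict at the descents of ℓ x₁ … xₘ.
  chains : ∀ {m} → Letter → Vec Letter m → ℕ → Carrier
  chains ℓ []      k = 1#
  chains ℓ (x ∷ v) k = below (does (x ≺? ℓ)) (λ g → q ^ colour x * (Q ^ g * chains x v g)) k

  below-cong : ∀ b {h h′ : ℕ → Carrier} k → (∀ g → h g ≈ h′ g) → below b h k ≈ below b h′ k
  below-cong true  k p = +-congʳ (sumTo-cong k (λ g _ → p g))
  below-cong false k p = +-cong (sumTo-cong k (λ g _ → p g)) (p k)

  below-*ˡ : ∀ b a h k → below b (λ g → a * h g) k ≈ a * below b h k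
  below-*ˡ true  a h k = trans (+-cong (sumTo-*ˡ k a h) (sym (zeroʳ a))) (sym (distribˡ a _ _))
  below-*ˡ false a h k = trans (+-congʳ (sumTo-*ˡ k a h)) (sym (distribˡ a _ _))

  below-∑ : ∀ {A : Set} b (xs : List A) (f : A → ℕ → Carrier) k →
    below b (λ g → ∑ xs (λ x → f x g)) k ≈ ∑ xs (λ x → below b (f x) k)
  below-∑ true  xs f k = trans (+-cong (sumTo-∑ k xs f) (sym (∑-zero xs))) (sym (∑-+ xs _ _))
  below-∑ false xs f k = trans (+-congʳ (sumTo-∑ k xs f)) (sym (∑-+ xs _ _))

module ChainCounting (R : CommutativeRing 0ℓ 0ℓ) (q Q : CommutativeRing.Carrier R) (n r : ℕ) where

  open CommutativeRing R hiding (zero)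
  open RangeSums R
  open ListSums R
  open SubsetProducts R
  open Chains R q Q
  open ColouredLetters n r
  open Exp semiring using (_^_)
  open CommutativeSemigroupProperties *-commutativeSemigroup using (x∙yz≈y∙xz)
  open SetoidReasoning setoid

  over : Fin n → (Element → Carrier) → Element → Carrier
  over i w v = ⟨ does (proj₁ v Fin.≟ i) ⟩ * w v

  after : Letter → (Element → Carrier) → Element → Carrier
  after ℓ w v = ⟨ does (ℓ ≺? letter v) ⟩ * w v

  -- Expanding the product over i of the sums over L, each choice of one letter
  -- per i ∈ S is accounted for by its ≺-least letter u.
  ∏-least : ∀ (S : Vec Bool n) (N : Fin n → Carrier) (w : Element → Carrier) L → AllPairs _⊏_ L →
    ∏ S (λ i → N i + ∑ L (over i w))
    ≈ ∏ S N + ∑ L (λ u → ⟨ lookup S (proj₁ u) ⟩ * (w u * ∏ (remove S (proj₁ u)) (λ i → N i + ∑ L (over i (after (letter u) w)))))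
  ∏-least S N w []      []         = trans (∏-cong S (λ i → +-identityʳ _)) (sym (+-identityʳ _))
  ∏-least S N w (u ∷ L) (u⊏L ∷ L⊏) = begin
    ∏ S (λ i → N i + (over i w u + ∑ L (over i w)))
      ≈⟨ ∏-cong S (λ i → trans (+-congˡ (+-comm _ _)) (sym (+-assoc _ _ _))) ⟩
    ∏ S (λ i → N i + ∑ L (over i w) + ⟨ does (proj₁ u Fin.≟ i) ⟩ * w u)
      ≈⟨ ∏-update S (proj₁ u) _ (w u) ⟩
    ∏ S (λ i → N i + ∑ L (over i w)) + ⟨ lookup S (proj₁ u) ⟩ * (w u * ∏ (remove S (proj₁ u)) (λ i → N i + ∑ L (over i w)))
      -- Every letter of L comes after u, so the restriction to letters after u excludes only u
      -- itself.
      ≈⟨ +-cong (∏-least S N w L L⊏) (*-congˡ (*-congˡ (∏-cong (remove S (proj₁ u)) (λ i → +-congˡ (head i))))) ⟩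
    ∏ S N + ∑ L _ + _
      ≈⟨ trans (+-assoc _ _ _) (+-congˡ (+-comm _ _)) ⟩
    ∏ S N + (_ + ∑ L _)
      -- For u′ in L the letter u precedes u′, so putting u back into the list adds nothing to the
      -- letters after u′.
      ≈⟨ +-congˡ (+-congˡ (∑-cong-All (All.map (λ {u′} u⊏u′ → *-congˡ (*-congˡ (∏-cong (remove S (proj₁ u′)) (λ i → +-congˡ (sym (tail i u′ u⊏u′)))))) u⊏L))) ⟩
    ∏ S N + ∑ (u ∷ L) (λ u′ → ⟨ lookup S (proj₁ u′) ⟩ * (w u′ * ∏ (remove S (proj₁ u′)) (λ i → N i + ∑ (u ∷ L) (over i (after (letter u′) w))))) ∎
    where
    absent : ∀ i v → ¬ (v ⊏ u) → over i (after (letter v) w) u ≈ 0#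
    absent i v v⊀u = trans (*-congˡ (trans (*-congʳ (⟨⟩-false (letter v ≺? letter u) v⊀u)) (zeroˡ _))) (zeroʳ _)
    head : ∀ i → ∑ L (over i w) ≈ ∑ (u ∷ L) (over i (after (letter u) w))
    head i = begin
      ∑ L (over i w)                              ≈⟨ ∑-cong-All (All.map (λ {v} u⊏v → *-congˡ (trans (sym (*-identityˡ _)) (*-congʳ (sym (⟨⟩-true (letter u ≺? letter v) u⊏v))))) u⊏L) ⟩
      ∑ L (over i (after (letter u) w))           ≈⟨ +-identityˡ _ ⟨
      0# + ∑ L (over i (after (letter u) w))      ≈⟨ +-congʳ (absent i u (≺-irrefl ≡.refl)) ⟨
      ∑ (u ∷ L) (over i (after (letter u) w))     ∎
    tail : ∀ i u′ → u ⊏ u′ → ∑ (u ∷ L) (over i (after (letter u′) w)) ≈ ∑ L (over i (after (letter u′) w))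
    tail i u′ u⊏u′ = trans (+-congʳ (absent i u′ (≺-asym u⊏u′))) (+-identityˡ _)

  weight : ℕ → Element → Carrier
  weight g (_ , c) = q ^ toℕ c * Q ^ g

  beneath : ℕ → Fin n → Carrier
  beneath k i = sumTo k (λ g → ∑ increasing (over i (weight g)))

  -- Total weight of the pairs (g, v) with v over i that may follow (k, ℓ): either
  -- g < k, or g = k and ℓ ≺ v.
  available : Letter → ℕ → Fin n → Carrier
  available ℓ k i = beneath k i + ∑ increasing (over i (after ℓ (weight k)))

  -- The contribution of the selections of one pair per i ∈ S whose first pair is (g, u): each
  -- remaining value gets a pair that may follow (g, u).
  choice : Vec Bool n → Element → ℕ → Carrier
  choice S u g = ⟨ lookup S (proj₁ u) ⟩ * (weight g u * ∏ (remove S (proj₁ u)) (available (letter u) g))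

  -- Selections from the levels below k are sorted by their first pair, `∏-least` handling one level
  -- at a time. S must be nonempty because at k = 0 there are no pairs to select and the right-hand
  -- side is 0.
  ∏-beneath : ∀ (S : Vec Bool n) {m} → count S ≡ suc m → ∀ k →
    ∏ S (beneath k) ≈ sumTo k (λ g → ∑ increasing (λ u → choice S u g))
  ∏-beneath S p zero    = ∏-zero S p
  ∏-beneath S p (suc k) = trans (∏-least S (beneath k) (weight k) increasing increasing-⊏) (+-congʳ (∏-beneath S p k))

  -- The indicator of “σ has no repetition and all its values lie in S”.
  admissible : ∀ {m} → Vec Bool n → Vec (Fin n) m → Carrier
  admissible S []      = 1#
  admissible S (i ∷ σ) = ⟨ lookup S i ⟩ * admissible (remove S i) σ

  spell : ∀ {m} → Vec (Fin r) m → Vec (Fin n) m → Vec Letter m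
  spell c σ = Vec.zipWith (λ i k → suc (toℕ i) ^^ toℕ k) σ c

  wordSum : Letter → Vec Bool n → ℕ → ℕ → Carrier
  wordSum ℓ S m k = ∑ (words (allFin r) m) λ c → ∑ (words (allFin n) m) λ σ → admissible S σ * chains ℓ (spell c σ) k

  -- The first colour and the first value, which come from two separate words, are joined into one
  -- coloured letter u; the rest is interchange of sums.
  wordSum-suc : ∀ ℓ S m k → wordSum ℓ S (suc m) k ≈
    ∑ elements (λ u → ⟨ lookup S (proj₁ u) ⟩ * below (does (letter u ≺? ℓ)) (λ g → weight g u * wordSum (letter u) (remove S (proj₁ u)) m g) k)
  wordSum-suc ℓ S m k = begin
    ∑ (words (allFin r) (suc m)) (λ c → ∑ (words (allFin n) (suc m)) (f c))
      ≈⟨ ∑-words-suc (allFin r) m _ ⟩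
    ∑ (allFin r) (λ c₀ → ∑ W (λ c → ∑ (words (allFin n) (suc m)) (f (c₀ ∷ c))))
      ≈⟨ ∑-cong (allFin r) (λ c₀ → ∑-cong W (λ c → ∑-words-suc (allFin n) m (f (c₀ ∷ c)))) ⟩
    ∑ (allFin r) (λ c₀ → ∑ W (λ c → ∑ (allFin n) (λ i → ∑ V (λ σ → f (c₀ ∷ c) (i ∷ σ)))))
      ≈⟨ ∑-cong (allFin r) (λ c₀ → ∑-swap W (allFin n) (λ c i → ∑ V (λ σ → f (c₀ ∷ c) (i ∷ σ)))) ⟩
    ∑ (allFin r) (λ c₀ → ∑ (allFin n) (λ i → ∑ W (λ c → ∑ V (λ σ → f (c₀ ∷ c) (i ∷ σ)))))
      ≈⟨ ∑-swap (allFin r) (allFin n) (λ c₀ i → ∑ W (λ c → ∑ V (λ σ → f (c₀ ∷ c) (i ∷ σ)))) ⟩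
    ∑ (allFin n) (λ i → ∑ (allFin r) (λ c₀ → ∑ W (λ c → ∑ V (λ σ → f (c₀ ∷ c) (i ∷ σ)))))
      ≈⟨ ∑-cartesianProductWith _,_ (allFin n) (allFin r) (λ u → ∑ W (λ c → ∑ V (λ σ → f (proj₂ u ∷ c) (proj₁ u ∷ σ)))) ⟨
    ∑ elements (λ u → ∑ W (λ c → ∑ V (λ σ → f (proj₂ u ∷ c) (proj₁ u ∷ σ))))
      ≈⟨ ∑-cong elements first ⟩
    ∑ elements (λ u → ⟨ lookup S (proj₁ u) ⟩ * below (does (letter u ≺? ℓ)) (λ g → weight g u * wordSum (letter u) (remove S (proj₁ u)) m g) k) ∎
    where
    W = words (allFin r) m
    V = words (allFin n) m
    f : ∀ {m} → Vec (Fin r) m → Vec (Fin n) m → Carrier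
    f c σ = admissible S σ * chains ℓ (spell c σ) k
    pull : ∀ a (F : Vec (Fin r) m → Vec (Fin n) m → Carrier) → ∑ W (λ c → ∑ V (λ σ → a * F c σ)) ≈ a * ∑ W (λ c → ∑ V (F c))
    pull a F = trans (∑-cong W (λ c → ∑-*ˡ V a (F c))) (∑-*ˡ W a _)
    first : ∀ u → ∑ W (λ c → ∑ V (λ σ → f (proj₂ u ∷ c) (proj₁ u ∷ σ))) ≈
      ⟨ lookup S (proj₁ u) ⟩ * below (does (letter u ≺? ℓ)) (λ g → weight g u * wordSum (letter u) (remove S (proj₁ u)) m g) k
    first u@(i , c₀) = begin
      ∑ W (λ c → ∑ V (λ σ → ⟨ lookup S i ⟩ * A σ * below b (h c σ) k))
        ≈⟨ ∑-cong W (λ c → ∑-cong V (λ σ → trans (*-assoc _ _ _) (*-congˡ (sym (below-*ˡ b (A σ) (h c σ) k))))) ⟩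
      ∑ W (λ c → ∑ V (λ σ → ⟨ lookup S i ⟩ * below b (λ g → A σ * h c σ g) k))
        ≈⟨ pull ⟨ lookup S i ⟩ _ ⟩
      ⟨ lookup S i ⟩ * ∑ W (λ c → ∑ V (λ σ → below b (λ g → A σ * h c σ g) k))
        ≈⟨ *-congˡ (trans (below-∑ b W _ k) (∑-cong W (λ c → below-∑ b V (λ σ g → A σ * h c σ g) k))) ⟨
      ⟨ lookup S i ⟩ * below b (λ g → ∑ W (λ c → ∑ V (λ σ → A σ * h c σ g))) k
        ≈⟨ *-congˡ (below-cong b k (λ g → trans
             (∑-cong W (λ c → ∑-cong V (λ σ → trans (*-congˡ (sym (*-assoc _ _ _))) (x∙yz≈y∙xz _ _ _))))
             (pull (weight g u) (λ c σ → A σ * chains (letter u) (spell c σ) g)))) ⟩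
      ⟨ lookup S i ⟩ * below b (λ g → weight g u * wordSum (letter u) (remove S i) m g) k ∎
      where
      b = does (letter u ≺? ℓ)
      A : Vec (Fin n) m → Carrier
      A = admissible (remove S i)
      h : Vec (Fin r) m → Vec (Fin n) m → ℕ → Carrier
      h c σ g = q ^ toℕ c₀ * (Q ^ g * chains (letter u) (spell c σ) g)

  -- The heart of the count. A selection of one pair (g, letter) per i ∈ S, listed by decreasing g
  -- and then by increasing letters, is a word with a chain that is strict at its descents; so both
  -- sides obey the recursion on the first pair. The condition on ℓ excludes a first letter equal to
  -- ℓ, which would be no descent and yet not come after ℓ.
  wordSum-∏ : ∀ m (S : Vec Bool n) ℓ → count S ≡ m → (∀ u → letter u ≡ ℓ → lookup S (proj₁ u) ≡ false) →
    ∀ k → wordSum ℓ S m k ≈ ∏ S (available ℓ k)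
  wordSum-∏ zero S ℓ p ℓ∉S k = trans (+-identityʳ _) (trans (+-identityʳ _) (trans (*-identityˡ _) (sym (∏-empty S _ p))))
  wordSum-∏ (suc m) S ℓ p ℓ∉S k = begin
    wordSum ℓ S (suc m) k
      ≈⟨ wordSum-suc ℓ S m k ⟩
    ∑ elements (λ u → ⟨ lookup S (proj₁ u) ⟩ * below (does (letter u ≺? ℓ)) (λ g → weight g u * wordSum (letter u) (remove S (proj₁ u)) m g) k)
      -- The induction hypothesis applies to the letter u with its own value removed from S, so the
      -- condition on the preceding letter holds again.
      ≈⟨ ∑-cong elements (λ u → trans (sym (below-*ˡ (does (letter u ≺? ℓ)) _ _ k)) (below-cong (does (letter u ≺? ℓ)) k (λ g →
           ⟨⟩-*-cong (lookup S (proj₁ u)) (λ u∈S → *-congˡ (wordSum-∏ m (remove S (proj₁ u)) (letter u)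
             (ℕ.suc-injective (≡.trans (≡.sym (count-remove S (proj₁ u) u∈S)) p)) (removed u) g))))) ⟩
    ∑ elements (λ u → below (does (letter u ≺? ℓ)) (choice S u) k)
      ≈⟨ ∑-↭ _ increasing-↭ ⟨
    ∑ increasing (λ u → below (does (letter u ≺? ℓ)) (choice S u) k)
      -- Levels g < k make up `∏ S (beneath k)`. Level g = k, forbidden exactly at a descent u ≺ ℓ,
      -- supplies the remaining sum in `∏-least`.
      ≈⟨ ∑-+ increasing _ _ ⟩
    ∑ increasing (λ u → sumTo k (choice S u)) + ∑ increasing (λ u → if does (letter u ≺? ℓ) then 0# else choice S u k)
      ≈⟨ +-cong (trans (sym (sumTo-∑ k increasing (choice S))) (sym (∏-beneath S p k))) (∑-cong increasing same-level) ⟩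
    ∏ S (beneath k) + ∑ increasing (λ u → ⟨ lookup S (proj₁ u) ⟩ * (after ℓ (weight k) u * ∏ (remove S (proj₁ u)) (λ i → beneath k i + ∑ increasing (over i (after (letter u) (after ℓ (weight k)))))))
      ≈⟨ ∏-least S (beneath k) (after ℓ (weight k)) increasing increasing-⊏ ⟨
    ∏ S (available ℓ k) ∎
    where
    removed : ∀ u v → letter v ≡ letter u → lookup (remove S (proj₁ u)) (proj₁ v) ≡ false
    removed u v eq with ≡.refl ← letter-injective {v} {u} eq = Vec.lookup∘updateAt (proj₁ u) S

    same-level : ∀ u → (if does (letter u ≺? ℓ) then 0# else choice S u k) ≈
      ⟨ lookup S (proj₁ u) ⟩ * (after ℓ (weight k) u * ∏ (remove S (proj₁ u)) (λ i → beneath k i + ∑ increasing (over i (after (letter u) (after ℓ (weight k))))))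
    same-level u with ≺-compare (letter u) ℓ
    ... | tri< u≺ℓ _ ℓ⊀u rewrite dec-true (letter u ≺? ℓ) u≺ℓ = sym (trans (*-congˡ (trans (*-congʳ (trans (*-congʳ (⟨⟩-false (ℓ ≺? letter u) ℓ⊀u)) (zeroˡ _))) (zeroˡ _))) (zeroʳ _))
    ... | tri≈ u⊀ℓ eq _ rewrite dec-false (letter u ≺? ℓ) u⊀ℓ | ℓ∉S u eq = trans (zeroˡ _) (sym (zeroˡ _))
    -- Whatever comes after u also comes after ℓ, so the nested `after` collapses.
    ... | tri> u⊀ℓ _ ℓ≺u rewrite dec-false (letter u ≺? ℓ) u⊀ℓ = *-congˡ (*-cong
      (sym (trans (*-congʳ (⟨⟩-true (ℓ ≺? letter u) ℓ≺u)) (*-identityˡ _)))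
      (∏-cong (remove S (proj₁ u)) (λ i → +-congˡ (∑-cong increasing (λ v → *-congˡ (later v))))))
      where
      later : ∀ v → after (letter u) (weight k) v ≈ after (letter u) (after ℓ (weight k)) v
      later v with letter u ≺? letter v
      ... | yes u≺v = *-congˡ (sym (trans (*-congʳ (⟨⟩-true (ℓ ≺? letter v) (≺-trans ℓ≺u u≺v))) (*-identityˡ _)))
      ... | no _    = trans (zeroˡ _) (sym (zeroˡ _))

  admissible-unique : ∀ {m} (S : Vec Bool n) (σ : Vec (Fin n) m) → Unique σ → VecAll.All (λ i → lookup S i ≡ true) σ → admissible S σ ≈ 1#
  admissible-unique S []      _          _                     = refl
  admissible-unique S (i ∷ σ) (i∉σ ∷ σ!) (i∈S VecAll.∷ σ⊆S) = begin
    ⟨ lookup S i ⟩ * admissible (remove S i) σ    ≈⟨ *-cong (reflexive (≡.cong ⟨_⟩ i∈S)) (admissible-unique (remove S i) σ σ! (VecAll.map kept (VecAll.zip (i∉σ , σ⊆S)))) ⟩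
    1# * 1#                                       ≈⟨ *-identityˡ 1# ⟩
    1#                                            ∎
    where
    kept : ∀ {j} → i ≢ j × lookup S j ≡ true → lookup (remove S i) j ≡ true
    kept {j} (i≢j , j∈S) = ≡.trans (Vec.lookup∘updateAt′ j i (i≢j ∘ ≡.sym) S) j∈S

  -- Each indicator is 0 or 1. If none is 0, every later value survives the removal of i, hence
  -- differs from i.
  admissible-dichotomy : ∀ {m} (S : Vec Bool n) (σ : Vec (Fin n) m) →
    admissible S σ ≈ 0# ⊎ (Unique σ × VecAll.All (λ i → lookup S i ≡ true) σ)
  admissible-dichotomy S []      = inj₂ ([] , VecAll.[])
  admissible-dichotomy S (i ∷ σ) with lookup S i in i∈S | admissible-dichotomy (remove S i) σ
  ... | false | _                 = inj₁ (zeroˡ _)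
  ... | true  | inj₁ σ≈0          = inj₁ (trans (*-congˡ σ≈0) (zeroʳ _))
  ... | true  | inj₂ (σ! , σ⊆S-i) = inj₂ (VecAll.map distinct σ⊆S-i ∷ σ! , i∈S VecAll.∷ VecAll.map member σ⊆S-i)
    where
    distinct : ∀ {j} → lookup (remove S i) j ≡ true → i ≢ j
    distinct p ≡.refl with () ← ≡.trans (≡.sym p) (Vec.lookup∘updateAt i S)
    member : ∀ {j} → lookup (remove S i) j ≡ true → lookup S j ≡ true
    member {j} p = ≡.trans (≡.sym (Vec.lookup∘updateAt′ j i (distinct p ∘ ≡.sym) S)) p

  unique-admissible : ∀ (σ : Vec (Fin n) n) → ⟨ does (unique? σ) ⟩ ≈ admissible (Vec.replicate n true) σ
  unique-admissible σ with unique? σ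
  ... | yes σ! = sym (admissible-unique _ σ σ! (VecAll.universal (λ i → Vec.lookup-replicate i true) σ))
  ... | no ¬σ! with admissible-dichotomy (Vec.replicate n true) σ
  ...   | inj₁ σ≈0      = sym σ≈0
  ...   | inj₂ (σ! , _) = contradiction σ! ¬σ!

  -- The filter by `unique?` becomes the factor `admissible` for the full set, and 𝟎 is the letter
  -- of no element, so `wordSum-∏` applies.
  G-sum : ∀ k → ∑ (G r n) (λ γ → chains 𝟎 (spell (proj₁ γ) (proj₂ γ)) k) ≈ ∏ (Vec.replicate n true) (available 𝟎 k)
  G-sum k = begin
    ∑ (G r n) (λ γ → chains 𝟎 (spell (proj₁ γ) (proj₂ γ)) k)
      ≈⟨ ∑-cartesianProductWith _,_ (words (allFin r) n) (List.filter unique? (words (allFin n) n)) _ ⟩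
    ∑ (words (allFin r) n) (λ c → ∑ (List.filter unique? (words (allFin n) n)) (λ σ → chains 𝟎 (spell c σ) k))
      ≈⟨ ∑-cong (words (allFin r) n) (λ c → trans (∑-filter unique? (words (allFin n) n) _)
           (∑-cong (words (allFin n) n) (λ σ → *-congʳ (unique-admissible σ)))) ⟩
    wordSum 𝟎 (Vec.replicate n true) n k
      ≈⟨ wordSum-∏ n (Vec.replicate n true) 𝟎 (count-full n) (λ u ()) k ⟩
    ∏ (Vec.replicate n true) (available 𝟎 k) ∎

  ∑-over : ∀ i w → ∑ increasing (over i w) ≈ ∑ (allFin r) (λ c → w (i , c))
  ∑-over i w = begin
    ∑ increasing (over i w)
      ≈⟨ ∑-↭ _ increasing-↭ ⟩
    ∑ elements (over i w)
      ≈⟨ ∑-cartesianProductWith _,_ (allFin n) (allFin r) (over i w) ⟩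
    ∑ (allFin n) (λ j → ∑ (allFin r) (λ c → ⟨ does (j Fin.≟ i) ⟩ * w (j , c)))
      ≈⟨ ∑-cong (allFin n) (λ j → ∑-*ˡ (allFin r) ⟨ does (j Fin.≟ i) ⟩ (λ c → w (j , c))) ⟩
    ∑ (allFin n) (λ j → ⟨ does (j Fin.≟ i) ⟩ * ∑ (allFin r) (λ c → w (j , c)))
      ≈⟨ ∑-select n i (λ j → ∑ (allFin r) (λ c → w (j , c))) ⟩
    ∑ (allFin r) (λ c → w (i , c)) ∎

module ChainTotals (R : CommutativeRing 0ℓ 0ℓ) (q : CommutativeRing.Carrier R) (n r′ : ℕ) where

  open CommutativeRing R hiding (zero)
  open Exp semiring using (_^_)
  private
    Q = q ^ suc r′
  open RangeSums R
  open ListSums R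
  open ChainCounting R q Q n (suc r′)
  open IntegerSolver R
  open SetoidReasoning setoid

  geometric : ∀ r → (1# - q) * ∑ (allFin r) (λ c → q ^ toℕ c) ≈ 1# - q ^ r
  geometric zero    = solve 1 (λ q → (:1 :- q) :* con (+ 0) := :1 :- :1) refl q
  geometric (suc r) = begin
    (1# - q) * ∑ (allFin (suc r)) (λ c → q ^ toℕ c)           ≈⟨ *-congˡ (trans (∑-allFin-suc r _) (+-congˡ (∑-*ˡ (allFin r) q _))) ⟩
    (1# - q) * (1# + q * ∑ (allFin r) (λ c → q ^ toℕ c))      ≈⟨ solve 2 (λ q s → (:1 :- q) :* (:1 :+ q :* s) := :1 :- q :+ q :* ((:1 :- q) :* s)) refl q _ ⟩
    1# - q + q * ((1# - q) * ∑ (allFin r) (λ c → q ^ toℕ c))  ≈⟨ +-congˡ (*-congˡ (geometric r)) ⟩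
    1# - q + q * (1# - q ^ r)                                 ≈⟨ solve 2 (λ q x → :1 :- q :+ q :* (:1 :- x) := :1 :- q :* x) refl q (q ^ r) ⟩
    1# - q * q ^ r                                            ∎

  -- The exponents rg + d with g < k and d < r are 0, ..., rk-1, each once. The factor 1 - q makes
  -- the geometric sums telescope without division.
  beneath-total : ∀ i k → (1# - q) * beneath k i ≈ 1# - Q ^ k
  beneath-total i zero    = solve 1 (λ q → (:1 :- q) :* con (+ 0) := :1 :- :1) refl q
  beneath-total i (suc k) = begin
    (1# - q) * (beneath k i + ∑ increasing (over i (weight k)))
      ≈⟨ *-congˡ (+-congˡ (trans (∑-over i (weight k)) (trans (∑-cong (allFin (suc r′)) (λ c → *-comm _ _)) (∑-*ˡ (allFin (suc r′)) (Q ^ k) _)))) ⟩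
    (1# - q) * (beneath k i + Q ^ k * ∑ (allFin (suc r′)) (λ c → q ^ toℕ c))
      ≈⟨ solve 4 (λ q b x s → (:1 :- q) :* (b :+ x :* s) := (:1 :- q) :* b :+ x :* ((:1 :- q) :* s)) refl q _ _ _ ⟩
    (1# - q) * beneath k i + Q ^ k * ((1# - q) * ∑ (allFin (suc r′)) (λ c → q ^ toℕ c))
      ≈⟨ +-cong (beneath-total i k) (*-congˡ (geometric (suc r′))) ⟩
    1# - Q ^ k + Q ^ k * (1# - Q)
      ≈⟨ solve 2 (λ Q x → :1 :- x :+ x :* (:1 :- Q) := :1 :- Q :* x) refl Q (Q ^ k) ⟩
    1# - Q * Q ^ k ∎
    where open ColouredLetters n (suc r′) using (increasing)

  -- At level k only the uncoloured letter over i exceeds 𝟎; it contributes Qᵏ = qʳᵏ and completes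
  -- [rk] to [rk+1].
  available-total : ∀ i k → (1# - q) * available 𝟎 k i ≈ 1# - q * Q ^ k
  available-total i k = begin
    (1# - q) * (beneath k i + ∑ increasing (over i (after 𝟎 (weight k))))
      ≈⟨ *-congˡ (+-congˡ (trans (∑-over i (after 𝟎 (weight k))) (trans (∑-allFin-suc r′ _)
           (+-cong (trans (*-identityˡ _) (*-identityˡ _)) (trans (∑-cong (allFin r′) (λ c → zeroˡ _)) (∑-zero (allFin r′))))))) ⟩
    (1# - q) * (beneath k i + (Q ^ k + 0#))
      ≈⟨ solve 3 (λ q b x → (:1 :- q) :* (b :+ (x :+ con (+ 0))) := (:1 :- q) :* b :+ (:1 :- q) :* x) refl q _ _ ⟩
    (1# - q) * beneath k i + (1# - q) * Q ^ k
      ≈⟨ +-congʳ (beneath-total i k) ⟩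
    1# - Q ^ k + (1# - q) * Q ^ k
      ≈⟨ solve 2 (λ q x → :1 :- x :+ (:1 :- q) :* x := :1 :- q :* x) refl q (Q ^ k) ⟩
    1# - q * Q ^ k ∎
    where open ColouredLetters n (suc r′) using (increasing)

-- Descents, major index and colour sum by recursion on words

module WordStatistics where

  descents majorIndex : ∀ {m} → Letter → Vec Letter m → ℕ
  descents ℓ []      = 0
  descents ℓ (x ∷ v) = if does (x ≺? ℓ) then suc (descents x v) else descents x v

  -- Prefixing a letter moves every descent of x ∷ v one place to the right.
  majorIndex ℓ []      = 0
  majorIndex ℓ (x ∷ v) = majorIndex x v ℕ.+ descents x v

  colourSum : ∀ {m} → Vec Letter m → ℕ
  colourSum []              = 0
  colourSum (𝟎 ∷ v)         = colourSum v
  colourSum ((i ^^ c) ∷ v)  = c ℕ.+ colourSum v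

  -- `Des` with any letter ℓ in place of the initial 𝟎, as recursion on the word requires.
  descentList : ∀ {m} → Letter → Vec Letter m → List (Fin m)
  descentList {m} ℓ v = List.filter (λ i → lookup (ℓ ∷ v) (suc i) ≺? lookup (ℓ ∷ v) (inject₁ i)) (allFin m)

  filter-map : ∀ {A B : Set} {P : Pred B 0ℓ} (P? : Decidable P) (f : A → B) xs →
    List.filter P? (List.map f xs) ≡ List.map f (List.filter (λ x → P? (f x)) xs)
  filter-map P? f []       = ≡.refl
  filter-map P? f (x ∷ xs) with does (P? (f x))
  ... | true  = ≡.cong (f x ∷_) (filter-map P? f xs)
  ... | false = filter-map P? f xs

  descentList-suc : ∀ {m} ℓ x (v : Vec Letter m) → descentList ℓ (x ∷ v) ≡
    (if does (x ≺? ℓ) then zero ∷ List.map suc (descentList x v) else List.map suc (descentList x v))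
  descentList-suc {m} ℓ x v = ≡.trans (≡.cong (λ xs → List.filter P? (zero ∷ xs)) (≡.sym (List.map-tabulate (λ i → i) suc))) split
    where
    P? = λ i → lookup (ℓ ∷ x ∷ v) (suc i) ≺? lookup (ℓ ∷ x ∷ v) (inject₁ i)
    split : List.filter P? (zero ∷ List.map suc (allFin m)) ≡
      (if does (x ≺? ℓ) then zero ∷ List.map suc (descentList x v) else List.map suc (descentList x v))
    split with does (x ≺? ℓ)
    ... | true  = ≡.cong (zero ∷_) (filter-map P? suc (allFin m))
    ... | false = filter-map P? suc (allFin m)

  length-descentList : ∀ {m} ℓ (v : Vec Letter m) → List.length (descentList ℓ v) ≡ descents ℓ v
  length-descentList ℓ []      = ≡.refl
  length-descentList ℓ (x ∷ v) rewrite descentList-suc ℓ x v with does (x ≺? ℓ)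
  ... | true  = ≡.cong suc (≡.trans (List.length-map suc (descentList x v)) (length-descentList x v))
  ... | false = ≡.trans (List.length-map suc (descentList x v)) (length-descentList x v)

  sum-map-suc : ∀ {m} (xs : List (Fin m)) → ListAction.sum (List.map toℕ (List.map suc xs)) ≡ ListAction.sum (List.map toℕ xs) ℕ.+ List.length xs
  sum-map-suc []       = ≡.refl
  sum-map-suc (x ∷ xs) = ≡.trans (≡.cong (suc (toℕ x) ℕ.+_) (sum-map-suc xs)) (≡.trans (≡.cong suc (≡.sym (ℕ.+-assoc (toℕ x) _ _))) (≡.sym (ℕ.+-suc _ _)))

  sum-descentList : ∀ {m} ℓ (v : Vec Letter m) → ListAction.sum (List.map toℕ (descentList ℓ v)) ≡ majorIndex ℓ v
  sum-descentList ℓ []      = ≡.refl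
  sum-descentList ℓ (x ∷ v) = ≡.trans leading (≡.trans (sum-map-suc (descentList x v)) (≡.cong₂ ℕ._+_ (sum-descentList x v) (length-descentList x v)))
    where
    -- A descent at the very first place has index 0 and contributes nothing to the sum.
    leading : ListAction.sum (List.map toℕ (descentList ℓ (x ∷ v))) ≡ ListAction.sum (List.map toℕ (List.map suc (descentList x v)))
    leading rewrite descentList-suc ℓ x v with does (x ≺? ℓ)
    ... | true  = ≡.refl
    ... | false = ≡.refl

  word : ∀ {r n} → ColouredWord r n → Vec Letter n
  word (c , σ) = Vec.zipWith (λ i k → suc (toℕ i) ^^ toℕ k) σ c

  des≡ : ∀ {r n} (γ : ColouredWord r n) → des γ ≡ descents 𝟎 (word γ)
  des≡ γ = length-descentList 𝟎 (word γ)

  col≡ : ∀ {r n m} (c : Vec (Fin r) m) (σ : Vec (Fin n) m) →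
    Vec.sum (Vec.map toℕ c) ≡ colourSum (Vec.zipWith (λ i k → suc (toℕ i) ^^ toℕ k) σ c)
  col≡ []      []      = ≡.refl
  col≡ (k ∷ c) (i ∷ σ) = ≡.cong (toℕ k ℕ.+_) (col≡ c σ)

  fmaj≡ : ∀ {r n} (γ : ColouredWord r n) → fmaj γ ≡ r ℕ.* majorIndex 𝟎 (word γ) ℕ.+ colourSum (word γ)
  fmaj≡ {r} (c , σ) = ≡.cong₂ (λ a b → r ℕ.* a ℕ.+ b) (sum-descentList 𝟎 (word (c , σ))) (col≡ c σ)

-- The generating function in Z of the chains over a fixed word

module ChainSeries (F : Field) (q Q : Field.Carrier F) where

  open Field F
  open RationalFunctions F using (PowerSeries; _≋_; Poly; polyRing; _*ₚ_; 1ₚ)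
  open SeriesModule F
  open Constants F
  open WordStatistics
  open Chains commutativeRing q Q
  open RangeSums commutativeRing using (sumTo)
  open Exp semiring using (^-homo-*)
  open CommutativeExp commutativeSemiring using (^-distrib-*)
  open IntegerSolver commutativeRing

  -- (wZ; Q)ₘ as a polynomial in Z
  pochhammerPoly : ℕ → Carrier → Poly
  pochhammerPoly zero    w = 1ₚ
  pochhammerPoly (suc m) w = linearFactor w *ₚ pochhammerPoly m (w * Q)

  shiftBy : ℕ → PowerSeries → PowerSeries
  shiftBy zero    s = s
  shiftBy (suc d) s = shift (shiftBy d s)

  shiftBy-cong : ∀ d {s t} → s ≋ t → shiftBy d s ≋ shiftBy d t
  shiftBy-cong zero    p = p
  shiftBy-cong (suc d) p = shift-cong (shiftBy-cong d p)

  shiftBy-⊙ : ∀ d a s → shiftBy d (a ⊙ s) ≋ a ⊙ shiftBy d s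
  shiftBy-⊙ zero    a s = ≋-refl
  shiftBy-⊙ (suc d) a s = ≋-trans (shift-cong (shiftBy-⊙ d a s)) (shift-⊙ a (shiftBy d s))

  -- `shift` is the action of Z, that is of `0# ∷ 1ₚ`, and polynomial actions commute.
  ▷-shift : ∀ f s → f ▷ shift s ≋ shift (f ▷ s)
  ▷-shift f s = begin
    f ▷ shift s                       ≈⟨ ▷-congˡ f (≋-trans (0∷-▷ 1ₚ s) (shift-cong (1-▷ s))) ⟨
    f ▷ (0# ∷ 1ₚ) ▷ s                 ≈⟨ ▷-comm f (0# ∷ 1ₚ) s ⟩
    (0# ∷ 1ₚ) ▷ f ▷ s                 ≈⟨ ≋-trans (0∷-▷ 1ₚ (f ▷ s)) (shift-cong (1-▷ (f ▷ s))) ⟩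
    shift (f ▷ s)                     ∎
    where open SetoidReasoning seriesSetoid

  -- Multiplication by 1 - wZ takes differences of consecutive terms and so undoes the partial sums
  -- over g ≤ k.
  linearFactor-weak : ∀ w h → linearFactor w ▷ (λ k → w ^ k * below false h k) ≋ λ k → w ^ k * h k
  linearFactor-weak w h zero = solve 1 (λ x → :1 :* (:1 :* (con (+ 0) :+ x)) :+ con (+ 0) := :1 :* x) refl (h 0)
  linearFactor-weak w h (suc k) = trans (linearFactor-▷ w (λ k → w ^ k * below false h k) k)
    (solve 5 (λ w p s x y → w :* p :* (s :+ x :+ y) :- w :* (p :* (s :+ x)) := w :* p :* y) refl w (w ^ k) (sumTo k h) (h k) (h (suc k)))

  -- With g < k the partial sums lag one step behind the weak ones. The resulting factor wZ is where
  -- each descent gets its Z.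
  linearFactor-strict : ∀ w h → linearFactor w ▷ (λ k → w ^ k * below true h k) ≋ w ⊙ shift (λ k → w ^ k * h k)
  linearFactor-strict w h zero = solve 1 (λ w → :1 :* (:1 :* (con (+ 0) :+ con (+ 0))) :+ con (+ 0) := w :* con (+ 0)) refl w
  linearFactor-strict w h (suc k) = trans (linearFactor-▷ w (λ k → w ^ k * below true h k) k)
    (solve 4 (λ w p s x → w :* p :* (s :+ x :+ con (+ 0)) :- w :* (p :* (s :+ con (+ 0))) := w :* (p :* x)) refl w (w ^ k) (sumTo k h) (h k))

  -- The extra parameter w stands for the substitution Z ↦ wZ: removing the
  -- first letter of the word replaces w by wQ.
  chains-series : ∀ {m} w ℓ (v : Vec Letter m) → pochhammerPoly (suc m) w ▷ (λ k → w ^ k * chains ℓ v k)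
    ≋ shiftBy (descents ℓ v) ((w ^ descents ℓ v * (Q ^ majorIndex ℓ v * q ^ colourSum v)) ⊙ 𝟙)
  chains-series w ℓ [] = begin
    (linearFactor w *ₚ 1ₚ) ▷ (λ k → w ^ k * 1#)           ≈⟨ ▷-congʳ (linearFactor w *ₚ 1ₚ) (linearFactor w) _ (CommutativeRing.*-identityʳ polyRing (linearFactor w)) ⟩
    linearFactor w ▷ (λ k → w ^ k * 1#)                   ≈⟨ ▷-congˡ (linearFactor w) (λ k → *-identityʳ (w ^ k)) ⟩
    linearFactor w ▷ (w ^_)                               ≈⟨ geometric w ⟩
    𝟙                                                     ≈⟨ (λ k → trans (*-congʳ (trans (*-identityˡ _) (*-identityˡ 1#))) (*-identityˡ _)) ⟨
    (1# * (1# * 1#)) ⊙ 𝟙                                  ∎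
    where open SetoidReasoning seriesSetoid
  chains-series {suc m} w ℓ (x ∷ v) = begin
    (linearFactor w *ₚ P) ▷ s                 ≈⟨ *-▷ (linearFactor w) P s ⟩
    linearFactor w ▷ P ▷ s                    ≈⟨ ▷-comm (linearFactor w) P s ⟩
    P ▷ linearFactor w ▷ s                    ≈⟨ step (does (x ≺? ℓ)) ⟩
    shiftBy (if does (x ≺? ℓ) then suc d else d) ((w ^ (if does (x ≺? ℓ) then suc d else d) * (Q ^ (M ℕ.+ d) * q ^ colourSum (x ∷ v))) ⊙ 𝟙) ∎
    where
    open SetoidReasoning seriesSetoid
    P = pochhammerPoly (suc m) (w * Q)
    s : PowerSeries
    s k = w ^ k * chains ℓ (x ∷ v) k
    h : ℕ → Carrier
    h g = q ^ colour x * (Q ^ g * chains x v g)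
    d = descents x v
    M = majorIndex x v
    e = w ^ d * (Q ^ (M ℕ.+ d) * q ^ colourSum (x ∷ v))

    colourSum-suc : ∀ x {m} (v : Vec Letter m) → q ^ colourSum (x ∷ v) ≈ q ^ colour x * q ^ colourSum v
    colourSum-suc 𝟎        v = sym (*-identityˡ _)
    colourSum-suc (i ^^ c) v = ^-homo-* q c _

    -- The factor Qᵈ of (wQ)ᵈ is the summand d by which the major index grows when a letter is put
    -- in front.
    exponents : q ^ colour x * ((w * Q) ^ d * (Q ^ M * q ^ colourSum v)) ≈ e
    exponents = trans (*-congˡ (*-congʳ (^-distrib-* w Q d))) (trans
      (solve 5 (λ a wd Qd QM c → a :* (wd :* Qd :* (QM :* c)) := wd :* (QM :* Qd :* (a :* c))) refl (q ^ colour x) (w ^ d) (Q ^ d) (Q ^ M) (q ^ colourSum v))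
      (*-congˡ (sym (*-cong (^-homo-* Q M d) (colourSum-suc x v)))))

    weak : P ▷ (λ k → w ^ k * h k) ≋ shiftBy d (e ⊙ 𝟙)
    weak = begin
      P ▷ (λ k → w ^ k * h k)
        ≈⟨ ▷-congˡ P (λ k → trans (solve 4 (λ p a r c → p :* (a :* (r :* c)) := a :* (p :* r :* c)) refl (w ^ k) (q ^ colour x) (Q ^ k) (chains x v k))
             (*-congˡ (*-congʳ (sym (^-distrib-* w Q k))))) ⟩
      P ▷ (q ^ colour x ⊙ (λ k → (w * Q) ^ k * chains x v k))
        ≈⟨ ▷-⊙ P (q ^ colour x) _ ⟩
      q ^ colour x ⊙ (P ▷ (λ k → (w * Q) ^ k * chains x v k))
        ≈⟨ ⊙-congˡ (q ^ colour x) (chains-series (w * Q) x v) ⟩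
      q ^ colour x ⊙ shiftBy d (((w * Q) ^ d * (Q ^ M * q ^ colourSum v)) ⊙ 𝟙)
        ≈⟨ shiftBy-⊙ d (q ^ colour x) _ ⟨
      shiftBy d (q ^ colour x ⊙ (((w * Q) ^ d * (Q ^ M * q ^ colourSum v)) ⊙ 𝟙))
        ≈⟨ shiftBy-cong d (λ k → trans (sym (*-assoc _ _ _)) (*-congʳ exponents)) ⟩
      shiftBy d (e ⊙ 𝟙) ∎

    step : ∀ b → P ▷ linearFactor w ▷ (λ k → w ^ k * below b h k) ≋
      shiftBy (if b then suc d else d) ((w ^ (if b then suc d else d) * (Q ^ (M ℕ.+ d) * q ^ colourSum (x ∷ v))) ⊙ 𝟙)
    step false = ≋-trans (▷-congˡ P (linearFactor-weak w h)) weak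
    step true  = begin
      P ▷ linearFactor w ▷ (λ k → w ^ k * below true h k)
        ≈⟨ ▷-congˡ P (linearFactor-strict w h) ⟩
      P ▷ (w ⊙ shift (λ k → w ^ k * h k))
        ≈⟨ ≋-trans (▷-⊙ P w _) (⊙-congˡ w (▷-shift P _)) ⟩
      w ⊙ shift (P ▷ (λ k → w ^ k * h k))
        ≈⟨ ⊙-congˡ w (shift-cong weak) ⟩
      w ⊙ shiftBy (suc d) (e ⊙ 𝟙)
        ≈⟨ shiftBy-⊙ (suc d) w _ ⟨
      shiftBy (suc d) (w ⊙ (e ⊙ 𝟙))
        ≈⟨ shiftBy-cong (suc d) (λ k → trans (sym (*-assoc _ _ _)) (*-congʳ (sym (*-assoc _ _ _)))) ⟩
      shiftBy (suc d) ((w * w ^ d * (Q ^ (M ℕ.+ d) * q ^ colourSum (x ∷ v))) ⊙ 𝟙) ∎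

-- An indeterminate is neither zero nor a root of unity

module Indeterminate (F : Field) where

  open RationalFunctions F
  open Expansions F
  private
    module F = Field F
    module K = Field fractionField

  ι-^ : ∀ f n → ι (f ^ₚ n) K.≈ ι f K.^ n
  ι-^ f zero    = K.refl
  ι-^ f (suc n) = K.trans (ι-* f (f ^ₚ n)) (K.*-congˡ {ι f} (ι-^ f n))

  X*-constant-term : ∀ f → coeff (X *ₚ f) 0 F.≈ F.0#
  X*-constant-term f = F.trans (coeff-+ (F.0# ·ₚ f) _ 0) (F.trans (F.+-identityʳ _) (F.trans (coeff-· F.0# f 0) (F.zeroˡ _)))

  X≉0 : ¬ (ι X K.≈ K.0#)
  X≉0 p = F.1≉0 (coeff-≈ (ι-injective p) 1)

  Xʲ≉1 : ∀ j → ¬ (ι X K.^ suc j K.≈ K.1#)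
  Xʲ≉1 j p = F.1≉0 (F.trans (F.sym (coeff-≈ (ι-injective {X ^ₚ suc j} (K.trans (ι-^ X (suc j)) p)) 0)) (X*-constant-term (X ^ₚ j)))

-- The case c = 1: the generating polynomial of coloured permutations

module ColouredPermutationMoments (F : Field) (q₀ : Field.Carrier F)
  (q₀≉0 : ¬ (Field._≈_ F q₀ (Field.0# F)))
  (q₀ʲ≉1 : ∀ j → ¬ (Field._≈_ F (Field._^_ F q₀ (suc j)) (Field.1# F)))
  (r′ : ℕ)
  where

  private
    module F = Field F
  open RationalFunctions F using (PowerSeries; _≋_; _ExpandsTo_; ι; fractionField)
  open Constants F
  open Expansions F
  open SeriesModule F
  open ShiftedMoments F q₀ q₀≉0 q₀ʲ≉1 r′ (+ 1)
  open ChainSeries F q₀ Q₀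
  open WordStatistics
  open Chains F.commutativeRing q₀ Q₀ using (chains)
  open ListSums F.commutativeRing using (∑; ∑-cong)
  private
    module S = RationalFunctions F
    module KS = ListSums K.commutativeRing
    module FF = FieldProperties F
    module KP = QPochhammerProperties fractionField
    module QK = QAnalogues fractionField

  ι-pochhammerPoly : ∀ m w → ι (pochhammerPoly m w) K.≈ QK.qPochhammer (Z K.* κ w) Q m
  ι-pochhammerPoly zero    w = K.refl
  ι-pochhammerPoly (suc m) w = begin
    ι (linearFactor w S.*ₚ pochhammerPoly m (w F.* Q₀))
      ≈⟨ ι-* (linearFactor w) (pochhammerPoly m (w F.* Q₀)) ⟩
    ι (linearFactor w) K.* ι (pochhammerPoly m (w F.* Q₀))
      ≈⟨ K.*-cong (ι-linearFactor w) (ι-pochhammerPoly m (w F.* Q₀)) ⟩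
    (K.1# K.- Z K.* κ w) K.* QK.qPochhammer (Z K.* κ (w F.* Q₀)) Q m
      ≈⟨ K.*-congˡ {K.1# K.- Z K.* κ w} (KP.poch-cong Q m (K.trans (K.*-congˡ {Z} (K.trans (κ-* w Q₀) (K.*-congˡ {κ w} (κ-^ q₀ r)))) (K.sym (K.*-assoc Z (κ w) Q)))) ⟩
    (K.1# K.- Z K.* κ w) K.* QK.qPochhammer (Z K.* κ w K.* Q) Q m
      ≈⟨ KP.poch-suc (Z K.* κ w) Q m ⟨
    QK.qPochhammer (Z K.* κ w) Q (suc m) ∎
    where open SetoidReasoning K.setoid

  ⨁ : ∀ {A : Set} → List A → (A → PowerSeries) → PowerSeries
  ⨁ xs s k = ∑ xs (λ x → s x k)

  ▷-⨁ : ∀ {A : Set} f (xs : List A) s → f ▷ ⨁ xs s ≋ ⨁ xs (λ x → f ▷ s x)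
  ▷-⨁ f []       s k = ▷-vanishes f 𝟘 k (λ _ _ → F.refl)
  ▷-⨁ f (x ∷ xs) s   = ≋-trans (▷-⊕ f (s x) (⨁ xs s)) (⊕-cong ≋-refl (▷-⨁ f xs s))

  ExpandsTo-∑ : ∀ {A : Set} (xs : List A) {f s} → (∀ x → f x ExpandsTo s x) → KS.∑ xs f ExpandsTo ⨁ xs s
  ExpandsTo-∑ []       {f} {s} p = ▷⇒ExpandsTo K.0# (⨁ [] s) (≋-sym (1-▷ 𝟘))
  ExpandsTo-∑ (x ∷ xs) {f} {s} p = ExpandsTo-+ {f x} {KS.∑ xs f} (p x) (ExpandsTo-∑ xs {f} {s} p)

  ExpandsTo-Z* : ∀ {f s} → f ExpandsTo s → (Z K.* f) ExpandsTo shift s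
  ExpandsTo-Z* {f} {s} p = ExpandsTo-cong {Z K.* f} K.refl (≋-trans (0∷-▷ S.1ₚ s) (shift-cong (1-▷ s))) (ExpandsTo-ι* S.X {f} p)

  monomial-ExpandsTo : ∀ d e → (Z K.^ d K.* q K.^ e) ExpandsTo shiftBy d ((q₀ F.^ e) ⊙ 𝟙)
  monomial-ExpandsTo zero e = ExpandsTo-cong {κ (q₀ F.^ e)} (K.trans (κ-^ q₀ e) (K.sym (K.*-identityˡ (q K.^ e))))
    (constant-▷ (q₀ F.^ e) 𝟙) (ι-ExpandsTo (q₀ F.^ e ∷ []))
  monomial-ExpandsTo (suc d) e = ExpandsTo-cong {Z K.* (Z K.^ d K.* q K.^ e)} (K.sym (K.*-assoc Z (Z K.^ d) (q K.^ e)))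
    ≋-refl (ExpandsTo-Z* {Z K.^ d K.* q K.^ e} (monomial-ExpandsTo d e))

  generating : ℕ → K.Carrier
  generating n = KS.∑ (G r n) (λ γ → Z K.^ des γ K.* q K.^ fmaj γ)

  module _ (n : ℕ) where

    open ChainCounting F.commutativeRing q₀ Q₀ n r using (available; G-sum)
    open ChainTotals F.commutativeRing q₀ n r′ using (available-total)
    open SubsetProducts F.commutativeRing using (∏-cong; ∏-full)

    -- The series of `chains-series` at w = 1, with its factor wᵏ kept as 1ᵏ.
    chainSeries : ColouredWord r n → PowerSeries
    chainSeries γ k = F.1# F.^ k F.* chains 𝟎 (word γ) k

    1^ : ∀ k → F.1# F.^ k F.≈ F.1#
    1^ zero    = F.refl
    1^ (suc k) = F.trans (F.*-identityˡ _) (1^ k)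

    available≈bracket : ∀ i k → available 𝟎 k i F.≈ QAnalogues.[_]⟨_⟩ F (+ (r ℕ.* k) ℤ.+ + 1) q₀
    available≈bracket i k = FF.*-cancelʳ (F.1# F.- q₀) 1-q₀≉0 (begin
      available 𝟎 k i F.* (F.1# F.- q₀)                     ≈⟨ F.*-comm _ _ ⟩
      (F.1# F.- q₀) F.* available 𝟎 k i                     ≈⟨ available-total i k ⟩
      F.1# F.- q₀ F.* Q₀ F.^ k                              ≈⟨ F.+-congˡ (F.-‿cong (F.trans (F.*-congˡ (Exp.^-assocʳ F.semiring q₀ r k))
                                                                 (Exp.^-congʳ F.semiring q₀ (ℕ.+-comm 1 (r ℕ.* k))))) ⟩
      F.1# F.- q₀ F.^ (r ℕ.* k ℕ.+ 1)                       ≈⟨ FF.÷-*-cancel _ 1-q₀≉0 ⟨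
      QAnalogues.[_]⟨_⟩ F (+ (r ℕ.* k) ℤ.+ + 1) q₀ F.* (F.1# F.- q₀) ∎)
      where open SetoidReasoning F.setoid

    ⨁-chains : ⨁ (G r n) chainSeries ≋ bracketPowers n
    ⨁-chains k = begin
      ∑ (G r n) (λ γ → F.1# F.^ k F.* chains 𝟎 (word γ) k)
        ≈⟨ ∑-cong (G r n) (λ γ → F.trans (F.*-congʳ (1^ k)) (F.*-identityˡ _)) ⟩
      ∑ (G r n) (λ γ → chains 𝟎 (word γ) k)
        ≈⟨ G-sum k ⟩
      _ ≈⟨ ∏-cong (Vec.replicate n _) (λ i → available≈bracket i k) ⟩
      _ ≈⟨ ∏-full n _ ⟩
      bracketPowers n k ∎
      where open SetoidReasoning F.setoid

    statistics : ∀ γ → pochhammerPoly (suc n) F.1# ▷ chainSeries γ ≋ shiftBy (des γ) ((q₀ F.^ fmaj γ) ⊙ 𝟙)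
    statistics γ rewrite des≡ γ | fmaj≡ γ = ≋-trans (chains-series F.1# 𝟎 (word γ)) (shiftBy-cong (descents 𝟎 (word γ)) (λ k → F.*-congʳ (begin
      F.1# F.^ descents 𝟎 (word γ) F.* (Q₀ F.^ M F.* q₀ F.^ C)    ≈⟨ F.trans (F.*-congʳ (1^ (descents 𝟎 (word γ)))) (F.*-identityˡ _) ⟩
      Q₀ F.^ M F.* q₀ F.^ C                                       ≈⟨ F.*-congʳ (Exp.^-assocʳ F.semiring q₀ r M) ⟩
      q₀ F.^ (r ℕ.* M) F.* q₀ F.^ C                               ≈⟨ Exp.^-homo-* F.semiring q₀ (r ℕ.* M) C ⟨
      q₀ F.^ (r ℕ.* M ℕ.+ C)                                      ∎)))
      where
      open SetoidReasoning F.setoid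
      M = majorIndex 𝟎 (word γ)
      C = colourSum (word γ)

    -- (ZQ; Q)ₙ, written with `F.1# F.* Q₀` so that `pochhammerPoly (suc n) F.1#` unfolds to
    -- `linearFactor F.1# *ₚ denominator`.
    denominator : S.Poly
    denominator = pochhammerPoly n (F.1# F.* Q₀)

    ι-denominator : ι denominator K.≈ QK.qPochhammer (Z K.* Q) Q n
    ι-denominator = K.trans (ι-pochhammerPoly n (F.1# F.* Q₀))
      (KP.poch-cong Q n (K.*-congˡ {Z} (K.trans (κ-cong (F.*-identityˡ Q₀)) (κ-^ q₀ r))))

    qPochhammer-nonzero : ¬ (QK.qPochhammer (Z K.* Q) Q n K.≈ K.0#)
    qPochhammer-nonzero = KP.poch-nonzero (Z K.* Q) Q n (λ j _ p → ZQʲ≉1 (suc j) (K.trans (K.sym (K.*-assoc Z Q (Q K.^ j))) p))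

    linearFactor-1 : linearFactor F.1# S.≈ₚ 1-Z
    linearFactor-1 = S.coeffwise λ
      { zero          → F.sym (F.trans (F.+-congˡ (F.trans (F.sym (F.+-identityˡ _)) (F.-‿inverseʳ F.0#))) (F.+-identityʳ F.1#))
      ; (suc zero)    → F.refl
      ; (suc (suc m)) → F.refl }

    generating-series : ⨁ (G r n) (λ γ → shiftBy (des γ) ((q₀ F.^ fmaj γ) ⊙ 𝟙)) ≋ denominator ▷ 1-Z ▷ bracketPowers n
    generating-series = begin
      ⨁ (G r n) (λ γ → shiftBy (des γ) ((q₀ F.^ fmaj γ) ⊙ 𝟙))
        ≈⟨ (λ k → ∑-cong (G r n) (λ γ → statistics γ k)) ⟨
      ⨁ (G r n) (λ γ → pochhammerPoly (suc n) F.1# ▷ chainSeries γ)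
        ≈⟨ ▷-⨁ (pochhammerPoly (suc n) F.1#) (G r n) chainSeries ⟨
      pochhammerPoly (suc n) F.1# ▷ ⨁ (G r n) chainSeries
        ≈⟨ ▷-congˡ (pochhammerPoly (suc n) F.1#) ⨁-chains ⟩
      -- (Z; Q)ₙ₊₁ = (1-Z)(ZQ; Q)ₙ: the first factor is the 1-Z of the moment series, the rest is
      -- the denominator in the theorem.
      (linearFactor F.1# S.*ₚ denominator) ▷ bracketPowers n
        ≈⟨ ≋-trans (*-▷ (linearFactor F.1#) denominator _) (▷-comm (linearFactor F.1#) denominator _) ⟩
      denominator ▷ linearFactor F.1# ▷ bracketPowers n
        ≈⟨ ▷-congˡ denominator (▷-congʳ (linearFactor F.1#) 1-Z (bracketPowers n) linearFactor-1) ⟩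
      denominator ▷ 1-Z ▷ bracketPowers n ∎
      where open SetoidReasoning seriesSetoid

    -- Both sides have the same expansion in Z, so they are equal as rational functions.
    product-formula : ∀ f → f ExpandsTo (1-Z ▷ bracketPowers n) → f K.* QK.qPochhammer (Z K.* Q) Q n K.≈ generating n
    product-formula f p = K.trans (K.*-comm f (QK.qPochhammer (Z K.* Q) Q n)) (K.trans (K.*-congʳ {f} (K.sym ι-denominator))
      (ExpandsTo-injective {ι denominator K.* f} {generating n} (ExpandsTo-ι* denominator {f} p)
        (ExpandsTo-cong {generating n} K.refl generating-series
          (ExpandsTo-∑ (G r n) {λ γ → Z K.^ des γ K.* q K.^ fmaj γ} (λ γ → monomial-ExpandsTo (des γ) (fmaj γ))))))

-- Specialisation to ℚ(q, Z)

open import Defs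
open 𝕂
open 𝕂[x]
open ℚ⟨q,Z⟩ using (_ExpandsTo_)
open Indeterminate ℚ-field using (X≉0; Xʲ≉1)

opaque
  unfolding ShiftedJacobi.shifted

  shifted-orthogonal : ∀ r c φ → IsOrthogonal φ (shiftedJacobi r c) → IsOrthogonal φ (ShiftedJacobi.shifted 𝕂-field q Z r c)
  shifted-orthogonal r c φ orthogonal = orthogonal

÷-unique : ∀ {x y z} → ¬ (z ≈ 0#) → y * z ≈ x → y ≈ x ÷ z
÷-unique = FieldProperties.÷-unique 𝕂-field

product-formula : ∀ r′ φ → IsLinearFunctional φ → φ 1ₚ ≈ 1# → IsOrthogonal φ (ShiftedJacobi.shifted 𝕂-field q Z (suc r′) (+ 1)) →
  ∀ n → φ (X ^ₚ n) * qPochhammer (Z * q ^ suc r′) (q ^ suc r′) n ≈ generatingPolynomial (suc r′) n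
product-formula r′ φ linear φ1≈1 orthogonal n =
  ColouredPermutationMoments.product-formula ℚ⟨q⟩-field q₀ X≉0 Xʲ≉1 r′ n (φ (X ^ₚ n))
    (ShiftedMoments.moments ℚ⟨q⟩-field q₀ X≉0 Xʲ≉1 r′ (+ 1) φ linear φ1≈1 orthogonal n)

qPochhammer-nonzero : ∀ r′ n → ¬ (qPochhammer (Z * q ^ suc r′) (q ^ suc r′) n ≈ 0#)
qPochhammer-nonzero = ColouredPermutationMoments.qPochhammer-nonzero ℚ⟨q⟩-field q₀ X≉0 Xʲ≉1

expansion : ∀ r′ c φ → IsLinearFunctional φ → φ 1ₚ ≈ 1# → IsOrthogonal φ (ShiftedJacobi.shifted 𝕂-field q Z (suc r′) c) →
  ∀ n → φ (X ^ₚ n) ExpandsTo momentSeries (suc r′) c n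
expansion r′ c φ linear φ1≈1 orthogonal = ShiftedMoments.moments-⊛ ℚ⟨q⟩-field q₀ X≉0 Xʲ≉1 r′ c φ linear φ1≈1 orthogonal

theorem1p4 : (r : ℕ) → 1 ≤ r → (c : ℤ) →
    (φ : Poly → Carrier) → IsLinearFunctional φ → φ 1ₚ ≈ 1# →
    IsOrthogonal φ (shiftedJacobi r c) →
    (∀ n → φ (X ^ₚ n) ExpandsTo momentSeries r c n)
    × (c ≡ + 1 → ∀ n → 1 ≤ n → φ (X ^ₚ n) ≈ generatingPolynomial r n ÷ qPochhammer (Z * q ^ r) (q ^ r) n)
theorem1p4 (suc r′) _ c φ linear φ1≈1 orthogonal =
  expansion r′ c φ linear φ1≈1 (shifted-orthogonal (suc r′) c φ orthogonal) ,
  λ { ≡.refl n _ → ÷-unique (qPochhammer-nonzero r′ n)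
        (product-formula r′ φ linear φ1≈1 (shifted-orthogonal (suc r′) c φ orthogonal) n) }
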